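{- Let $G$ be a graph with $\alpha(G)\ge 3$. If $G$ has no induced subgraph isomorphic to $C_k$ for any $k$ with $4\le k\le 2\alpha(G)-1$, then $h(G)\ge \chi(G)$.
   Context: All graphs are finite, without loops or parallel edges. $C_k$ is the cycle on $k$ vertices; $\alpha(G)$ is the independence number and $\chi(G)$ the chromatic number of $G$. A graph $H$ is a minor of $G$ if $H$ can be obtained from a subgraph of $G$ by contracting edges. The Hadwiger number $h(G)$ is the largest integer $k$ such that the complete graph $K_k$ is a minor of $G$. -}

module Defs where

open import Data.Nat using (ℕ; zero; suc; _+_; _∸_; _≤_)
open import Data.Fin using (Fin; toℕ)
open import Data.Bool using (Bool; true; false)
open import Data.Maybe using (Maybe; just)
open import Data.Product using (Σ; ∃; ∃-syntax; _×_; _,_)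
open import Data.Sum using (_⊎_)
open import Function.Definitions using (Injective)
open import Relation.Binary.PropositionalEquality using (_≡_; _≢_)

record Graph (n : ℕ) : Set where
  field
    adj    : Fin n → Fin n → Bool
    sym    : ∀ u v → adj u v ≡ adj v u
    irrefl : ∀ v → adj v v ≡ false
open Graph public

module _ {n : ℕ} (G : Graph n) where

  Adj : Fin n → Fin n → Set
  Adj u v = adj G u v ≡ true

  HasIndependentSet : ℕ → Set
  HasIndependentSet k =
    Σ (Fin k → Fin n) λ f → Injective _≡_ _≡_ f × (∀ i j → adj G (f i) (f j) ≡ false)

  IsIndependenceNumber : ℕ → Set
  IsIndependenceNumber a = HasIndependentSet a × (∀ k → HasIndependentSet k → k ≤ a)

  ProperColouring : (k : ℕ) → (Fin n → Fin k) → Set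
  ProperColouring k c = ∀ u v → Adj u v → c u ≢ c v

  Colourable : ℕ → Set
  Colourable k = Σ (Fin n → Fin k) (ProperColouring k)

  IsChromaticNumber : ℕ → Set
  IsChromaticNumber c = Colourable c × (∀ k → Colourable k → c ≤ k)

  data WalkIn (P : Fin n → Set) : Fin n → Fin n → Set where
    here : ∀ {v} → P v → WalkIn P v v
    step : ∀ {u w v} → P u → Adj u w → WalkIn P w v → WalkIn P u v

  -- A model of a graph H in G: a partial map φ assigning vertices of G to
  -- (pairwise disjoint) branch sets indexed by V(H); each branch set is
  -- nonempty and connected, and every edge of H is realised by an edge of G
  -- between the corresponding branch sets.
  record MinorModel {m : ℕ} (H : Graph m) : Set where
    field
      φ         : Fin n → Maybe (Fin m)
      nonempty  : ∀ i → ∃[ v ] (φ v ≡ just i)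
      connected : ∀ i u v → φ u ≡ just i → φ v ≡ just i →
                  WalkIn (λ w → φ w ≡ just i) u v
      edges     : ∀ i j → adj H i j ≡ true →
                  ∃[ u ] ∃[ v ] (φ u ≡ just i × φ v ≡ just j × Adj u v)

_≼_ : ∀ {m n} → Graph m → Graph n → Set
H ≼ G = MinorModel G H

complete-adj : ∀ {k} → Fin k → Fin k → Bool
complete-adj {suc k} Fin.zero Fin.zero = false
complete-adj {suc k} Fin.zero (Fin.suc j) = true
complete-adj {suc k} (Fin.suc i) Fin.zero = true
complete-adj {suc k} (Fin.suc i) (Fin.suc j) = complete-adj i j

complete-sym : ∀ {k} (i j : Fin k) → complete-adj i j ≡ complete-adj j i
complete-sym Fin.zero Fin.zero = _≡_.refl
complete-sym Fin.zero (Fin.suc j) = _≡_.refl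
complete-sym (Fin.suc i) Fin.zero = _≡_.refl
complete-sym (Fin.suc i) (Fin.suc j) = complete-sym i j

complete-irrefl : ∀ {k} (i : Fin k) → complete-adj i i ≡ false
complete-irrefl Fin.zero = _≡_.refl
complete-irrefl (Fin.suc i) = complete-irrefl i

K : (k : ℕ) → Graph k
K k = record { adj = complete-adj ; sym = complete-sym ; irrefl = complete-irrefl }

IsHadwigerNumber : ∀ {n} → Graph n → ℕ → Set
IsHadwigerNumber G h = (K h ≼ G) × (∀ k → K k ≼ G → k ≤ h)

CycleAdj : (k : ℕ) → Fin k → Fin k → Set
CycleAdj k i j =
  (suc (toℕ i) ≡ toℕ j) ⊎ (suc (toℕ j) ≡ toℕ i) ⊎
  ((toℕ i ≡ 0) × (toℕ j ≡ k ∸ 1)) ⊎ ((toℕ j ≡ 0) × (toℕ i ≡ k ∸ 1))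

HasInducedCycle : ∀ {n} → Graph n → ℕ → Set
HasInducedCycle {n} G k =
  Σ (Fin k → Fin n) λ f → Injective _≡_ _≡_ f ×
    (∀ i j → (Adj G (f i) (f j) → CycleAdj k i j) × (CycleAdj k i j → Adj G (f i) (f j)))

{-# OPTIONS --safe #-}

-- Write t for the bound on the independence number.  By induction on the number of vertices we exhibit a k
-- such that G is k-colourable and has a K_k minor; everything is argued by contradiction, which is harmless
-- because c ≤ h is decidable.  Holes have length 2t or 2t + 1.
--
-- Kempe chains settle a vertex v whose neighbourhood is L ∪ M ∪ R with L ∪ M and M ∪ R cliques and no edges
-- between L and R.  Colour G - v; every colour must occur at v.  Match the colours seen only in R with colours
-- seen only in L (or the other way round).  Each matched pair has a chain from R to L, since otherwise v could
-- be coloured; with v it forms an odd hole, and the bound on the independence number forces every vertex of L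
-- to have a neighbour on the rest of the chain.  So v, the vertices of L ∪ M and the chains without their ends
-- in L are the branch sets of a complete minor with one vertex more than there are colours.
--
-- Without holes there is a simplicial vertex, which is of this kind.  If there are holes but no odd ones, a
-- vertex with inclusion-minimal closed neighbourhood among those on holes is of this kind, unless some vertex is
-- simplicial.  On an odd hole a vertex far from every shortcut is of this kind.  Shortcuts can reach all of an
-- odd hole only for t = 3, and then G is an inflation of the square of the 11-cycle.  There every closed
-- neighbourhood, five consecutive parts, has more vertices than there are colours, which leaves enough room to
-- route disjoint paths around a largest clique.

module Submission where

open import Defs
open import Data.Bool as Bool using (Bool; true; false; if_then_else_)
import Data.Bool.Properties as Boolₚ
open import Data.Empty using (⊥; ⊥-elim)
open import Data.Fin as Fin using (Fin; toℕ; fromℕ<; punchIn; punchOut)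
import Data.Fin.Properties as Finₚ
open import Data.List using (List; []; _∷_; filter; upTo)
open import Data.List.Membership.Propositional using (_∈_; _∉_)
open import Data.List.Membership.Propositional.Properties using (∈-filter⁺; ∈-filter⁻; ∈-upTo⁺; ∈-upTo⁻)
import Data.List.Relation.Unary.All as All
open import Data.List.Relation.Unary.Any using (here; there)
open import Data.List.Relation.Unary.Unique.Propositional using (Unique; []; _∷_)
import Data.List.Relation.Unary.Unique.Propositional.Properties as Uniqueₚ
open import Data.Maybe using (Maybe; just; nothing)
open import Data.Maybe.Properties using (just-injective)
open import Data.Nat
open import Data.Nat.DivMod using (_%_; _/_; m≡m%n+[m/n]*n; m%n<n)
open import Data.Nat.Properties
open import Data.Nat.Tactic.RingSolver using (solve-∀)
open import Data.Product using (Σ; ∃; _×_; _,_; proj₁; proj₂)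
open import Data.Sum using (_⊎_; inj₁; inj₂; [_,_]′)
open import Function.Base using (_∘_; id; case_of_)
open import Relation.Binary.Definitions using (tri<; tri≈; tri>)
open import Relation.Binary.PropositionalEquality as Eq using (_≡_; _≢_; refl; cong; subst; trans) renaming (sym to ≡-sym)
open import Relation.Nullary using (¬_; Dec; yes; no; does; ¬?; _×-dec_; _⊎-dec_)
open import Relation.Nullary.Decidable using (dec-true; decidable-stable)

-- Induced paths and cycles

-- Alternate vertices of a cycle of length at least 2t + 2 are t + 1 independent vertices; hence the
-- two possible lengths. The same count governs a vertex off a hole: with too few neighbours it
-- misses an arc long enough to enlarge an independent set, with scattered ones it closes up a
-- shorter cycle. So it sees the whole hole, or a run of two or three consecutive vertices if the
-- length is 2t, of three or four if it is 2t + 1. A vertex with a run of three is a copy of the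
-- middle one. The obstacles are the other runs. Two runs of two on consecutive edges turn an even
-- hole into an odd one. A run of four is a shortcut: its vertex replaces two vertices of an odd
-- hole and leaves an even one, on which four consecutive neighbours already force all, so that no
-- further run of four lies opposite. On a hole of length seven, two shortcuts at distance two leave
-- a vertex whose only possible defect is an edge between copies of its two neighbours; the seven
-- vertices, the two shortcuts and the ends of that edge are the eleven vertices of the ring.

lastSuch : ∀ {T : ℕ → Set} → (∀ i → Dec (T i)) → ∀ L → T 0 →
  ∃ λ b → ∃ λ r → b + r ≡ L × T b × (∀ j → j < r → ¬ T (suc j + b))
lastSuch T? zero t0 = 0 , 0 , refl , t0 , λ _ ()
lastSuch {T} T? (suc L) t0 with T? (suc L)
... | yes t = suc L , 0 , +-identityʳ _ , t , λ _ ()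
... | no ¬t with lastSuch T? L t0
...   | b , r , eq , tb , none = b , suc r , trans (+-suc b r) (cong suc eq) , tb , none′
  where
  none′ : ∀ j → j < suc r → ¬ _
  none′ j j<sr with m≤n⇒m<n∨m≡n (≤-pred j<sr)
  ... | inj₁ j<r = none j j<r
  ... | inj₂ refl = λ t → ¬t (subst T (cong suc (trans (+-comm r b) eq)) t)

module Adjacency {n : ℕ} (G : Graph n) where

  infix 4 _~_ _≁_ _~?_
  _~_ _≁_ : Fin n → Fin n → Set
  _~_ = Adj G
  x ≁ y = ¬ (x ~ y)

  _~?_ : ∀ x y → Dec (x ~ y)
  x ~? y = adj G x y Bool.≟ true

  ~-sym : ∀ {x y} → x ~ y → y ~ x
  ~-sym {x} {y} p = trans (Graph.sym G y x) p

  ≁-sym : ∀ {x y} → x ≁ y → y ≁ x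
  ≁-sym p q = p (~-sym q)

  ~-irrefl : ∀ {x} → x ≁ x
  ~-irrefl {x} p with trans (≡-sym p) (irrefl G x)
  ... | ()

  ~-stable : ∀ {x y} → ¬ (x ≁ y) → x ~ y
  ~-stable {x} {y} = decidable-stable (x ~? y)

  ~⇒≢ : ∀ {x y} → x ~ y → x ≢ y
  ~⇒≢ p refl = ~-irrefl p

  ≁⇒false : ∀ {x y} → x ≁ y → adj G x y ≡ false
  ≁⇒false = Boolₚ.¬-not

module _ {n : ℕ} (G : Graph n) where
  open Adjacency G

  private
    V : Set
    V = Fin n

  -- Paths are sequences on all of ℕ with arbitrary values beyond `len`, so that suffixes,
  -- extensions and arcs of cycles are mere reindexings.
  record IsInducedPath (len : ℕ) (p : ℕ → V) : Set where
    field
      edge      : ∀ i → i < len → p i ~ p (suc i)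
      chordless : ∀ i j → 2 + i ≤ j → j ≤ len → p i ≁ p j
      distinct  : ∀ i j → i < j → j ≤ len → p i ≢ p j
  open IsInducedPath

  record InducedPath (P : V → Set) (x y : V) : Set where
    field
      len     : ℕ
      at      : ℕ → V
      start   : at 0 ≡ x
      end     : at len ≡ y
      within  : ∀ i → i ≤ len → P (at i)
      induced : IsInducedPath len at

  cons : V → (ℕ → V) → ℕ → V
  cons v p zero = v
  cons v p (suc i) = p i

  cons-induced : ∀ {len v p} → IsInducedPath len p → v ~ p 0 →
    (∀ i → i < len → v ≁ p (suc i)) → (∀ i → i ≤ len → v ≢ p i) →
    IsInducedPath (suc len) (cons v p)
  cons-induced ip v~ v≁ v≢ .edge zero _ = v~
  cons-induced ip v~ v≁ v≢ .edge (suc i) (s≤s i<) = ip .edge i i<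
  cons-induced ip v~ v≁ v≢ .chordless zero (suc (suc j)) (s≤s _) (s≤s j≤) = v≁ j j≤
  cons-induced ip v~ v≁ v≢ .chordless zero (suc zero) (s≤s ()) _
  cons-induced ip v~ v≁ v≢ .chordless (suc i) (suc j) (s≤s h) (s≤s j≤) = ip .chordless i j h j≤
  cons-induced ip v~ v≁ v≢ .distinct zero (suc j) _ (s≤s j≤) = v≢ j j≤
  cons-induced ip v~ v≁ v≢ .distinct (suc i) (suc j) (s≤s h) (s≤s j≤) = ip .distinct i j h j≤

  suffix-induced : ∀ {len p} k r → k + r ≡ len → IsInducedPath len p → IsInducedPath r (λ i → p (i + k))
  suffix-induced k r refl ip .edge i i<r = ip .edge (i + k) (subst (i + k <_) (+-comm r k) (+-monoˡ-< k i<r))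
  suffix-induced k r refl ip .chordless i j h j≤r =
    ip .chordless (i + k) (j + k) (+-monoˡ-≤ k h) (subst (j + k ≤_) (+-comm r k) (+-monoˡ-≤ k j≤r))
  suffix-induced k r refl ip .distinct i j h j≤r =
    ip .distinct (i + k) (j + k) (+-monoˡ-≤ k h) (subst (j + k ≤_) (+-comm r k) (+-monoˡ-≤ k j≤r))

  abstract
    -- By induction on the walk: a new first vertex jumps to the last vertex of the path that it
    -- equals or sees.
    walk⇒inducedPath : ∀ {P x y} → WalkIn G P x y → InducedPath P x y
    walk⇒inducedPath {x = x} (here px) = record
      { len = 0 ; at = λ _ → x ; start = refl ; end = refl ; within = λ _ _ → px
      ; induced = record
          { edge = λ _ () ; chordless = λ { i .0 () z≤n } ; distinct = λ { i .0 () z≤n } } }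
    walk⇒inducedPath {P} {x} {y} (step px x~w walk)
      with walk⇒inducedPath walk
    ... | q with lastSuch (λ i → (x Finₚ.≟ InducedPath.at q i) ⊎-dec (x ~? InducedPath.at q i))
                     (InducedPath.len q) (inj₂ (subst (x ~_) (≡-sym (InducedPath.start q)) x~w))
    ... | k , r , eq , inj₁ x≡ , none = record
      { len = r ; at = λ i → q.at (i + k) ; start = ≡-sym x≡
      ; end = trans (cong q.at (trans (+-comm r k) eq)) q.end
      ; within = λ i i≤ → q.within (i + k) (subst (i + k ≤_) (trans (+-comm r k) eq) (+-monoˡ-≤ k i≤))
      ; induced = suffix-induced k r eq q.induced }
      where module q = InducedPath q
    ... | k , r , eq , inj₂ x~ , none = record
      { len = suc r ; at = cons x (λ i → q.at (i + k)) ; start = refl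
      ; end = trans (cong q.at (trans (+-comm r k) eq)) q.end
      ; within = λ { zero _ → px
                   ; (suc i) (s≤s i≤) → q.within (i + k) (subst (i + k ≤_) (trans (+-comm r k) eq) (+-monoˡ-≤ k i≤)) }
      ; induced = cons-induced (suffix-induced k r eq q.induced) x~ (λ i i< → none i i< ∘ inj₂)
                    λ { zero _ → ~⇒≢ x~ ; (suc i) i< → none i i< ∘ inj₁ } }
      where module q = InducedPath q

  -- The induced cycle v, p 0, …, p ℓ, indexed from v.
  record IsApex (v : V) (ℓ : ℕ) (p : ℕ → V) : Set where
    field
      2≤ℓ    : 2 ≤ ℓ
      path   : IsInducedPath ℓ p
      first  : v ~ p 0
      final  : v ~ p ℓ
      middle : ∀ i → 0 < i → i < ℓ → v ≁ p i
      off    : ∀ i → i ≤ ℓ → v ≢ p i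

  -- A cycle of length m as an m-periodic sequence, so that rotating is shifting the index.
  record Hole (m : ℕ) : Set where
    field
      c    : ℕ → V
      per  : ∀ i → c (m + i) ≡ c i
      link : ∀ i → c i ~ c (suc i)
      far  : ∀ i d → 2 ≤ d → 2 + d ≤ m → c i ≁ c (d + i)

  module _ {v ℓ p} (ap : IsApex v ℓ p) where
    open IsApex ap

    private
      q : ℕ → V
      q = cons v p

      q-edge : ∀ r → r < suc ℓ → q r ~ q (suc r)
      q-edge zero _ = first
      q-edge (suc r) (s≤s r<) = path .edge r r<

      q-far : ∀ r d → 2 ≤ d → d ≤ ℓ → d + r < 2 + ℓ → q r ≁ q (d + r)
      q-far zero (suc d) (s≤s 1≤d) d≤ℓ _ rewrite +-identityʳ d = middle d 1≤d d≤ℓ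
      q-far (suc r) d 2≤d _ (s≤s h) rewrite +-suc d r = path .chordless r (d + r) (+-monoˡ-≤ r 2≤d) (≤-pred h)

      next : ℕ → ℕ
      next r with r ≟ suc ℓ
      ... | yes _ = 0
      ... | no _ = suc r

      pos : ℕ → ℕ
      pos zero = 0
      pos (suc i) = next (pos i)

      pos< : ∀ i → pos i < 2 + ℓ
      pos< zero = s≤s z≤n
      pos< (suc i) with pos i ≟ suc ℓ
      ... | yes _ = s≤s z≤n
      ... | no ne = s≤s (≤∧≢⇒< (≤-pred (pos< i)) ne)

      -- At most one full turn passes the seam at `v` at most once; the wrapped case is stated
      -- additively to avoid subtraction.
      advance : ∀ d i → d ≤ 2 + ℓ → (pos (d + i) ≡ d + pos i) ⊎ (2 + ℓ + pos (d + i) ≡ d + pos i)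
      advance zero i _ = inj₁ refl
      advance (suc d) i d< with pos (d + i) ≟ suc ℓ | advance d i (<⇒≤ d<)
      ... | yes eq | inj₁ a = inj₂ (trans (+-identityʳ _) (cong suc (trans (≡-sym eq) a)))
      ... | yes eq | inj₂ a = ⊥-elim (<-irrefl (≡-sym a)
              (subst (λ z → d + pos i < 2 + ℓ + z) (≡-sym eq) (≤-<-trans (+-monoʳ-≤ d (≤-pred (pos< i))) (+-monoˡ-< (suc ℓ) d<))))
      ... | no _ | inj₁ a = inj₁ (cong suc a)
      ... | no _ | inj₂ a = inj₂ (trans (+-suc (2 + ℓ) (pos (d + i))) (cong suc a))

      pos-id : ∀ j → j ≤ suc ℓ → pos j ≡ j
      pos-id zero _ = refl
      pos-id (suc j) h rewrite pos-id j (<⇒≤ h) with j ≟ suc ℓ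
      ... | yes refl = ⊥-elim (<-irrefl refl h)
      ... | no _ = refl

      pos-wrap : pos (2 + ℓ) ≡ 0
      pos-wrap rewrite pos-id (suc ℓ) ≤-refl with suc ℓ ≟ suc ℓ
      ... | yes _ = refl
      ... | no ne = ⊥-elim (ne refl)

      pos-per : ∀ i → pos (2 + ℓ + i) ≡ pos i
      pos-per zero = trans (cong pos (+-identityʳ (2 + ℓ))) pos-wrap
      pos-per (suc i) = trans (cong pos (+-suc (2 + ℓ) i)) (cong next (pos-per i))

      pos-edge : ∀ i → q (pos i) ~ q (next (pos i))
      pos-edge i with pos i ≟ suc ℓ
      ... | yes eq = subst (λ z → q z ~ v) (≡-sym eq) (~-sym final)
      ... | no ne = q-edge (pos i) (≤∧≢⇒< (≤-pred (pos< i)) ne)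

    abstract
      apexHole : Hole (2 + ℓ)
      apexHole = record
        { c = λ i → q (pos i)
        ; per = λ i → cong q (pos-per i)
        ; link = pos-edge
        ; far = far }
        where
        far : ∀ i d → 2 ≤ d → 2 + d ≤ 2 + ℓ → q (pos i) ≁ q (pos (d + i))
        far i d 2≤d d≤ with advance d i (≤-trans (m≤n+m d 2) d≤)
        ... | inj₁ a rewrite a = q-far (pos i) d 2≤d (≤-pred (≤-pred d≤)) (subst (_< 2 + ℓ) a (pos< (d + i)))
        -- Past the seam the two vertices occur in the opposite order and are compared along the
        -- complementary arc, of `2 + ℓ ∸ d` steps.
        ... | inj₂ a = subst (λ z → q z ≁ q (pos (d + i))) (≡-sym pi≡)
                (≁-sym (q-far (pos (d + i)) d′ 2≤d′ d′≤ℓ (subst (_< 2 + ℓ) pi≡ (pos< i))))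
          where
          d≤m : d ≤ 2 + ℓ
          d≤m = ≤-trans (m≤n+m d 2) d≤
          d′ : ℕ
          d′ = 2 + ℓ ∸ d
          2≤d′ : 2 ≤ d′
          2≤d′ = subst (_≤ d′) (m+n∸n≡m 2 d) (∸-monoˡ-≤ d d≤)
          d′≤ℓ : d′ ≤ ℓ
          d′≤ℓ = ∸-monoʳ-≤ (2 + ℓ) 2≤d
          pi≡ : pos i ≡ d′ + pos (d + i)
          pi≡ = +-cancelˡ-≡ d _ _ (trans (≡-sym a) (trans (cong (_+ pos (d + i)) (≡-sym (m+[n∸m]≡n d≤m))) (+-assoc d d′ _)))

      apexHole-0 : Hole.c apexHole 0 ≡ v
      apexHole-0 = refl

      apexHole-suc : ∀ j → j ≤ ℓ → Hole.c apexHole (suc j) ≡ p j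
      apexHole-suc j j≤ = cong q (pos-id (suc j) (s≤s j≤))

    apexCycle : HasInducedCycle G (2 + ℓ)
    apexCycle = (λ i → q (toℕ i)) , inj , λ i j → to (toℕ i) (toℕ j) (≤-pred (Finₚ.toℕ<n i)) (≤-pred (Finₚ.toℕ<n j)) , from i j
      where
      q-distinct : ∀ i j → i < j → j ≤ suc ℓ → q i ≢ q j
      q-distinct zero (suc j) _ (s≤s j≤) = off j j≤
      q-distinct (suc i) (suc j) (s≤s h) (s≤s j≤) = path .distinct i j h j≤
      inj : ∀ {i j} → q (toℕ i) ≡ q (toℕ j) → i ≡ j
      inj {i} {j} eq with <-cmp (toℕ i) (toℕ j)
      ... | tri< lt _ _ = ⊥-elim (q-distinct _ _ lt (≤-pred (Finₚ.toℕ<n j)) eq)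
      ... | tri≈ _ e _ = Finₚ.toℕ-injective e
      ... | tri> _ _ gt = ⊥-elim (q-distinct _ _ gt (≤-pred (Finₚ.toℕ<n i)) (≡-sym eq))
      C : ℕ → ℕ → Set
      C a b = (suc a ≡ b) ⊎ (suc b ≡ a) ⊎ ((a ≡ 0) × (b ≡ suc ℓ)) ⊎ ((b ≡ 0) × (a ≡ suc ℓ))
      ends : ∀ b → b ≤ ℓ → v ~ p b → (1 ≡ suc b) ⊎ (b ≡ ℓ)
      ends zero _ _ = inj₁ refl
      ends (suc b) b≤ vp with suc b ≟ ℓ
      ... | yes e = inj₂ e
      ... | no ne = ⊥-elim (middle (suc b) (s≤s z≤n) (≤∧≢⇒< b≤ ne) vp)
      to : ∀ a b → a ≤ suc ℓ → b ≤ suc ℓ → q a ~ q b → C a b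
      to zero zero _ _ h = ⊥-elim (~-irrefl h)
      to zero (suc b) _ (s≤s b≤) h with ends b b≤ h
      ... | inj₁ e = inj₁ e
      ... | inj₂ e = inj₂ (inj₂ (inj₁ (refl , cong suc e)))
      to (suc a) zero (s≤s a≤) _ h with ends a a≤ (~-sym h)
      ... | inj₁ e = inj₂ (inj₁ e)
      ... | inj₂ e = inj₂ (inj₂ (inj₂ (refl , cong suc e)))
      to (suc a) (suc b) (s≤s a≤) (s≤s b≤) h with <-cmp a b
      ... | tri≈ _ refl _ = ⊥-elim (~-irrefl h)
      ... | tri< lt _ _ with suc a ≟ b
      ...   | yes e = inj₁ (cong suc e)
      ...   | no ne = ⊥-elim (path .chordless a b (≤∧≢⇒< lt ne) b≤ h)
      to (suc a) (suc b) (s≤s a≤) (s≤s b≤) h | tri> _ _ gt with suc b ≟ a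
      ...   | yes e = inj₂ (inj₁ (cong suc e))
      ...   | no ne = ⊥-elim (path .chordless b a (≤∧≢⇒< gt ne) a≤ (~-sym h))
      from : ∀ i j → CycleAdj (2 + ℓ) i j → q (toℕ i) ~ q (toℕ j)
      from i j (inj₁ e) = subst (λ z → q (toℕ i) ~ q z) e (q-edge (toℕ i) (≤-pred (subst (_< 2 + ℓ) (≡-sym e) (Finₚ.toℕ<n j))))
      from i j (inj₂ (inj₁ e)) = ~-sym (subst (λ z → q (toℕ j) ~ q z) e (q-edge (toℕ j) (≤-pred (subst (_< 2 + ℓ) (≡-sym e) (Finₚ.toℕ<n i)))))
      from i j (inj₂ (inj₂ (inj₁ (e , f)))) rewrite e | f = final
      from i j (inj₂ (inj₂ (inj₂ (e , f)))) rewrite e | f = ~-sym final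

-- Components and simplicial vertices

true≢false : {A : Set} {b : Bool} → b ≡ true → b ≡ false → A
true≢false refl ()

toSet : ∀ {n} {P : Fin n → Set} → (∀ x → Dec (P x)) → Fin n → Bool
toSet P? x = does (P? x)

toSet-in : ∀ {n} {P : Fin n → Set} (P? : ∀ x → Dec (P x)) {x} → P x → toSet P? x ≡ true
toSet-in P? {x} = dec-true (P? x)

toSet-out : ∀ {n} {P : Fin n → Set} (P? : ∀ x → Dec (P x)) {x} → toSet P? x ≡ true → P x
toSet-out P? {x} eq with P? x
... | yes p = p

bit : Bool → ℕ
bit b = if b then 1 else 0

count : ∀ {n} → (Fin n → Bool) → ℕ
count {zero} f = 0
count {suc n} f = bit (f Fin.zero) + count (f ∘ Fin.suc)

bit-mono : ∀ {a b} → (a ≡ true → b ≡ true) → bit a ≤ bit b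
bit-mono {false} h = z≤n
bit-mono {true} h rewrite h refl = ≤-refl

count-mono : ∀ {n} {f g : Fin n → Bool} → (∀ x → f x ≡ true → g x ≡ true) → count f ≤ count g
count-mono {zero} h = z≤n
count-mono {suc n} {f} {g} h = +-mono-≤ (bit-mono (h Fin.zero)) (count-mono (h ∘ Fin.suc))

count-strict : ∀ {n} {f g : Fin n → Bool} → (∀ x → f x ≡ true → g x ≡ true) →
  ∀ y → g y ≡ true → f y ≡ false → count f < count g
count-strict h Fin.zero gy fy rewrite gy | fy = s≤s (count-mono (h ∘ Fin.suc))
count-strict h (Fin.suc y) gy fy = +-mono-≤-< (bit-mono (h Fin.zero)) (count-strict (h ∘ Fin.suc) y gy fy)

count-all : ∀ n → count {n} (λ _ → true) ≡ n
count-all zero = refl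
count-all (suc n) = cong suc (count-all n)

count-≤ : ∀ {n} (f : Fin n → Bool) → count f ≤ n
count-≤ {n} f = subst (count f ≤_) (count-all n) (count-mono {n} {f} λ _ _ → refl)

count-< : ∀ {n} (f : Fin n → Bool) y → f y ≡ false → count f < n
count-< {n} f y fy = subst (count f <_) (count-all n) (count-strict {n} {f} (λ _ _ → refl) y refl fy)

count-pos : ∀ {n} (f : Fin n → Bool) y → f y ≡ true → 0 < count f
count-pos f Fin.zero fy rewrite fy = s≤s z≤n
count-pos f (Fin.suc y) fy = ≤-trans (count-pos (f ∘ Fin.suc) y fy) (m≤n+m _ _)

descend : ∀ {n} {Q : Fin n → Set} (size : Fin n → ℕ) →
  (∀ v → Q v → (∀ w → Q w → size w < size v → ⊥) → ⊥) → ∀ v → Q v → ⊥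
descend {n} {Q} size h v qv = go (suc (size v)) v qv ≤-refl
  where
  go : ∀ k v → Q v → size v < k → ⊥
  go (suc k) v qv (s≤s sz) = h v qv λ w qw lt → go k w qw (<-≤-trans lt sz)

module _ {n : ℕ} (G : Graph n) where
  open IsInducedPath

  open Adjacency G

  walk-map : ∀ {P Q : Fin n → Set} {x y} → (∀ w → P w → Q w) → WalkIn G P x y → WalkIn G Q x y
  walk-map f (here p) = here (f _ p)
  walk-map f (step p a w) = step (f _ p) a (walk-map f w)

  walk-append : ∀ {P x y z} → WalkIn G P x y → WalkIn G P y z → WalkIn G P x z
  walk-append (here _) w′ = w′
  walk-append (step p a w) w′ = step p a (walk-append w w′)

  walk-start : ∀ {P x y} → WalkIn G P x y → P x
  walk-start (here p) = p
  walk-start (step p _ _) = p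

  walk-end : ∀ {P x y} → WalkIn G P x y → P y
  walk-end (here p) = p
  walk-end (step _ _ w) = walk-end w

  walk-snoc : ∀ {P x y z} → WalkIn G P x y → y ~ z → P z → WalkIn G P x z
  walk-snoc w a pz = walk-append w (step (walk-end w) a (here pz))

  walk-reverse : ∀ {P x y} → WalkIn G P x y → WalkIn G P y x
  walk-reverse (here p) = here p
  walk-reverse (step p a w) = walk-snoc (walk-reverse w) (~-sym a) p

  record Component (P : Fin n → Set) (x : Fin n) : Set where
    field
      D      : Fin n → Bool
      source : D x ≡ true
      sound  : ∀ y → D y ≡ true → WalkIn G P x y
      closed : ∀ y z → D y ≡ true → P z → y ~ z → D z ≡ true

    stays : ∀ {y z} → D y ≡ true → WalkIn G P y z → WalkIn G (λ w → D w ≡ true) y z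
    stays dy (here _) = here dy
    stays dy (step _ a w) = step dy a (stays (closed _ _ dy (walk-start w) a) w)

    reaches : ∀ {y} → WalkIn G P x y → D y ≡ true
    reaches w = walk-end (stays source w)

    linked : ∀ {y z} → D y ≡ true → D z ≡ true → WalkIn G (λ w → D w ≡ true) y z
    linked dy dz = walk-append (walk-reverse (stays source (sound _ dy))) (stays source (sound _ dz))

  abstract
    -- The set grows by one boundary vertex at a time. The fuel `k` suffices because a set of at
    -- least `n` vertices has no boundary left.
    component : ∀ {P : Fin n → Set} → (∀ x → Dec (P x)) → ∀ x → P x → Component P x
    component {P} P? x px = grow n (λ w → does (w Finₚ.≟ x)) (dec-true (x Finₚ.≟ x) refl) base (m≤n+m n _)
      where
      base : ∀ y → does (y Finₚ.≟ x) ≡ true → WalkIn G P x y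
      base y eq with y Finₚ.≟ x
      ... | yes refl = here px
      grow : ∀ k (D : Fin n → Bool) → D x ≡ true → (∀ y → D y ≡ true → WalkIn G P x y) →
             n ≤ count D + k → Component P x
      grow k D dx snd bound
        with Finₚ.any? (λ y → Finₚ.any? (λ z → (D y Bool.≟ true) ×-dec (D z Bool.≟ false) ×-dec P? z ×-dec (_~?_ y z)))
      ... | no none = record { D = D ; source = dx ; sound = snd ; closed = cl }
        where
        cl : ∀ y z → D y ≡ true → P z → y ~ z → D z ≡ true
        cl y z dy pz a with D z in eq
        ... | true = refl
        ... | false = ⊥-elim (none (y , z , dy , eq , pz , a))
      grow zero D dx snd bound | yes (y , z , dy , dz , pz , a) =
        ⊥-elim (<-irrefl refl (<-≤-trans (count-< D z dz) (subst (n ≤_) (+-identityʳ _) bound)))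
      grow (suc k) D dx snd bound | yes (y , z , dy , dz , pz , a) =
        grow k D′ (D⊆D′ x dx) snd′
          (≤-trans bound (subst (_≤ count D′ + k) (≡-sym (+-suc (count D) k))
            (+-monoˡ-≤ k (count-strict D⊆D′ z z∈D′ dz))))
        where
        D′ : Fin n → Bool
        D′ w = D w Bool.∨ does (w Finₚ.≟ z)
        D⊆D′ : ∀ w → D w ≡ true → D′ w ≡ true
        D⊆D′ w dw rewrite dw = refl
        z∈D′ : D′ z ≡ true
        z∈D′ rewrite dec-true (z Finₚ.≟ z) refl = Boolₚ.∨-zeroʳ (D z)
        snd′ : ∀ w → D′ w ≡ true → WalkIn G P x w
        snd′ w dw with D w in eq | w Finₚ.≟ z
        ... | true | _ = snd w eq
        ... | false | yes refl = walk-snoc (snd y dy) a pz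

  SimplicialIn : (Fin n → Bool) → Fin n → Set
  SimplicialIn W v = ∀ a b → W a ≡ true → W b ≡ true → v ~ a → v ~ b → a ≢ b → a ~ b

  module _ (noHole : ∀ {v ℓ p} → IsApex G v ℓ p → ⊥) where

    -- Dirac: take u and a component D of the non-neighbours of u with |D| as large as possible.
    -- Its attachment S is a clique and is complete to the rest W′, so a simplicial vertex of W′
    -- stays simplicial.
    chordal-simplicial : ∀ k W → count W ≤ k → ∀ x → W x ≡ true →
      (∀ v → W v ≡ true → ¬ SimplicialIn W v) → ⊥
    chordal-simplicial zero W le x wx _ = <-irrefl refl (<-≤-trans (count-pos W x wx) le)
    chordal-simplicial (suc k) W le x₀ wx₀ noSimp = noSimp x₀ wx₀ λ a b wa wb _ _ a≢b →
      ~-stable λ a≁b → loop n a b wa (far a b wb a≢b a≁b) (m≤n+m n _)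
      where
      Away : Fin n → Fin n → Set
      Away u w = W w ≡ true × u ≢ w × u ≁ w
      away? : ∀ u w → Dec (Away u w)
      away? u w = (W w Bool.≟ true) ×-dec ¬? (u Finₚ.≟ w) ×-dec ¬? (_~?_ u w)
      far : ∀ a b → W b ≡ true → a ≢ b → a ≁ b → Component (Away a) b
      far a b wb a≢b a≁b = component (away? a) b (wb , a≢b , a≁b)
      -- `f` bounds the number of vertices outside the component, so replacing `D` by a larger
      -- component uses it up.
      loop : ∀ f u x → W u ≡ true → (C : Component (Away u) x) → n ≤ count (Component.D C) + f → ⊥
      loop f u x wu C bound =
        chordal-simplicial k W′ (≤-pred (<-≤-trans (count-strict W′⊆W x (proj₁ (away x source)) x∉W′) le)) u
          (toSet-in rest? (wu , u∉D , λ (d , dd , a) → proj₂ (proj₂ (away d dd)) a))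
          λ v v∈W′ simp → noSimp v (W′⊆W v v∈W′) (lift v (toSet-out rest? v∈W′) simp)
        where
        open Component C
        Rest : Fin n → Set
        Rest w = W w ≡ true × D w ≡ false × ¬ (∃ λ d → D d ≡ true × w ~ d)
        rest? : ∀ w → Dec (Rest w)
        rest? w = (W w Bool.≟ true) ×-dec (D w Bool.≟ false) ×-dec ¬? (Finₚ.any? λ d → (D d Bool.≟ true) ×-dec (_~?_ w d))
        W′ : Fin n → Bool
        W′ = toSet rest?
        W′⊆W : ∀ w → W′ w ≡ true → W w ≡ true
        W′⊆W w h = proj₁ (toSet-out rest? h)
        away : ∀ d → D d ≡ true → Away u d
        away d dd = walk-end (sound d dd)
        u∉D : D u ≡ false
        u∉D with D u in eq
        ... | false = refl
        ... | true = ⊥-elim (proj₁ (proj₂ (away u eq)) refl)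
        x∉W′ : W′ x ≡ false
        x∉W′ with W′ x in eq
        ... | false = refl
        ... | true = true≢false source (proj₁ (proj₂ (toSet-out rest? eq)))
        Att : Fin n → Set
        Att s = W s ≡ true × D s ≡ false × ∃ λ d → D d ≡ true × s ~ d
        att~u : ∀ s → Att s → u ~ s
        att~u s (ws , s∉D , d , dd , s~d) = ~-stable λ u≁s →
          true≢false (closed d s dd (ws , (λ { refl → proj₂ (proj₂ (away d dd)) s~d }) , u≁s) (~-sym s~d)) s∉D
        -- An induced path from `s` to `s′` through `D` has its interior away from `u`, which sees
        -- both ends; so `u` closes it to a hole.
        clique : ∀ s s′ → Att s → Att s′ → s ≢ s′ → s ~ s′
        clique s s′ as@(_ , s∉D , d , dd , s~d) as′@(_ , s′∉D , d′ , dd′ , s′~d′) s≢s′ =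
          ~-stable λ s≁s′ → noHole (apex s≁s′)
          where
          Q : Fin n → Set
          Q w = D w ≡ true ⊎ w ≡ s ⊎ w ≡ s′
          walk : WalkIn G Q s s′
          walk = step (inj₂ (inj₁ refl)) s~d
                   (walk-snoc (walk-map (λ _ → inj₁) (linked dd dd′)) (~-sym s′~d′) (inj₂ (inj₂ refl)))
          open InducedPath (walk⇒inducedPath G walk)
          2≤len : s ≁ s′ → ∀ l → at l ≡ s′ → l ≤ len → 2 ≤ l
          2≤len _ zero e _ = ⊥-elim (s≢s′ (trans (≡-sym start) e))
          2≤len s≁s′ (suc zero) e l≤ = ⊥-elim (s≁s′ (Eq.subst₂ _~_ start e (induced .edge 0 l≤)))
          2≤len _ (suc (suc l)) _ _ = s≤s (s≤s z≤n)
          apex : s ≁ s′ → IsApex G u len at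
          apex s≁s′ = record
            { 2≤ℓ = 2≤len s≁s′ len end ≤-refl ; path = induced
            ; first = subst (u ~_) (≡-sym start) (att~u s as)
            ; final = subst (u ~_) (≡-sym end) (att~u s′ as′)
            ; middle = mid ; off = off }
            where
            mid : ∀ i → 0 < i → i < len → u ≁ at i
            mid i 0<i i< with within i (<⇒≤ i<)
            ... | inj₁ di = proj₂ (proj₂ (away _ di))
            ... | inj₂ (inj₁ e) = ⊥-elim (induced .distinct 0 i 0<i (<⇒≤ i<) (trans start (≡-sym e)))
            ... | inj₂ (inj₂ e) = ⊥-elim (induced .distinct i len i< ≤-refl (trans e (≡-sym end)))
            off : ∀ i → i ≤ len → u ≢ at i
            off i i≤ with within i i≤
            ... | inj₁ di = proj₁ (proj₂ (away _ di))
            ... | inj₂ (inj₁ e) = λ e′ → ~⇒≢ (att~u s as) (trans e′ e)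
            ... | inj₂ (inj₂ e) = λ e′ → ~⇒≢ (att~u s′ as′) (trans e′ e)
        -- The non-neighbours of `w` include `D` and `s`, so they have a component larger than `D`,
        -- against its maximality.
        improve : ∀ f → n ≤ count D + f → ∀ w s → Rest w → Att s → w ≁ s → ⊥
        improve f bound w s (ww , w∉D , w≁D) (ws , s∉D , d , dd , s~d) w≁s = again f bound
          where
          off-w : ∀ y → D y ≡ true → Away w y
          off-w y dy = proj₁ (away y dy) , (λ { refl → true≢false dy w∉D }) , λ a → w≁D (y , dy , a)
          C′ : Component (Away w) x
          C′ = component (away? w) x (off-w x source)
          module C′ = Component C′
          D⊆D′ : ∀ y → D y ≡ true → C′.D y ≡ true
          D⊆D′ y dy = C′.reaches (walk-map off-w (stays source (sound y dy)))
          s∈D′ : C′.D s ≡ true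
          s∈D′ = C′.closed d s (D⊆D′ d dd) (ws , (λ { refl → w≁D (d , dd , s~d) }) , w≁s) (~-sym s~d)
          bigger : count D < count C′.D
          bigger = count-strict D⊆D′ s s∈D′ s∉D
          again : ∀ f → n ≤ count D + f → ⊥
          again zero b = <-irrefl refl (<-≤-trans (count-< D s s∉D) (subst (n ≤_) (+-identityʳ _) b))
          again (suc f) b = loop f w x ww C′ (≤-trans b (subst (_≤ count C′.D + f) (≡-sym (+-suc _ f)) (+-monoˡ-≤ f bigger)))
        side : ∀ v → Rest v → ∀ a → W a ≡ true → v ~ a → Rest a ⊎ Att a
        side v (_ , _ , v≁D) a wa v~a with D a in eq
        ... | true = ⊥-elim (v≁D (a , eq , v~a))
        ... | false with Finₚ.any? (λ d → (D d Bool.≟ true) ×-dec (_~?_ a d))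
        ...   | yes h = inj₂ (wa , refl , h)
        ...   | no h = inj₁ (wa , refl , h)
        lift : ∀ v → Rest v → SimplicialIn W′ v → SimplicialIn W v
        lift v rv simp a b wa wb v~a v~b a≢b with side v rv a wa v~a | side v rv b wb v~b
        ... | inj₁ ra | inj₁ rb = simp a b (toSet-in rest? ra) (toSet-in rest? rb) v~a v~b a≢b
        ... | inj₂ sa | inj₂ sb = clique a b sa sb a≢b
        ... | inj₁ ra | inj₂ sb = ~-stable (improve f bound a b ra sb)
        ... | inj₂ sa | inj₁ rb = ~-sym (~-stable (improve f bound b a rb sa))

-- Kempe chains

HadwigerBound : ∀ {n} → Graph n → Set
HadwigerBound G = ∃ λ k → Colourable G k × (K k ≼ G)

complete-adj⇒≢ : ∀ {k} {i j : Fin k} → complete-adj i j ≡ true → i ≢ j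
complete-adj⇒≢ {i = i} h refl = true≢false h (complete-irrefl i)

-- Heads are paired until one list is exhausted. An involution serves both directions, so it can be
-- decided afterwards which side is matched into the other.
matching : ∀ (xs ys : List ℕ) → Unique xs → Unique ys → (∀ {z} → z ∈ xs → z ∉ ys) →
  Σ (ℕ → ℕ) λ π → (∀ z → π (π z) ≡ z) × (∀ z → z ∉ xs → z ∉ ys → π z ≡ z) ×
    ((∀ {x} → x ∈ xs → π x ∈ ys) ⊎ (∀ {y} → y ∈ ys → π y ∈ xs))
matching [] ys _ _ _ = id , (λ _ → refl) , (λ _ _ _ → refl) , inj₁ λ ()
matching (x ∷ xs) [] _ _ _ = id , (λ _ → refl) , (λ _ _ _ → refl) , inj₂ λ ()
matching (x ∷ xs) (y ∷ ys) (x∉xs ∷ uxs) (y∉ys ∷ uys) disj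
  with matching xs ys uxs uys (λ p q → disj (there p) (there q))
... | π′ , inv , fix , emb = π , involutive , fixed , embeds emb
  where
  π : ℕ → ℕ
  π z with z ≟ x | z ≟ y
  ... | yes _ | _ = y
  ... | no _ | yes _ = x
  ... | no _ | no _ = π′ z
  fix-x : π′ x ≡ x
  fix-x = fix x (λ p → All.lookup x∉xs p refl) (λ p → disj (here refl) (there p))
  fix-y : π′ y ≡ y
  fix-y = fix y (λ p → disj (there p) (here refl)) (λ p → All.lookup y∉ys p refl)
  π-x : π x ≡ y
  π-x with x ≟ x
  ... | yes _ = refl
  ... | no ne = ⊥-elim (ne refl)
  π-y : π y ≡ x
  π-y with y ≟ x | y ≟ y
  ... | yes e | _ = e
  ... | no _ | yes _ = refl
  ... | no _ | no ne = ⊥-elim (ne refl)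
  π-else : ∀ z → z ≢ x → z ≢ y → π z ≡ π′ z
  π-else z zx zy with z ≟ x | z ≟ y
  ... | yes e | _ = ⊥-elim (zx e)
  ... | no _ | yes e = ⊥-elim (zy e)
  ... | no _ | no _ = refl
  involutive : ∀ z → π (π z) ≡ z
  involutive z with z ≟ x | z ≟ y
  ... | yes refl | _ = π-y
  ... | no _ | yes refl = π-x
  ... | no zx | no zy = trans (π-else (π′ z)
          (λ e → zx (trans (≡-sym (inv z)) (trans (cong π′ e) fix-x)))
          (λ e → zy (trans (≡-sym (inv z)) (trans (cong π′ e) fix-y)))) (inv z)
  fixed : ∀ z → z ∉ x ∷ xs → z ∉ y ∷ ys → π z ≡ z
  fixed z zx zy = trans (π-else z (zx ∘ here) (zy ∘ here)) (fix z (zx ∘ there) (zy ∘ there))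
  embeds : _ → _
  embeds (inj₁ e) = inj₁ λ { (here refl) → here π-x
                           ; {z} (there p) → there (subst (_∈ ys) (≡-sym (π-else z (λ { refl → All.lookup x∉xs p refl }) λ { refl → disj (there p) (here refl) })) (e p)) }
  embeds (inj₂ e) = inj₂ λ { (here refl) → here π-y
                           ; {z} (there p) → there (subst (_∈ xs) (≡-sym (π-else z (λ { refl → disj (here refl) (there p) }) λ { refl → All.lookup y∉ys p refl })) (e p)) }

matchBelow : ∀ κ {A B : ℕ → Set} → (∀ i → Dec (A i)) → (∀ i → Dec (B i)) → (∀ {i} → A i → B i → ⊥) →
  Σ (ℕ → ℕ) λ π → (∀ z → π (π z) ≡ z) ×
    ((∀ j → j < κ → B j → π j < κ × A (π j)) ⊎ (∀ i → i < κ → A i → π i < κ × B (π i)))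
matchBelow κ A? B? disj
  with matching (filter B? (upTo κ)) (filter A? (upTo κ)) (Uniqueₚ.filter⁺ B? (Uniqueₚ.upTo⁺ κ)) (Uniqueₚ.filter⁺ A? (Uniqueₚ.upTo⁺ κ))
         (λ p q → disj (proj₂ (∈-filter⁻ A? {xs = upTo κ} q)) (proj₂ (∈-filter⁻ B? {xs = upTo κ} p)))
... | π , inv , _ , emb = π , inv , Data.Sum.map
        (λ e j j< bj → case ∈-filter⁻ A? {xs = upTo κ} (e (∈-filter⁺ B? (∈-upTo⁺ j<) bj)) of λ (m , a) → ∈-upTo⁻ m , a)
        (λ e i i< ai → case ∈-filter⁻ B? {xs = upTo κ} (e (∈-filter⁺ A? (∈-upTo⁺ i<) ai)) of λ (m , a) → ∈-upTo⁻ m , a)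
        emb

module _ {n : ℕ} (G : Graph n) where

  open Adjacency G

  colourable : ∀ k (c : Fin n → ℕ) → (∀ x → c x < k) → (∀ x y → x ~ y → c x ≢ c y) → Colourable G k
  colourable k c c< proper = (λ x → fromℕ< (c< x)) , λ x y a e →
    proper x y a (trans (≡-sym (Finₚ.toℕ-fromℕ< (c< x))) (trans (cong toℕ e) (Finₚ.toℕ-fromℕ< (c< y))))

  -- A label of at least k means that the vertex lies in no branch set.
  complete-minor : ∀ k (ψ : Fin n → ℕ) (r : ℕ → Fin n) → (∀ i → i < k → ψ (r i) ≡ i) →
    (∀ i x → i < k → ψ x ≡ i → WalkIn G (λ w → ψ w ≡ i) (r i) x) →
    (∀ i j → i < j → j < k → ∃ λ u → ∃ λ w → ψ u ≡ i × ψ w ≡ j × u ~ w) → K k ≼ G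
  complete-minor k ψ r ψr conn edg = record
    { φ = φ
    ; nonempty = λ i → r (toℕ i) , φ-in (r (toℕ i)) i (ψr (toℕ i) (Finₚ.toℕ<n i))
    ; connected = λ i x y φx φy → walk-map G (λ w → φ-in w i)
        (walk-append G (walk-reverse G (conn _ x (Finₚ.toℕ<n i) (φ-out x i φx))) (conn _ y (Finₚ.toℕ<n i) (φ-out y i φy)))
    ; edges = joins }
    where
    φ : Fin n → Maybe (Fin k)
    φ x with ψ x <? k
    ... | yes lt = just (fromℕ< lt)
    ... | no _ = nothing
    φ-in : ∀ x i → ψ x ≡ toℕ i → φ x ≡ just i
    φ-in x i e with ψ x <? k
    ... | yes lt = cong just (Finₚ.toℕ-injective (trans (Finₚ.toℕ-fromℕ< lt) e))
    ... | no nlt = ⊥-elim (nlt (subst (_< k) (≡-sym e) (Finₚ.toℕ<n i)))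
    φ-out : ∀ x i → φ x ≡ just i → ψ x ≡ toℕ i
    φ-out x i e with ψ x <? k
    ... | yes lt = trans (≡-sym (Finₚ.toℕ-fromℕ< lt)) (cong toℕ (just-injective e))
    joins : ∀ i j → complete-adj i j ≡ true → ∃ λ u → ∃ λ w → φ u ≡ just i × φ w ≡ just j × Adj G u w
    joins i j h with <-cmp (toℕ i) (toℕ j)
    ... | tri≈ _ e _ = ⊥-elim (complete-adj⇒≢ h (Finₚ.toℕ-injective e))
    ... | tri< lt _ _ with edg _ _ lt (Finₚ.toℕ<n j)
    ...   | u , w , pu , pw , a = u , w , φ-in u i pu , φ-in w j pw , a
    joins i j h | tri> _ _ gt with edg _ _ gt (Finₚ.toℕ<n i)
    ...   | u , w , pu , pw , a = w , u , φ-in w i pw , φ-in u j pu , ~-sym a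

  -- A bound for G with v deleted; the colour of v is junk.
  record BoundWithout (v : Fin n) : Set where
    field
      κ      : ℕ
      c      : Fin n → ℕ
      c<κ    : ∀ x → x ≢ v → c x < κ
      proper : ∀ x y → x ≢ v → y ≢ v → x ~ y → c x ≢ c y
      minor  : K κ ≼ G
      avoids : MinorModel.φ minor v ≡ nothing

  -- The neighbourhood of v is L ∪ M ∪ R, where L ∪ M and M ∪ R are cliques and L is anticomplete to R;
  -- M is what is neither in L nor in R.
  record Good (v : Fin n) : Set where
    field
      L R      : Fin n → Bool
      disjoint : ∀ x → v ~ x → L x ≡ true → R x ≡ true → ⊥
      left     : ∀ x y → v ~ x → v ~ y → R x ≡ false → R y ≡ false → x ≢ y → x ~ y
      right    : ∀ x y → v ~ x → v ~ y → L x ≡ false → L y ≡ false → x ≢ y → x ~ y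
      apart    : ∀ x y → v ~ x → v ~ y → L x ≡ true → R y ≡ true → x ≁ y

  module _ (unbounded : ¬ HadwigerBound G) {v : Fin n} (bw : BoundWithout v) where
    open BoundWithout bw

    -- The minor of G - v is a minor of G, so a colour free at `v` would give G a bound with the
    -- same κ.
    recolour : (c′ : Fin n → ℕ) → (∀ x → x ≢ v → c′ x < κ) → ∀ k → k < κ →
      (∀ x y → x ≢ v → y ≢ v → x ~ y → c′ x ≢ c′ y) → (∀ x → v ~ x → c′ x ≢ k) → ⊥
    recolour c′ c′< k k<κ prop free = unbounded (κ , colourable κ d d< d-proper , minor)
      where
      d : Fin n → ℕ
      d x with x Finₚ.≟ v
      ... | yes _ = k
      ... | no _ = c′ x
      d< : ∀ x → d x < κ
      d< x with x Finₚ.≟ v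
      ... | yes _ = k<κ
      ... | no ne = c′< x ne
      d-proper : ∀ x y → x ~ y → d x ≢ d y
      d-proper x y a with x Finₚ.≟ v | y Finₚ.≟ v
      ... | yes refl | yes refl = ⊥-elim (~-irrefl a)
      ... | yes refl | no _ = λ e → free y a (≡-sym e)
      ... | no _ | yes refl = free x (~-sym a)
      ... | no nx | no ny = prop x y nx ny a

    colour-seen : ∀ i → i < κ → ∃ λ x → v ~ x × c x ≡ i
    colour-seen i i< with Finₚ.any? (λ x → (_~?_ v x) ×-dec (c x ≟ i))
    ... | yes h = h
    ... | no h = ⊥-elim (recolour c c<κ i i< proper λ x a e → h (x , a , e))

    colour-suc : Colourable G (suc κ)
    colour-suc = colourable (suc κ) d d< d-proper
      where
      d : Fin n → ℕ
      d x with x Finₚ.≟ v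
      ... | yes _ = κ
      ... | no _ = c x
      d< : ∀ x → d x < suc κ
      d< x with x Finₚ.≟ v
      ... | yes _ = ≤-refl
      ... | no ne = m<n⇒m<1+n (c<κ x ne)
      d-proper : ∀ x y → x ~ y → d x ≢ d y
      d-proper x y a with x Finₚ.≟ v | y Finₚ.≟ v
      ... | yes refl | yes refl = ⊥-elim (~-irrefl a)
      ... | yes refl | no ny = λ e → <-irrefl (≡-sym e) (c<κ y ny)
      ... | no nx | yes refl = λ e → <-irrefl e (c<κ x nx)
      ... | no nx | no ny = proper x y nx ny a

    no-next-minor : K (suc κ) ≼ G → ⊥
    no-next-minor m = unbounded (suc κ , colour-suc , m)

module _ {n : ℕ} (G : Graph n) (unbounded : ¬ HadwigerBound G) where

  open Adjacency G

  -- The minor avoids `u`, so `u` can be added as a branch set of its own, which pays for the one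
  -- additional colour.
  no-universal : ∀ u → BoundWithout G u → (∀ x → x ≢ u → u ~ x) → ⊥
  no-universal u bw univ = no-next-minor G unbounded bw record
    { φ = φ
    ; nonempty = λ { Fin.zero → u , φ-u ; (Fin.suc i) → proj₁ (M.nonempty i) , φ-lift _ i (proj₂ (M.nonempty i)) }
    ; connected = λ { Fin.zero x y p q → Eq.subst₂ (WalkIn G _) (≡-sym (φ-zero x p)) (≡-sym (φ-zero y q)) (here φ-u)
                    ; (Fin.suc i) x y p q → walk-map G (λ w → φ-lift w i) (M.connected i x y (φ-suc x i p) (φ-suc y i q)) }
    ; edges = λ { Fin.zero Fin.zero ()
                ; Fin.zero (Fin.suc j) _ → let (x , p) = M.nonempty j in u , x , φ-u , φ-lift x j p , univ x (off x j p)
                ; (Fin.suc i) Fin.zero _ → let (x , p) = M.nonempty i in x , u , φ-lift x i p , φ-u , ~-sym (univ x (off x i p))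
                ; (Fin.suc i) (Fin.suc j) h → let (x , y , p , q , a) = M.edges i j h in x , y , φ-lift x i p , φ-lift y j q , a } }
    where
    open BoundWithout bw
    module M = MinorModel minor
    φ : Fin n → Maybe (Fin (suc κ))
    φ x with x Finₚ.≟ u
    ... | yes _ = just Fin.zero
    ... | no _ = Data.Maybe.map Fin.suc (M.φ x)
    off : ∀ x i → M.φ x ≡ just i → x ≢ u
    off x i p refl with trans (≡-sym p) avoids
    ... | ()
    φ-u : φ u ≡ just Fin.zero
    φ-u with u Finₚ.≟ u
    ... | yes _ = refl
    ... | no ne = ⊥-elim (ne refl)
    φ-lift : ∀ x i → M.φ x ≡ just i → φ x ≡ just (Fin.suc i)
    φ-lift x i p with x Finₚ.≟ u
    ... | yes e = ⊥-elim (off x i p e)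
    ... | no _ rewrite p = refl
    φ-zero : ∀ x → φ x ≡ just Fin.zero → x ≡ u
    φ-zero x p with x Finₚ.≟ u
    ... | yes e = e
    ... | no _ with M.φ x
    φ-zero x () | no _ | just _
    φ-zero x () | no _ | nothing
    φ-suc : ∀ x i → φ x ≡ just (Fin.suc i) → M.φ x ≡ just i
    φ-suc x i p with x Finₚ.≟ u
    φ-suc x i () | yes _
    ... | no _ with M.φ x
    φ-suc x i refl | no _ | just .i = refl
    φ-suc x i () | no _ | nothing

  module _ (t : ℕ) (independence : ¬ HasIndependentSet G (suc t))
    (noShort : ∀ k → 4 ≤ k → k < t + t → ¬ HasInducedCycle G k)
    {v : Fin n} (bw : BoundWithout G v) where
    open BoundWithout bw
    open IsInducedPath

    module Kempe (good : Good G v) (π : ℕ → ℕ) (π-inv : ∀ z → π (π z) ≡ z)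
      (π-spec : ∀ j → j < κ → (∀ x → v ~ x → c x ≡ j → Good.R good x ≡ true) →
                π j < κ × (∀ x → v ~ x → c x ≡ π j → Good.L good x ≡ true)) where
      open Good good

      v≢ : ∀ {x} → v ~ x → x ≢ v
      v≢ a e = ~⇒≢ a (≡-sym e)

      LeftMid : Fin n → Set
      LeftMid x = v ~ x × R x ≡ false
      leftMid? : ∀ x → Dec (LeftMid x)
      leftMid? x = (_~?_ v x) ×-dec (R x Bool.≟ false)

      LM-unique : ∀ {x y} → LeftMid x → LeftMid y → c x ≡ c y → x ≡ y
      LM-unique {x} {y} (vx , rx) (vy , ry) e with x Finₚ.≟ y
      ... | yes p = p
      ... | no ne = ⊥-elim (proper x y (v≢ vx) (v≢ vy) (left x y vx vy rx ry ne) e)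

      OnlyR : ℕ → Set
      OnlyR j = j < κ × (∀ x → v ~ x → c x ≡ j → R x ≡ true)

      classify : ∀ j → j < κ → (∃ λ x → LeftMid x × c x ≡ j) ⊎ OnlyR j
      classify j j< with Finₚ.any? (λ x → leftMid? x ×-dec (c x ≟ j))
      ... | yes h = inj₁ h
      ... | no h = inj₂ (j< , λ x vx e → Boolₚ.¬-not λ rx → h (x , (vx , rx) , e))

      onlyR? : ∀ j → Dec (OnlyR j)
      onlyR? j with j <? κ
      ... | no h = no (h ∘ proj₁)
      ... | yes j< with classify j j<
      ...   | inj₂ o = yes o
      ...   | inj₁ (x , (vx , rx) , e) = no λ o → true≢false (proj₂ o x vx e) rx

      -- A representative in L ∪ M is preferred; only a colour absent there falls back on R, where a
      -- chain takes over. `v` is a placeholder for labels that are not colours.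
      rep : ℕ → Fin n
      rep j with j <? κ
      ... | no _ = v
      ... | yes j< with classify j j<
      ...   | inj₁ (x , _) = x
      ...   | inj₂ _ = proj₁ (colour-seen G unbounded bw j j<)

      rep-nbr : ∀ j → j < κ → v ~ rep j × c (rep j) ≡ j
      rep-nbr j j< with j <? κ
      ... | no h = ⊥-elim (h j<)
      ... | yes j<′ with classify j j<′
      ...   | inj₁ (x , (vx , _) , e) = vx , e
      ...   | inj₂ _ = proj₂ (colour-seen G unbounded bw j j<′)

      rep-left : ∀ j → j < κ → ¬ OnlyR j → LeftMid (rep j)
      rep-left j j< ¬o with j <? κ
      ... | no h = ⊥-elim (h j<)
      ... | yes j<′ with classify j j<′
      ...   | inj₁ (x , lm , _) = lm
      ...   | inj₂ o = ⊥-elim (¬o o)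

      Two : ℕ → Fin n → Set
      Two j w = w ≢ v × (c w ≡ j ⊎ c w ≡ π j)
      two? : ∀ j w → Dec (Two j w)
      two? j w = ¬? (w Finₚ.≟ v) ×-dec ((c w ≟ j) ⊎-dec (c w ≟ π j))

      Outside : ℕ → Fin n → Set
      Outside j w = Two j w × ¬ LeftMid w
      outside? : ∀ j w → Dec (Outside j w)
      outside? j w = two? j w ×-dec ¬? (leftMid? w)

      module Chain {j : ℕ} (only : OnlyR j) where
        j<κ = proj₁ only
        i = π j
        i<κ = proj₁ (π-spec j j<κ (proj₂ only))
        onlyL : ∀ x → v ~ x → c x ≡ i → L x ≡ true
        onlyL = proj₂ (π-spec j j<κ (proj₂ only))
        onlyL′ : ∀ x → v ~ x → c x ≡ i → R x ≡ false
        onlyL′ x vx e = Boolₚ.¬-not λ rx → disjoint x vx (onlyL x vx e) rx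
        rj = rep j
        li = rep i
        v~rj = proj₁ (rep-nbr j j<κ)
        v~li = proj₁ (rep-nbr i i<κ)
        c-rj = proj₂ (rep-nbr j j<κ)
        c-li = proj₂ (rep-nbr i i<κ)

        unique-rj : ∀ x → v ~ x → c x ≡ j → x ≡ rj
        unique-rj x vx e with x Finₚ.≟ rj
        ... | yes p = p
        ... | no ne = ⊥-elim (proper x rj (v≢ vx) (v≢ v~rj)
                (right x rj vx v~rj (notL x vx e) (notL rj v~rj c-rj) ne) (trans e (≡-sym c-rj)))
          where
          notL : ∀ x → v ~ x → c x ≡ j → L x ≡ false
          notL x vx e = Boolₚ.¬-not λ lx → disjoint x vx lx (proj₂ only x vx e)
        unique-li : ∀ x → v ~ x → c x ≡ i → x ≡ li
        unique-li x vx e = LM-unique (vx , onlyL′ x vx e) (v~li , onlyL′ li v~li c-li) (trans e (≡-sym c-li))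

        i≢j : i ≢ j
        i≢j e = disjoint rj v~rj (onlyL rj v~rj (trans c-rj (≡-sym e))) (proj₂ only rj v~rj c-rj)

        comp : Component G (Two j) rj
        comp = component G (two? j) rj (v≢ v~rj , inj₁ c-rj)
        open Component comp renaming (D to D₂)

        σ : ℕ → ℕ
        σ z with z ≟ j
        ... | yes _ = i
        ... | no _ = j
        swapped : Fin n → ℕ
        swapped w = if D₂ w then σ (c w) else c w

        -- Exchanging the two colours on the chain of rj would free colour j at v.
        abstract
          li∈chain : D₂ li ≡ true
          li∈chain = Boolₚ.¬-not λ li∉ → recolour G unbounded bw swapped swapped< j j<κ swapped-proper (free li∉)
            where
            σ< : ∀ z → σ z < κ
            σ< z with z ≟ j
            ... | yes _ = i<κ
            ... | no _ = j<κ
            swapped< : ∀ x → x ≢ v → swapped x < κ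
            swapped< x ne with D₂ x
            ... | true = σ< (c x)
            ... | false = c<κ x ne
            σ-in : ∀ z → σ z ≡ j ⊎ σ z ≡ i
            σ-in z with z ≟ j
            ... | yes _ = inj₂ refl
            ... | no _ = inj₁ refl
            σ-inj : ∀ {a b} → a ≡ j ⊎ a ≡ i → b ≡ j ⊎ b ≡ i → σ a ≡ σ b → a ≡ b
            σ-inj {a} {b} ha hb e with a ≟ j | b ≟ j
            ... | yes p | yes q = trans p (≡-sym q)
            ... | yes p | no q = ⊥-elim (i≢j e)
            ... | no p | yes q = ⊥-elim (i≢j (≡-sym e))
            ... | no p | no q = trans ([_,_]′ (⊥-elim ∘ p) id ha) (≡-sym ([_,_]′ (⊥-elim ∘ q) id hb))
            mixed : ∀ x y → D₂ x ≡ true → D₂ y ≡ false → y ≢ v → x ~ y → σ (c x) ≢ c y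
            mixed x y dx dy ny a e = true≢false (closed x y dx (ny , subst (λ z → z ≡ j ⊎ z ≡ i) e (σ-in (c x))) a) dy
            swapped-proper : ∀ x y → x ≢ v → y ≢ v → x ~ y → swapped x ≢ swapped y
            swapped-proper x y nx ny a with D₂ x in dx | D₂ y in dy
            ... | true | true = λ e → proper x y nx ny a
                    (σ-inj (proj₂ (walk-end G (sound x dx))) (proj₂ (walk-end G (sound y dy))) e)
            ... | true | false = mixed x y dx dy ny a
            ... | false | true = λ e → mixed y x dy dx nx (~-sym a) (≡-sym e)
            ... | false | false = proper x y nx ny a
            σ≡j : ∀ z → z ≡ j ⊎ z ≡ i → σ z ≡ j → z ≡ i
            σ≡j z h e with z ≟ j
            ... | yes _ = ⊥-elim (i≢j e)
            ... | no ne = [_,_]′ (⊥-elim ∘ ne) id h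
            free : D₂ li ≡ false → ∀ x → v ~ x → swapped x ≢ j
            free li∉ x vx with D₂ x in dx
            ... | false = λ e → true≢false (subst (λ z → D₂ z ≡ true) (≡-sym (unique-rj x vx e)) source) dx
            ... | true = λ e → true≢false (subst (λ z → D₂ z ≡ true)
                    (unique-li x vx (σ≡j (c x) (proj₂ (walk-end G (sound x dx))) e)) dx) li∉

        open InducedPath (walk⇒inducedPath G (sound li li∈chain))

        colourAt : ℕ → ℕ
        colourAt zero = j
        colourAt (suc zero) = i
        colourAt (suc (suc k)) = colourAt k

        alternates : ∀ k → k ≤ len → c (at k) ≡ colourAt k
        alternates zero _ = trans (cong c start) c-rj
        alternates (suc k) k≤ = go k (alternates k (<⇒≤ k≤)) (proj₂ (within (suc k) k≤))
            (proper (at k) (at (suc k)) (proj₁ (within k (<⇒≤ k≤))) (proj₁ (within (suc k) k≤)) (induced .edge k k≤))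
          where
          flip : ∀ k → (colourAt k ≡ j × colourAt (suc k) ≡ i) ⊎ (colourAt k ≡ i × colourAt (suc k) ≡ j)
          flip zero = inj₁ (refl , refl)
          flip (suc k) with flip k
          ... | inj₁ (a , b) = inj₂ (b , a)
          ... | inj₂ (a , b) = inj₁ (b , a)
          go : ∀ k → c (at k) ≡ colourAt k → ∀ {z} → z ≡ j ⊎ z ≡ i → c (at k) ≢ z → z ≡ colourAt (suc k)
          go k e h ne with flip k
          go k e (inj₁ refl) ne | inj₁ (a , b) = ⊥-elim (ne (trans e a))
          go k e (inj₂ refl) ne | inj₁ (a , b) = ≡-sym b
          go k e (inj₁ refl) ne | inj₂ (a , b) = ≡-sym b
          go k e (inj₂ refl) ne | inj₂ (a , b) = ⊥-elim (ne (trans e a))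

        odd-length : ∀ k → colourAt k ≡ i → ∃ λ q → k ≡ suc (q + q)
        odd-length zero e = ⊥-elim (i≢j (≡-sym e))
        odd-length (suc zero) e = 0 , refl
        odd-length (suc (suc k)) e with odd-length k e
        ... | q , refl = suc q , cong (suc ∘ suc) (≡-sym (+-suc q q))

        even-colour : ∀ q → colourAt (q + q) ≡ j
        even-colour zero = refl
        even-colour (suc q) rewrite +-suc q q = even-colour q

        abstract
          half : ∃ λ q → len ≡ suc (q + q)
          half = odd-length len (trans (≡-sym (alternates len ≤-refl)) (trans (cong c end) c-li))

        q = proj₁ half

        li-only-last : ∀ k → k < len → at k ≢ li
        li-only-last k k< e = induced .distinct k len k< ≤-refl (trans e (≡-sym end))

        -- The chain closes up through v to an odd hole.
        t≤ : t ≤ suc q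
        t≤ = ≮⇒≥ λ q<t → noShort (2 + len) (s≤s (s≤s 2≤len)) (long q<t) (apexCycle G apex)
          where
          2≤len : 2 ≤ len
          -- Length 0 would identify the colours `i` and `j`, and length 1 would be an edge between
          -- L and R.
          2≤len = go len refl
            where
            go : ∀ l → l ≡ len → 2 ≤ l
            go zero e = ⊥-elim (i≢j (trans (≡-sym (trans (cong c (trans (cong at e) end)) c-li)) (trans (cong c start) c-rj)))
            go (suc zero) e = ⊥-elim (apart li rj v~li v~rj (onlyL li v~li c-li) (proj₂ only rj v~rj c-rj)
              (~-sym (Eq.subst₂ _~_ start (trans (cong at e) end) (induced .edge 0 (subst (0 <_) e (s≤s z≤n))))))
            go (suc (suc l)) _ = s≤s (s≤s z≤n)
          long : suc q < t → 2 + len < t + t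
          long q<t = subst (λ l → 3 + l ≤ t + t) (≡-sym (proj₂ half))
            (subst (_≤ t + t) (cong (2 +_) (trans (+-suc q (suc q)) (cong suc (+-suc q q)))) (+-mono-≤ q<t q<t))
          apex : IsApex G v len at
          apex = record
            { 2≤ℓ = 2≤len ; path = induced
            ; first = subst (v ~_) (≡-sym start) v~rj ; final = subst (v ~_) (≡-sym end) v~li
            ; middle = mid ; off = λ k k≤ e → proj₁ (within k k≤) (≡-sym e) }
            where
            mid : ∀ k → 0 < k → k < len → v ≁ at k
            mid k 0<k k< a with proj₂ (within k (<⇒≤ k<))
            ... | inj₁ e = induced .distinct 0 k 0<k (<⇒≤ k<) (trans start (≡-sym (unique-rj (at k) a e)))
            ... | inj₂ e = li-only-last k k< (unique-li (at k) a e)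

        -- The odd hole leaves no room for a vertex of L that misses the chain.
        dominates : ∀ l → LeftMid l → ∃ λ k → k < len × l ~ at k
        dominates l (vl , rl) with Finₚ.any? {n = len} (λ k → _~?_ l (at (toℕ k)))
        ... | yes (k , a) = toℕ k , Finₚ.toℕ<n k , a
        ... | no none = ⊥-elim (independence (f , f-inj , f-indep))
          where
          l≁ : ∀ k → k < len → l ≁ at k
          l≁ k k< a = none (fromℕ< k< , subst (λ z → l ~ at z) (≡-sym (Finₚ.toℕ-fromℕ< k<)) a)
          dbl : Fin t → ℕ
          dbl k = toℕ k + toℕ k
          dbl< : ∀ k → dbl k < len
          dbl< k = subst (dbl k <_) (≡-sym (proj₂ half)) (s≤s (+-mono-≤ k≤ k≤))
            where k≤ = ≤-pred (<-≤-trans (Finₚ.toℕ<n k) t≤)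
          -- Even positions of the chain have colour `j`, which is absent from L ∪ M, so they differ
          -- from `l`. By `t≤` there are at least t of them before the end, which together with `l`
          -- is one too many.
          f : Fin (suc t) → Fin n
          f Fin.zero = l
          f (Fin.suc k) = at (dbl k)
          l≢ : ∀ k → l ≢ at (dbl k)
          l≢ k e = true≢false (proj₂ only l vl (trans (cong c e)
            (trans (alternates (dbl k) (<⇒≤ (dbl< k))) (even-colour (toℕ k))))) rl
          mono : ∀ {a b} → toℕ {t} a < toℕ {t} b → 2 + dbl a ≤ dbl b
          mono {a} {b} lt = subst (_≤ dbl b) (+-suc (suc (toℕ a)) (toℕ a)) (+-mono-≤ lt lt)
          f-inj : ∀ {a b} → f a ≡ f b → a ≡ b
          f-inj {Fin.zero} {Fin.zero} _ = refl
          f-inj {Fin.zero} {Fin.suc b} e = ⊥-elim (l≢ b e)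
          f-inj {Fin.suc a} {Fin.zero} e = ⊥-elim (l≢ a (≡-sym e))
          f-inj {Fin.suc a} {Fin.suc b} e with <-cmp (toℕ a) (toℕ b)
          ... | tri< lt _ _ = ⊥-elim (induced .distinct _ _ (<-trans ≤-refl (mono {a} {b} lt)) (<⇒≤ (dbl< b)) e)
          ... | tri≈ _ p _ = cong Fin.suc (Finₚ.toℕ-injective p)
          ... | tri> _ _ gt = ⊥-elim (induced .distinct _ _ (<-trans ≤-refl (mono {b} {a} gt)) (<⇒≤ (dbl< a)) (≡-sym e))
          f-≁ : ∀ a b → f a ≁ f b
          f-≁ Fin.zero Fin.zero = ~-irrefl
          f-≁ Fin.zero (Fin.suc b) = l≁ (dbl b) (dbl< b)
          f-≁ (Fin.suc a) Fin.zero = ≁-sym (l≁ (dbl a) (dbl< a))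
          f-≁ (Fin.suc a) (Fin.suc b) h with <-cmp (toℕ a) (toℕ b)
          ... | tri< lt _ _ = induced .chordless _ _ (mono {a} {b} lt) (<⇒≤ (dbl< b)) h
          ... | tri≈ _ p _ = ~-irrefl (subst (λ z → at (dbl a) ~ at (dbl z)) (≡-sym (Finₚ.toℕ-injective p)) h)
          ... | tri> _ _ gt = induced .chordless _ _ (mono {b} {a} gt) (<⇒≤ (dbl< a)) (~-sym h)
          f-indep : ∀ a b → adj G (f a) (f b) ≡ false
          f-indep a b = ≁⇒false (f-≁ a b)

        outside : ∀ k → k < len → Outside j (at k)
        outside k k< = within k (<⇒≤ k<) , λ lm → case proj₂ (within k (<⇒≤ k<)) of λ
          { (inj₁ e) → true≢false (proj₂ only (at k) (proj₁ lm) e) (proj₂ lm)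
          ; (inj₂ e) → li-only-last k k< (unique-li (at k) (proj₁ lm) e) }

        prefix : ∀ k → k < len → WalkIn G (Outside j) rj (at k)
        prefix zero k< = subst (λ z → WalkIn G (Outside j) z (at 0)) start (here (outside 0 k<))
        prefix (suc k) k< = walk-snoc G (prefix k (<-trans ≤-refl k<)) (induced .edge k (<-trans ≤-refl k<)) (outside (suc k) k<)

        rj-outside : Outside j rj
        rj-outside = walk-start G (prefix 0 (subst (0 <_) (≡-sym (proj₂ half)) (s≤s z≤n)))

        touches : ∀ l → LeftMid l → ∃ λ y → WalkIn G (Outside j) rj y × l ~ y
        touches l lm with dominates l lm
        ... | k , k< , a = at k , prefix k k< , a

      -- The branch set of a colour seen only in R is a whole component outside L ∪ M rather than
      -- the induced path. It contains the part of the path that dominates L ∪ M, and connectedness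
      -- is built in.
      Reach : ℕ → Fin n → Set
      Reach j x = OnlyR j × WalkIn G (Outside j) (rep j) x

      reach? : ∀ j x → Dec (Reach j x)
      reach? j x with onlyR? j
      ... | no h = no (h ∘ proj₁)
      ... | yes o with component G (outside? j) (rep j) (Chain.rj-outside o)
      ...   | C with Component.D C x in eq
      ...     | true = yes (o , Component.sound C x eq)
      ...     | false = no λ (_ , w) → true≢false (Component.reaches C w) eq

      -- A chain vertex labelled `j` has colour `j` or `π j`, so its label is `c x` or `π (c x)`;
      -- hence the two tests. The label `suc κ` discards a vertex.
      ψ : Fin n → ℕ
      ψ x with x Finₚ.≟ v | leftMid? x | reach? (c x) x | reach? (π (c x)) x
      ... | yes _ | _ | _ | _ = κ
      ... | no _ | yes _ | _ | _ = c x
      ... | no _ | no _ | yes _ | _ = c x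
      ... | no _ | no _ | no _ | yes _ = π (c x)
      ... | no _ | no _ | no _ | no _ = suc κ

      ψ-v : ψ v ≡ κ
      ψ-v with v Finₚ.≟ v | leftMid? v | reach? (c v) v | reach? (π (c v)) v
      ... | yes _ | _ | _ | _ = refl
      ... | no ne | _ | _ | _ = ⊥-elim (ne refl)

      ψ-κ : ∀ x → ψ x ≡ κ → x ≡ v
      ψ-κ x e with x Finₚ.≟ v | leftMid? x | reach? (c x) x | reach? (π (c x)) x
      ... | yes p | _ | _ | _ = p
      ... | no ne | yes _ | _ | _ = ⊥-elim (<-irrefl e (c<κ x ne))
      ... | no ne | no _ | yes _ | _ = ⊥-elim (<-irrefl e (c<κ x ne))
      ... | no _ | no _ | no _ | yes (o , _) = ⊥-elim (<-irrefl e (proj₁ o))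
      ... | no _ | no _ | no _ | no _ = ⊥-elim (<-irrefl (≡-sym e) ≤-refl)

      ψ-left : ∀ x → LeftMid x → ψ x ≡ c x
      ψ-left x lm with x Finₚ.≟ v | leftMid? x | reach? (c x) x | reach? (π (c x)) x
      ... | yes e | _ | _ | _ = ⊥-elim (v≢ (proj₁ lm) e)
      ... | no _ | yes _ | _ | _ = refl
      ... | no _ | no h | _ | _ = ⊥-elim (h lm)

      ψ-reach : ∀ j x → Reach j x → ψ x ≡ j
      ψ-reach j x rx@(o , w) with walk-end G w | x Finₚ.≟ v | leftMid? x | reach? (c x) x | reach? (π (c x)) x
      ... | (nv , _) , _ | yes e | _ | _ | _ = ⊥-elim (nv e)
      ... | _ , nl | no _ | yes h | _ | _ = ⊥-elim (nl h)
      ... | (_ , inj₁ e) , _ | no _ | no _ | yes _ | _ = e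
      ... | (_ , inj₁ e) , _ | no _ | no _ | no h | _ = ⊥-elim (h (subst (λ z → Reach z x) (≡-sym e) rx))
      -- Here `c x` is `π j`, a colour seen only in L, so it cannot also head a chain of its own.
      ... | (_ , inj₂ e) , _ | no _ | no _ | yes (o′ , _) | _ =
        ⊥-elim (disjoint li v~li (onlyL li v~li c-li) (proj₂ o′ li v~li (trans c-li (≡-sym e))))
        where open Chain o
      ... | (_ , inj₂ e) , _ | no _ | no _ | no _ | yes _ = trans (cong π e) (π-inv j)
      ... | (_ , inj₂ e) , _ | no _ | no _ | no _ | no h =
        ⊥-elim (h (subst (λ z → Reach z x) (≡-sym (trans (cong π e) (π-inv j))) rx))

      ψ-sound : ∀ j x → j < κ → ψ x ≡ j → (LeftMid x × c x ≡ j) ⊎ Reach j x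
      ψ-sound j x j< e with x Finₚ.≟ v | leftMid? x | reach? (c x) x | reach? (π (c x)) x
      ... | yes p | _ | _ | _ = ⊥-elim (<-irrefl (≡-sym e) j<)
      ... | no ne | yes h | _ | _ = inj₁ (h , e)
      ... | no ne | no _ | yes h | _ = inj₂ (subst (λ z → Reach z x) e h)
      ... | no _ | no _ | no _ | yes h = inj₂ (subst (λ z → Reach z x) e h)
      ... | no _ | no _ | no _ | no _ = ⊥-elim (<-irrefl (≡-sym e) (m<n⇒m<1+n j<))

      centre : ℕ → Fin n
      centre i with i ≟ κ
      ... | yes _ = v
      ... | no _ = rep i

      ψ-rep : ∀ i → i < κ → ψ (rep i) ≡ i
      ψ-rep i i< with onlyR? i
      ... | yes o = ψ-reach i (rep i) (o , here (Chain.rj-outside o))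
      ... | no h = trans (ψ-left (rep i) (rep-left i i< h)) (proj₂ (rep-nbr i i<))

      below : ∀ {i} → i < suc κ → i ≢ κ → i < κ
      below i< ne = ≤∧≢⇒< (≤-pred i<) ne

      ψ-centre : ∀ i → i < suc κ → ψ (centre i) ≡ i
      ψ-centre i i< with i ≟ κ
      ... | yes refl = ψ-v
      ... | no ne = ψ-rep i (below i< ne)

      grow-walk : ∀ j {x} → OnlyR j → WalkIn G (Outside j) (rep j) x → WalkIn G (λ w → ψ w ≡ j) (rep j) x
      grow-walk j o w = go (here (walk-start G w)) w
        where
        go : ∀ {y x} → WalkIn G (Outside j) (rep j) y → WalkIn G (Outside j) y x → WalkIn G (λ w → ψ w ≡ j) y x
        go p (here _) = here (ψ-reach j _ (o , p))
        go p (step _ a w) = step (ψ-reach j _ (o , p)) a (go (walk-snoc G p a (walk-start G w)) w)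

      centre-walk : ∀ i x → i < suc κ → ψ x ≡ i → WalkIn G (λ w → ψ w ≡ i) (centre i) x
      centre-walk i x i< e with i ≟ κ
      ... | yes refl = subst (WalkIn G _ v) (≡-sym (ψ-κ x e)) (here ψ-v)
      ... | no ne with onlyR? i | ψ-sound i x (below i< ne) e
      ...   | yes o | inj₁ ((vx , rx) , ce) = true≢false (proj₂ o x vx ce) rx
      ...   | _ | inj₂ (o , w) = grow-walk i o w
      ...   | no h | inj₁ (lm , ce) =
        subst (WalkIn G _ (rep i)) (LM-unique (rep-left i i<κ h) lm (trans (proj₂ (rep-nbr i i<κ)) (≡-sym ce)))
          (here (ψ-rep i i<κ))
        where i<κ = below i< ne

      -- Two labels present in L ∪ M meet in that clique, two seen only in R meet in M ∪ R, and a
      -- mixed pair meets because the chain dominates L ∪ M.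
      joins : ∀ i j → i < j → j < suc κ → ∃ λ u → ∃ λ w → ψ u ≡ i × ψ w ≡ j × u ~ w
      joins i j i<j j< with j ≟ κ
      ... | yes refl = rep i , v , ψ-rep i i<j , ψ-v , ~-sym (proj₁ (rep-nbr i i<j))
      ... | no ne with onlyR? i | onlyR? j
      ...   | no hi | no hj = rep i , rep j , ψ-rep i i<κ , ψ-rep j j<κ ,
                left _ _ (proj₁ li) (proj₁ lj) (proj₂ li) (proj₂ lj) rep≢
        where
        j<κ = below j< ne
        i<κ = <-trans i<j j<κ
        li = rep-left i i<κ hi
        lj = rep-left j j<κ hj
        rep≢ : rep i ≢ rep j
        rep≢ e = <-irrefl (trans (≡-sym (ψ-rep i i<κ)) (trans (cong ψ e) (ψ-rep j j<κ))) i<j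
      ...   | yes oi | yes oj = rep i , rep j , ψ-rep i i<κ , ψ-rep j j<κ ,
                right _ _ ni nj (notL oi) (notL oj) rep≢
        where
        j<κ = below j< ne
        i<κ = <-trans i<j j<κ
        ni = proj₁ (rep-nbr i i<κ)
        nj = proj₁ (rep-nbr j j<κ)
        rep≢ : rep i ≢ rep j
        rep≢ e = <-irrefl (trans (≡-sym (ψ-rep i i<κ)) (trans (cong ψ e) (ψ-rep j j<κ))) i<j
        notL : ∀ {k} → OnlyR k → L (rep k) ≡ false
        notL {k} (k< , o) = Boolₚ.¬-not λ lx → disjoint (rep k) (proj₁ (rep-nbr k k<)) lx
          (o (rep k) (proj₁ (rep-nbr k k<)) (proj₂ (rep-nbr k k<)))
      ...   | no hi | yes oj with Chain.touches oj (rep i) (rep-left i (<-trans i<j (below j< ne)) hi)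
      ...     | y , w , a = rep i , y , ψ-rep i (<-trans i<j (below j< ne)) , ψ-reach j y (oj , w) , a
      joins i j i<j j< | no ne | yes oi | no hj with Chain.touches oi (rep j) (rep-left j (below j< ne) hj)
      ...     | y , w , a = y , rep j , ψ-reach i y (oi , w) , ψ-rep j (below j< ne) , ~-sym a

      impossible : ⊥
      impossible = no-next-minor G unbounded bw (complete-minor G (suc κ) ψ centre ψ-centre centre-walk joins)

    mirror : Good G v → Good G v
    mirror g = record { L = R ; R = L ; disjoint = λ x vx l r → disjoint x vx r l ; left = right ; right = left
                      ; apart = λ x y vx vy rx ly a → apart y x vy vx ly rx (~-sym a) }
      where open Good g

    -- Whichever of the two sets of one-sided colours is matched into the other, it becomes the
    -- right-hand one, if need be after exchanging L and R.
    no-good : Good G v → ⊥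
    no-good g with matchBelow κ (only? L) (only? R) disj
      where
      open Good g
      Only : (Fin n → Bool) → ℕ → Set
      Only S j = j < κ × (∀ x → v ~ x → c x ≡ j → S x ≡ true)
      only? : ∀ S j → Dec (Only S j)
      only? S j with j <? κ
      ... | no h = no (h ∘ proj₁)
      ... | yes j< with Finₚ.any? (λ x → (_~?_ v x) ×-dec (c x ≟ j) ×-dec (S x Bool.≟ false))
      ...   | yes (x , vx , e , s) = no λ (_ , o) → true≢false (o x vx e) s
      ...   | no h = yes (j< , λ x vx e → Boolₚ.¬-not λ s → h (x , vx , e , s))
      disj : ∀ {i} → Only L i → Only R i → ⊥
      disj {i} (i< , l) (_ , r) with colour-seen G unbounded bw i i<
      ... | x , vx , e = disjoint x vx (l x vx e) (r x vx e)
    ... | π , inv , inj₁ spec = Kempe.impossible g π inv λ j j< o → Data.Product.map₂ proj₂ (spec j j< (j< , o))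
    ... | π , inv , inj₂ spec = Kempe.impossible (mirror g) π inv λ j j< o → Data.Product.map₂ proj₂ (spec j j< (j< , o))

-- Arcs, rotations and reflections of a hole

shift₂ : ∀ j i → j + (2 + i) ≡ 2 + j + i
shift₂ = solve-∀

module _ {n : ℕ} (G : Graph n) where
  open IsInducedPath

  open Adjacency G

  independentFamily : ∀ N (g : ℕ → Fin n) → (∀ a b → a < b → b < N → g a ≢ g b × g a ≁ g b) → HasIndependentSet G N
  independentFamily N g h = (λ i → g (toℕ i)) , inj , λ i j → ≁⇒false (apart i j)
    where
    inj : ∀ {i j : Fin N} → g (toℕ i) ≡ g (toℕ j) → i ≡ j
    inj {i} {j} e with <-cmp (toℕ i) (toℕ j)
    ... | tri< lt _ _ = ⊥-elim (proj₁ (h _ _ lt (Finₚ.toℕ<n j)) e)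
    ... | tri≈ _ p _ = Finₚ.toℕ-injective p
    ... | tri> _ _ gt = ⊥-elim (proj₁ (h _ _ gt (Finₚ.toℕ<n i)) (≡-sym e))
    apart : ∀ (i j : Fin N) → g (toℕ i) ≁ g (toℕ j)
    apart i j a with <-cmp (toℕ i) (toℕ j)
    ... | tri< lt _ _ = proj₂ (h _ _ lt (Finₚ.toℕ<n j)) a
    ... | tri≈ _ p _ = ~⇒≢ a (cong g p)
    ... | tri> _ _ gt = proj₂ (h _ _ gt (Finₚ.toℕ<n i)) (~-sym a)

  module OnHole {m} (5≤m : 5 ≤ m) (C : Hole G m) where
    open Hole C

    -- Injectivity need not be a field of `Hole`: two equal vertices would share a neighbour on the
    -- cycle at a distance where `far` forbids adjacency, once the length is at least 5.
    c-distinct : ∀ i d → 1 ≤ d → d < m → c i ≢ c (d + i)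
    c-distinct i (suc zero) _ _ e = ~⇒≢ (link i) e
    c-distinct i (suc (suc zero)) _ _ e = far i 3 (s≤s (s≤s z≤n)) 5≤m (subst (_~ c (3 + i)) (≡-sym e) (link (2 + i)))
    c-distinct i (suc (suc (suc d))) _ d< e =
      far i (2 + d) (s≤s (s≤s z≤n)) d< (subst (_~ c (2 + d + i)) (≡-sym e) (~-sym (link (2 + d + i))))

    private
      shift : ∀ {i j} k → i ≤ j → j + k ≡ (j ∸ i) + (i + k)
      shift {i} {j} k i≤j = trans (cong (_+ k) (≡-sym (m∸n+n≡m i≤j))) (+-assoc (j ∸ i) i k)

    arc : ∀ k ℓ → 2 + ℓ ≤ m → IsInducedPath G ℓ (λ j → c (j + k))
    arc k ℓ ℓ≤ .edge i _ = link (i + k)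
    arc k ℓ ℓ≤ .chordless i j h j≤ = subst (λ z → c (i + k) ≁ c z) (≡-sym (shift {i} {j} k (≤-trans (m≤n+m i 2) h)))
      (far (i + k) (j ∸ i) (subst (_≤ j ∸ i) (m+n∸n≡m 2 i) (∸-monoˡ-≤ i h))
        (≤-trans (+-monoʳ-≤ 2 (≤-trans (m∸n≤m j i) j≤)) ℓ≤))
    arc k ℓ ℓ≤ .distinct i j h j≤ = subst (λ z → c (i + k) ≢ c z) (≡-sym (shift {i} {j} k (<⇒≤ h)))
      (c-distinct (i + k) (j ∸ i) (m<n⇒0<n∸m h)
        (≤-<-trans (≤-trans (m∸n≤m j i) j≤) (<-≤-trans (n<1+n ℓ) (≤-trans (n≤1+n _) ℓ≤))))

    alternate : ∀ k N → N + N ≤ m → ∀ a b → a < b → b < N → c (a + a + k) ≢ c (b + b + k) × c (a + a + k) ≁ c (b + b + k)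
    alternate k (suc N) N≤ a b a<b (s≤s b≤) = arc k (N + N) le .distinct (a + a) (b + b) (+-mono-< a<b a<b) bb , arc k (N + N) le .chordless (a + a) (b + b)
        (subst (_≤ b + b) (cong suc (+-suc a a)) (+-mono-≤ a<b a<b)) bb
      where
      le : 2 + (N + N) ≤ m
      le = subst (_≤ m) (cong suc (+-suc N N)) N≤
      bb : b + b ≤ N + N
      bb = +-mono-≤ b≤ b≤

    c-wrap : ∀ k i → c (k * m + i) ≡ c i
    c-wrap zero i = refl
    c-wrap (suc k) i = trans (cong c (+-assoc m (k * m) i)) (trans (per _) (c-wrap k i))

    shortcut : ∀ x i ℓ → 2 ≤ ℓ → 2 + ℓ ≤ m → x ~ c i → x ~ c (ℓ + i) →
      (∀ j → 0 < j → j < ℓ → x ≁ c (j + i)) → (∀ j → 0 < j → j < ℓ → x ≢ c (j + i)) → IsApex G x ℓ (λ j → c (j + i))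
    shortcut x i ℓ 2≤ℓ ℓ≤ first final mid off = record
      { 2≤ℓ = 2≤ℓ ; path = arc i ℓ ℓ≤ ; first = first ; final = final ; middle = mid ; off = off′ }
      where
      off′ : ∀ j → j ≤ ℓ → x ≢ c (j + i)
      off′ zero _ = ~⇒≢ first
      off′ (suc j) j≤ with suc j ≟ ℓ
      ... | yes refl = ~⇒≢ final
      ... | no ne = off (suc j) (s≤s z≤n) (≤∧≢⇒< j≤ ne)

    -- A vertex of the arc itself cannot see just its two ends, unless it is the middle of three.
    off-arc : ∀ x i ℓ → 3 ≤ ℓ → (∀ j → 0 < j → j < ℓ → x ≁ c (j + i)) → ∀ j → 0 < j → j < ℓ → x ≢ c (j + i)
    off-arc x i ℓ 3≤ℓ mid (suc j) _ j< e with suc (suc j) ≟ ℓ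
    ... | no ne = mid (2 + j) (s≤s z≤n) (≤∧≢⇒< j< ne) (subst (_~ c (2 + j + i)) (≡-sym e) (link (suc j + i)))
    off-arc x i ℓ 3≤ℓ mid (suc zero) _ j< e | yes refl = ⊥-elim (<-irrefl refl 3≤ℓ)
    off-arc x i ℓ 3≤ℓ mid (suc (suc j)) _ j< e | yes _ =
      mid (suc j) (s≤s z≤n) (<-trans ≤-refl j<) (subst (_~ c (suc j + i)) (≡-sym e) (~-sym (link (suc j + i))))

  rotate : ∀ {m} → ℕ → Hole G m → Hole G m
  rotate {m} k C = record
    { c = λ i → c (i + k)
    ; per = λ i → trans (cong c (+-assoc m i k)) (per (i + k))
    ; link = λ i → link (i + k)
    ; far = λ i d 2≤d d≤ → subst (λ z → c (i + k) ≁ c z) (≡-sym (+-assoc d i k)) (far (i + k) d 2≤d d≤) }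
    where open Hole C

  -- Multiplication by m ∸ 1 is negation modulo m.
  reflect : ∀ {m} → Hole G (suc m) → Hole G (suc m)
  reflect {m} C = record
    { c = λ i → c (i * m)
    ; per = λ i → trans (cong c (e₁ i m)) (wrap m (i * m))
    ; link = λ i → ~-sym (subst (c (m + i * m) ~_) (per (i * m)) (link (m + i * m)))
    ; far = λ i d 2≤d d≤ a → far (((d + i)) * m) d 2≤d d≤
        (~-sym (subst (_~ c ((d + i) * m)) (≡-sym (trans (cong c (e₂ d i m)) (wrap d (i * m)))) a)) }
    where
    open Hole C
    wrap : ∀ k i → c (k * suc m + i) ≡ c i
    wrap zero i = refl
    wrap (suc k) i = trans (cong c (+-assoc (suc m) (k * suc m) i)) (trans (per _) (wrap k i))
    e₁ : ∀ i m → (suc m + i) * m ≡ m * suc m + i * m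
    e₁ = solve-∀
    e₂ : ∀ d i m → d + (d + i) * m ≡ d * suc m + i * m
    e₂ = solve-∀

  -- Modulo `2 + m`, adding `1 + m` is a step back. From `i`, `i` such steps lead to 0 and
  -- `suc m * k` further ones to `k`, because `1 + m` is -1.
  backwards : ∀ m (Q : ℕ → Set) → (∀ i → Q (2 + m + i) → Q i) → (∀ i → Q i → Q (suc m + i)) →
    ∀ i → Q i → ∀ k → Q k
  backwards m Q down back i qi k = unwrap (i + m * k) k (subst Q (e i k m) (iterate (i + suc m * k) qi))
    where
    iterate : ∀ j → Q i → Q (j * suc m + i)
    iterate zero q = q
    iterate (suc j) q = subst Q (≡-sym (+-assoc (suc m) (j * suc m) i)) (back _ (iterate j q))
    unwrap : ∀ j k → Q (j * (2 + m) + k) → Q k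
    unwrap zero k q = q
    unwrap (suc j) k q = unwrap j k (down _ (subst Q (+-assoc (2 + m) (j * (2 + m)) k) q))
    e : ∀ i k m → (i + suc m * k) * suc m + i ≡ (i + m * k) * (2 + m) + k
    e = solve-∀

last≤ : ∀ {T : ℕ → Set} → (∀ i → Dec (T i)) → ∀ L → T 0 → ∃ λ b → b ≤ L × T b × (∀ j → b < j → j ≤ L → ¬ T j)
last≤ {T} T? L t0 with lastSuch T? L t0
... | b , r , eq , tb , none = b , subst (b ≤_) eq (m≤m+n b r) , tb , none′
  where
  none′ : ∀ j → b < j → j ≤ L → ¬ T j
  none′ j b<j j≤ t = none (j ∸ suc b) (subst (_≤ r) (+-∸-assoc 1 b<j) (≤-trans (∸-monoˡ-≤ b j≤) (≤-reflexive (trans (cong (_∸ b) (≡-sym eq)) (m+n∸m≡n b r)))))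
    (subst T (trans (≡-sym (m∸n+n≡m b<j)) (+-suc (j ∸ suc b) b)) t)

-- Holes.  The bound on the independence number is t = 3 + s, and e = 2t ∸ 6, so that a hole has
-- length 6 + e or 7 + e.

module Holes {n : ℕ} (G : Graph n) (s : ℕ) (independence : ¬ HasIndependentSet G (4 + s))
  (noShort : ∀ k → 4 ≤ k → k ≤ 5 + (s + s) → ¬ HasInducedCycle G k) where
  open IsInducedPath

  open Adjacency G public

  e : ℕ
  e = s + s

  noApex : ∀ {v ℓ p} → IsApex G v ℓ p → ℓ ≤ 3 + e → ⊥
  noApex ap ℓ≤ = noShort _ (s≤s (s≤s (IsApex.2≤ℓ ap))) (s≤s (s≤s ℓ≤)) (apexCycle G ap)

  path₁ : ∀ {a b} → a ~ b → IsInducedPath G 1 (cons G a (λ _ → b))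
  path₁ {a} {b} ab = cons-induced G
    (record { edge = λ _ () ; chordless = λ { _ _ () z≤n } ; distinct = λ { _ _ () z≤n } })
    ab (λ _ ()) λ _ _ → ~⇒≢ ab

  path₂ : ∀ {a b c} → a ~ b → b ~ c → a ≁ c → a ≢ c → IsInducedPath G 2 (cons G a (cons G b λ _ → c))
  path₂ ab bc a≁c a≢c = cons-induced G (path₁ bc) ab (λ { zero _ → a≁c ; (suc _) (s≤s ()) })
    λ { zero _ → ~⇒≢ ab ; (suc zero) _ → a≢c ; (suc (suc _)) (s≤s ()) }

  noC₄ : ∀ {a b c d} → a ~ b → b ~ c → c ~ d → d ~ a → a ≢ c → b ≢ d → a ≁ c → b ≁ d → ⊥
  noC₄ {a} {b} {c} {d} ab bc cd da a≢c b≢d a≁c b≁d = noApex {a} {2} {cons G b (cons G c λ _ → d)} (record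
    { 2≤ℓ = ≤-refl ; path = path₂ bc cd b≁d b≢d ; first = ab ; final = ~-sym da
    ; middle = λ { (suc zero) _ _ → a≁c ; (suc (suc _)) _ (s≤s (s≤s ())) }
    ; off = λ { zero _ → ~⇒≢ ab ; (suc zero) _ → a≢c ; (suc (suc zero)) _ → ~⇒≢ (~-sym da) ; (suc (suc (suc _))) (s≤s (s≤s ())) } })
    (s≤s (s≤s z≤n))

  noC₅ : ∀ {a b c d f} → a ~ b → b ~ c → c ~ d → d ~ f → f ~ a →
    a ≁ c → a ≁ d → b ≁ d → b ≁ f → c ≁ f → ⊥
  noC₅ {a} {b} {c} {d} {f} ab bc cd df fa a≁c a≁d b≁d b≁f c≁f = noApex {a} {3} {cons G b (cons G c (cons G d λ _ → f))} (record
    { 2≤ℓ = s≤s (s≤s z≤n)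
    ; path = cons-induced G (path₂ cd df c≁f λ { refl → a≁c (~-sym fa) }) bc
        (λ { zero _ → b≁d ; (suc zero) _ → b≁f ; (suc (suc _)) (s≤s (s≤s ())) })
        λ { zero _ → ~⇒≢ bc ; (suc zero) _ → λ { refl → b≁f df } ; (suc (suc zero)) _ → λ { refl → b≁d (~-sym df) }
          ; (suc (suc (suc _))) (s≤s (s≤s ())) }
    ; first = ab ; final = ~-sym fa
    ; middle = λ { (suc zero) _ _ → a≁c ; (suc (suc zero)) _ _ → a≁d ; (suc (suc (suc _))) _ (s≤s (s≤s (s≤s ()))) }
    ; off = λ { zero _ → ~⇒≢ ab ; (suc zero) _ → λ { refl → a≁d cd } ; (suc (suc zero)) _ → λ { refl → a≁c (~-sym cd) }
              ; (suc (suc (suc zero))) _ → ~⇒≢ (~-sym fa) ; (suc (suc (suc (suc _)))) (s≤s (s≤s (s≤s ()))) } })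
    (m≤m+n 3 _)

  -- Otherwise `a`, `p`, `b`, `q` would be an induced 4-cycle.
  common : ∀ {a b p q} → a ≢ b → a ~ p → a ~ q → b ~ p → b ~ q → p ≢ q → p ≁ q → a ~ b
  common {a} {b} a≢b ap aq bp bq p≢q p≁q = ~-stable λ a≁b →
    noC₄ ap (~-sym bp) bq (~-sym aq) a≢b p≢q a≁b p≁q

  module _ {m} (6≤m : 6 + e ≤ m) (C : Hole G m) where
    open Hole C
    private
      5≤m : 5 ≤ m
      5≤m = ≤-trans (m≤m+n 5 _) 6≤m
    open OnHole G 5≤m C

    -- Every vertex of an arc with at least two vertices has a neighbour on that arc.
    off-window : ∀ {x} a w → 1 ≤ w → (∀ j → j ≤ w → x ≁ c (j + a)) → ∀ j → j ≤ w → x ≢ c (j + a)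
    off-window a w 1≤w h j j≤ eq with m≤n⇒m<n∨m≡n j≤
    ... | inj₁ j< = h (suc j) j< (subst (_~ c (suc j + a)) (≡-sym eq) (link (j + a)))
    off-window a .(suc j) 1≤w h (suc j) j≤ eq | inj₂ refl =
      h j (n≤1+n j) (subst (_~ c (j + a)) (≡-sym eq) (~-sym (link (j + a))))
    off-window a .0 () h zero j≤ eq | inj₂ refl

    private
      dbl : ∀ {k} N → k < suc N → k + k ≤ N + N
      dbl N (s≤s k≤) = +-mono-≤ k≤ k≤

    -- A vertex missing an arc of 2t ∸ 1 vertices extends an independent set of size t.
    miss₁ : ∀ {x} a → (∀ j → j ≤ 4 + e → x ≁ c (j + a)) → ⊥
    miss₁ {x} a h = independence (independentFamily G (4 + s) (cons G x λ k → c (k + k + a)) ind)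
      where
      le : ∀ {k} → k < 3 + s → k + k ≤ 4 + e
      le {k} k< = subst (k + k ≤_) (eq s) (dbl (2 + s) k<)
        where
        eq : ∀ s → (2 + s) + (2 + s) ≡ 4 + (s + s)
        eq = solve-∀
      fit : ∀ s → (3 + s) + (3 + s) ≡ 6 + (s + s)
      fit = solve-∀
      ind : ∀ i j → i < j → j < 4 + s → cons G x (λ k → c (k + k + a)) i ≢ cons G x (λ k → c (k + k + a)) j ×
                                        cons G x (λ k → c (k + k + a)) i ≁ cons G x (λ k → c (k + k + a)) j
      ind zero (suc j) _ (s≤s j<) = off-window a (4 + e) (s≤s z≤n) h (j + j) (le j<) , h (j + j) (le j<)
      ind (suc i) (suc j) (s≤s i<j) (s≤s j<) = alternate a (3 + s) (subst (_≤ m) (≡-sym (fit s)) 6≤m) i j i<j j<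

    -- Otherwise `x`, `y` and t ∸ 1 alternate vertices of the missed arc, which has 2t ∸ 3 vertices,
    -- would be independent.
    miss₂ : ∀ {x y} a → x ≢ y → (∀ j → j ≤ 2 + e → x ≁ c (j + a)) → (∀ j → j ≤ 2 + e → y ≁ c (j + a)) → x ~ y
    miss₂ {x} {y} a x≢y hx hy = ~-stable λ x≁y →
        independence (independentFamily G (4 + s) g (ind x≁y))
      where
      g : ℕ → Fin n
      g = cons G x (cons G y λ k → c (k + k + a))
      le : ∀ {k} → k < 2 + s → k + k ≤ 2 + e
      le {k} k< = subst (k + k ≤_) (eq s) (dbl (1 + s) k<)
        where
        eq : ∀ s → (1 + s) + (1 + s) ≡ 2 + (s + s)
        eq = solve-∀
      fit : (2 + s) + (2 + s) ≤ m
      fit = ≤-trans (≤-trans (≤-reflexive (eq s)) (m≤n+m (4 + e) 2)) 6≤m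
        where
        eq : ∀ s → (2 + s) + (2 + s) ≡ 4 + (s + s)
        eq = solve-∀
      ind : x ≁ y → ∀ i j → i < j → j < 4 + s → g i ≢ g j × g i ≁ g j
      ind x≁y zero (suc zero) _ _ = x≢y , x≁y
      ind _ zero (suc (suc j)) _ (s≤s (s≤s j<)) = off-window a (2 + e) (s≤s z≤n) hx (j + j) (le j<) , hx (j + j) (le j<)
      ind _ (suc zero) (suc (suc j)) _ (s≤s (s≤s j<)) = off-window a (2 + e) (s≤s z≤n) hy (j + j) (le j<) , hy (j + j) (le j<)
      ind _ (suc zero) (suc zero) (s≤s ()) _
      ind _ (suc (suc i)) (suc (suc j)) (s≤s (s≤s i<j)) (s≤s (s≤s j<)) = alternate a (2 + s) fit i j i<j j<

    gap : ∀ {x} i ℓ → 2 ≤ ℓ → ℓ ≤ 3 + e → x ~ c i → x ~ c (ℓ + i) →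
      (∀ j → 0 < j → j < ℓ → x ≁ c (j + i)) → (∀ j → 0 < j → j < ℓ → x ≢ c (j + i)) → ⊥
    gap i ℓ 2≤ ℓ≤ f l mid off = noApex
      (shortcut _ i ℓ 2≤ (≤-trans (s≤s (s≤s ℓ≤)) (≤-trans (n≤1+n _) 6≤m)) f l mid off) ℓ≤

  module _ {m} (C : Hole G m) where
    open Hole C

    Off : Fin n → Set
    Off x = ∀ i → x ≢ c i

    record Run (i k : ℕ) (x : Fin n) : Set where
      field
        hit : ∀ j → j < k → x ~ c (j + i)
        miss : ∀ j → k ≤ j → j < m → x ≁ c (j + i)

    -- Such x can replace c (1 + i).
    record X (i : ℕ) (x : Fin n) : Set where
      field
        hit₀ : x ~ c i
        hit₂ : x ~ c (2 + i)
        miss : ∀ j → 3 ≤ j → j < m → x ≁ c (j + i)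

    Run-down : ∀ {i k x} → Run (m + i) k x → Run i k x
    Run-down {i} r = record { hit = λ j j< → subst (_ ~_) (eq j) (r .hit j j<) ; miss = λ j a b → r .miss j a b ∘ subst (_ ~_) (≡-sym (eq j)) }
      where
      open Run
      swap₃ : ∀ j m i → j + (m + i) ≡ m + (j + i)
      swap₃ = solve-∀
      eq : ∀ j → c (j + (m + i)) ≡ c (j + i)
      eq j = trans (cong c (swap₃ j m i)) (per (j + i))

    Run⇒X : ∀ {i x} → Run i 3 x → X i x
    Run⇒X r = record { hit₀ = r .hit 0 (s≤s z≤n) ; hit₂ = r .hit 2 ≤-refl ; miss = r .miss }
      where open Run

  open Run
  open X

  -- The vertices c (b + i), …, c (m + i) together with x form a cycle.
  tailGap : ∀ {m} → 6 + e ≤ m → (C : Hole G m) → ∀ {x} → Off C x → ∀ i b → b ≤ m → 2 + b ≤ m → m ∸ b ≤ 3 + e →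
    x ~ Hole.c C i → x ~ Hole.c C (b + i) → (∀ j → b < j → j < m → x ≁ Hole.c C (j + i)) → ⊥
  tailGap {m} 6≤m C {x} off i b b≤ b+2≤ short hi hb none =
    gap 6≤m C (b + i) (m ∸ b) (m+n≤o⇒m≤o∸n 2 b+2≤) short hb
      (subst (x ~_) (≡-sym (trans (cong c (trans (≡-sym (+-assoc (m ∸ b) b i)) (cong (_+ i) (m∸n+n≡m b≤)))) (per i))) hi)
      (λ j 0<j j< → none (j + b) (m<n+m b 0<j) (subst (j + b <_) (m∸n+n≡m b≤) (+-monoˡ-< b j<)) ∘ subst (x ~_) (cong c (≡-sym (+-assoc j b i))))
      λ j _ _ → off _
    where open Hole C

  even≤ : 6 + e ≤ 6 + e
  even≤ = ≤-refl
  odd≤ : 6 + e ≤ 7 + e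
  odd≤ = n≤1+n (6 + e)

  2≤3+e : 2 ≤ 3 + e
  2≤3+e = s≤s (s≤s z≤n)

  module EvenHole (C : Hole G (6 + e)) where
    open Hole C

    -- Consider the last neighbour counted from `c (suc i)`. If it is `c (suc i)` itself, too long
    -- an arc is missed. If it is three or more steps away, the arc from it onwards to `c (suc i)`,
    -- passing the missed `c i`, closes up through `x` to a cycle shorter than 2t.
    start : ∀ {x} → Off C x → ∀ i → x ≁ c i → x ~ c (suc i) → Run C (suc i) 2 x ⊎ Run C (suc i) 3 x
    start {x} off i x≁ x~ with last≤ (λ j → _~?_ x (c (j + suc i))) (5 + e) x~
    ... | zero , _ , _ , none = ⊥-elim (miss₁ even≤ C (2 + i) λ j j≤ → none (suc j) (s≤s z≤n) (s≤s j≤) ∘ subst (x ~_) (cong c (+-suc j (suc i))))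
    ... | suc zero , _ , h₁ , none = inj₁ (record
      { hit = λ { zero _ → x~ ; (suc zero) _ → h₁ ; (suc (suc _)) (s≤s (s≤s ())) } ; miss = λ j 2≤ j< → none j 2≤ (≤-pred j<) })
    ... | suc (suc zero) , _ , h₂ , none = inj₂ (record
      { hit = λ { zero _ → x~ ; (suc zero) _ → ~-stable λ x≁₁ →
                    gap even≤ C (suc i) 2 ≤-refl 2≤3+e x~ h₂ (λ { (suc zero) _ _ → x≁₁ ; (suc (suc _)) _ (s≤s (s≤s ())) }) (λ j _ _ → off _)
                ; (suc (suc zero)) _ → h₂ ; (suc (suc (suc _))) (s≤s (s≤s (s≤s ()))) }
      ; miss = λ j 3≤ j< → none j 3≤ (≤-pred j<) })
    ... | suc (suc (suc b)) , b≤ , hb , none = ⊥-elim (tailGap even≤ C off (suc i) (3 + b) (m≤n⇒m≤1+n b≤)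
          (s≤s (≤∧≢⇒< b≤ λ { refl → x≁ (subst (x ~_) (trans (cong c (cong (5 +_) (+-suc e i))) (per i)) hb) })) (m∸n≤m (3 + e) b) x~ hb
          λ j b< j< → none j b< (≤-pred j<))

    -- If the vertex before the run were missed, `start` would allow only three consecutive
    -- neighbours. So the run extends backwards all the way round.
    four : ∀ {x} → Off C x → ∀ i → (∀ j → j < 4 → x ~ c (j + i)) → ∀ k → x ~ c k
    four {x} off i h k = backwards G (4 + e) Q down back i h k 0 (s≤s z≤n)
      where
      Q : ℕ → Set
      Q i = ∀ j → j < 4 → x ~ c (j + i)
      swap₃ : ∀ j i → j + (6 + e + i) ≡ 6 + e + (j + i)
      swap₃ j i = eq j i s
        where
        eq : ∀ j i s → j + (6 + (s + s) + i) ≡ 6 + (s + s) + (j + i)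
        eq = solve-∀
      down : ∀ i → Q (6 + e + i) → Q i
      down i q j j< = subst (x ~_) (trans (cong c (swap₃ j i)) (per _)) (q j j<)
      back : ∀ i → Q i → Q (5 + e + i)
      back i q = λ { zero _ → prev ; (suc j) (s≤s j<) → subst (x ~_) (≡-sym (trans (cong c (shift j)) (per _))) (q j (m<n⇒m<1+n j<)) }
        where
        shift : ∀ j → suc j + (5 + e + i) ≡ 6 + e + (j + i)
        shift j = trans (≡-sym (+-suc j (5 + e + i))) (swap₃ j i)
        up : ∀ j → j < 4 → x ~ c (j + (6 + e + i))
        up j j< = subst (x ~_) (≡-sym (trans (cong c (swap₃ j i)) (per _))) (q j j<)
        prev : x ~ c (5 + e + i)
        prev = ~-stable λ x≁ → case start off (5 + e + i) x≁ (up 0 (s≤s z≤n)) of λ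
          { (inj₁ r) → r .miss 3 (s≤s (s≤s z≤n)) (m≤m+n 4 _) (up 3 ≤-refl)
          ; (inj₂ r) → r .miss 3 ≤-refl (m≤m+n 4 _) (up 3 ≤-refl) }

    data Near (p : ℕ) (x : Fin n) : Set where
      full  : (∀ k → x ~ c k) → Near p x
      run₃  : Run C p 3 x → Near p x
      run₃′ : Run C (1 + p) 3 x → Near p x
      run₃″ : Run C (2 + p) 3 x → Near p x
      run₂  : Run C (1 + p) 2 x → Near p x
      run₂′ : Run C (2 + p) 2 x → Near p x

    abstract
      -- The search goes back from `c (2 + p)` for a missed vertex at which `start` applies; finding
      -- none in three steps gives four consecutive neighbours.
      near : ∀ {x} → Off C x → ∀ p → x ~ c (2 + p) → Near p x
      near {x} off p h₂ with _~?_ x (c (1 + p))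
      ... | no x≁ = [ run₂′ , run₃″ ]′ (start off (1 + p) x≁ h₂)
      ... | yes h₁ with _~?_ x (c p)
      ...   | no x≁ = [ run₂ , run₃′ ]′ (start off p x≁ h₁)
      ...   | yes h₀ with _~?_ x (c (5 + e + p))
      ...     | yes h₅ = full (four off (5 + e + p) λ
                  { zero _ → h₅ ; (suc zero) _ → up 0 h₀ ; (suc (suc zero)) _ → up 1 h₁ ; (suc (suc (suc zero))) _ → up 2 h₂
                  ; (suc (suc (suc (suc _)))) (s≤s (s≤s (s≤s (s≤s ())))) })
        where
        up : ∀ j → x ~ c (j + p) → x ~ c (suc j + (5 + e + p))
        up j h = subst (x ~_) (≡-sym (trans (cong c (eq j p s)) (per (j + p)))) h
          where
          eq : ∀ j p s → suc j + (5 + (s + s) + p) ≡ 6 + (s + s) + (j + p)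
          eq = solve-∀
      ...     | no x≁ with start off (5 + e + p) x≁ (subst (x ~_) (≡-sym (per p)) h₀)
      ...       | inj₁ r = ⊥-elim (Run-down C r .miss 2 ≤-refl (m≤m+n 3 _) h₂)
      ...       | inj₂ r = run₃ (Run-down C r)

    three : ∀ {x} → Off C x → ∀ p k → x ≁ c k → (∀ j → j < 3 → x ~ c (j + p)) → Run C p 3 x
    three off p k x≁k h with near off p (h 2 ≤-refl)
    ... | full f = ⊥-elim (x≁k (f k))
    ... | run₃ r = r
    ... | run₃′ r = ⊥-elim (r .miss (5 + e) (m≤m+n 3 _) ≤-refl (subst (_ ~_) (≡-sym (trans (cong c (cong (5 +_) (+-suc e p))) (per p))) (h 0 (s≤s z≤n))))
    ... | run₃″ r = ⊥-elim (r .miss (5 + e) (m≤m+n 3 _) ≤-refl (subst (_ ~_) (≡-sym (trans (cong c (cong (5 +_) (+-suc e (1 + p)))) (per (1 + p)))) (h 1 (s≤s (s≤s z≤n)))))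
    ... | run₂ r = ⊥-elim (r .miss (5 + e) (s≤s (s≤s z≤n)) ≤-refl (subst (_ ~_) (≡-sym (trans (cong c (cong (5 +_) (+-suc e p))) (per p))) (h 0 (s≤s z≤n))))
    ... | run₂′ r = ⊥-elim (r .miss (5 + e) (s≤s (s≤s z≤n)) ≤-refl (subst (_ ~_) (≡-sym (trans (cong c (cong (5 +_) (+-suc e (1 + p)))) (per (1 + p)))) (h 1 (s≤s (s≤s z≤n)))))

  module OddHole (C : Hole G (7 + e)) where
    open Hole C

    -- The longer cycle shifts both bounds by one: a run of two still misses 2t ∸ 1 vertices, while
    -- a run of four only closes up a cycle of length 2t, which is allowed.
    start : ∀ {x} → Off C x → ∀ i → x ≁ c i → x ~ c (suc i) → Run C (suc i) 3 x ⊎ Run C (suc i) 4 x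
    start {x} off i x≁ x~ with last≤ (λ j → _~?_ x (c (j + suc i))) (6 + e) x~
    ... | zero , _ , _ , none = ⊥-elim (miss₁ odd≤ C (2 + i) λ j j≤ → none (suc j) (s≤s z≤n) (s≤s (m≤n⇒m≤1+n j≤)) ∘ subst (x ~_) (cong c (+-suc j (suc i))))
    ... | suc zero , _ , _ , none = ⊥-elim (miss₁ odd≤ C (3 + i) λ j j≤ → none (2 + j) (s≤s (s≤s z≤n)) (s≤s (s≤s j≤)) ∘ subst (x ~_) (cong c (shift₂ j (suc i))))
    ... | suc (suc zero) , _ , h₂ , none = inj₁ (record
      { hit = λ { zero _ → x~ ; (suc zero) _ → ~-stable λ x≁₁ →
                    gap odd≤ C (suc i) 2 ≤-refl 2≤3+e x~ h₂ (λ { (suc zero) _ _ → x≁₁ ; (suc (suc _)) _ (s≤s (s≤s ())) }) (λ j _ _ → off _)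
                ; (suc (suc zero)) _ → h₂ ; (suc (suc (suc _))) (s≤s (s≤s (s≤s ()))) }
      ; miss = λ j 3≤ j< → none j 3≤ (≤-pred j<) })
    ... | suc (suc (suc zero)) , _ , h₃ , none = inj₂ (record
      { hit = λ { zero _ → x~ ; (suc zero) _ → h₁ ; (suc (suc zero)) _ → h₂
                ; (suc (suc (suc zero))) _ → h₃ ; (suc (suc (suc (suc _)))) (s≤s (s≤s (s≤s (s≤s ())))) }
      ; miss = λ j 4≤ j< → none j 4≤ (≤-pred j<) })
      where
      h₁ : x ~ c (2 + i)
      h₁ = ~-stable λ x≁₁ → case _~?_ x (c (3 + i)) of λ
        { (yes h₂) → gap odd≤ C (suc i) 2 ≤-refl 2≤3+e x~ h₂ (λ { (suc zero) _ _ → x≁₁ ; (suc (suc _)) _ (s≤s (s≤s ())) }) (λ j _ _ → off _)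
        ; (no x≁₂) → gap odd≤ C (suc i) 3 2≤3+e' 3≤3+e x~ h₃
            (λ { (suc zero) _ _ → x≁₁ ; (suc (suc zero)) _ _ → x≁₂ ; (suc (suc (suc _))) _ (s≤s (s≤s (s≤s ()))) }) (λ j _ _ → off _) }
        where
        2≤3+e' : 2 ≤ 3
        2≤3+e' = s≤s (s≤s z≤n)
        3≤3+e : 3 ≤ 3 + e
        3≤3+e = s≤s (s≤s (s≤s z≤n))
      h₂ : x ~ c (3 + i)
      h₂ = ~-stable λ x≁₂ →
        gap odd≤ C (2 + i) 2 ≤-refl 2≤3+e h₁ h₃ (λ { (suc zero) _ _ → x≁₂ ; (suc (suc _)) _ (s≤s (s≤s ())) }) (λ j _ _ → off _)
    ... | suc (suc (suc (suc b))) , b≤ , hb , none = ⊥-elim (tailGap odd≤ C off (suc i) (4 + b) (m≤n⇒m≤1+n b≤)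
          (s≤s (≤∧≢⇒< b≤ λ { refl → x≁ (subst (x ~_) (trans (cong c (cong (6 +_) (+-suc e i))) (per i)) hb) })) (m∸n≤m (3 + e) b) x~ hb
          λ j b< j< → none j b< (≤-pred j<))

  module _ {m′} (6≤m : 6 + e ≤ suc m′) (C : Hole G (suc m′)) where
    open Hole C
    private
      m : ℕ
      m = suc m′
      5≤m : 5 ≤ m
      5≤m = ≤-trans (m≤m+n 5 _) 6≤m
    open OnHole G 5≤m C

    abstract
      onHole? : ∀ x → (∃ λ k → k < m × x ≡ c k) ⊎ Off C x
      onHole? x with Finₚ.any? {n = m} (λ k → x Finₚ.≟ c (toℕ k))
      ... | yes (k , eq) = inj₁ (toℕ k , Finₚ.toℕ<n k , eq)
      ... | no none = inj₂ λ i eq → none (fromℕ< (m%n<n i m) , trans eq (trans (cong c (trans (m≡m%n+[m/n]*n i m) (+-comm (i % m) _)))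
              (trans (c-wrap (i / m) (i % m)) (cong c (≡-sym (Finₚ.toℕ-fromℕ< (m%n<n i m)))))))

    hole-nbr : ∀ k → k < m → c 2 ~ c k → k ≡ 1 ⊎ k ≡ 3
    hole-nbr 0 _ a = ⊥-elim (far 0 2 ≤-refl (≤-trans (n≤1+n 4) 5≤m) (~-sym a))
    hole-nbr 1 _ _ = inj₁ refl
    hole-nbr 2 _ a = ⊥-elim (~-irrefl a)
    hole-nbr 3 _ _ = inj₂ refl
    hole-nbr (suc (suc (suc (suc k)))) k< a = ⊥-elim (far 2 (2 + k) (s≤s (s≤s z≤n)) (<⇒≤ k<)
      (subst (λ z → c 2 ~ c z) (eq k) a))
      where
      eq : ∀ k → 4 + k ≡ (2 + k) + 2
      eq = solve-∀

    X-clique : ∀ {i x y} → X C i x → X C i y → x ≢ y → x ~ y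
    X-clique {i} hx hy x≢y = common x≢y (hx .hit₀) (hx .hit₂) (hy .hit₀) (hy .hit₂)
      (c-distinct i 2 (s≤s z≤n) (≤-trans (m≤m+n 3 _) 5≤m)) (far i 2 ≤-refl (≤-trans (n≤1+n 4) 5≤m))

    X-full : ∀ {i x u} → X C i x → (∀ k → u ~ c k) → x ≢ u → x ~ u
    X-full {i} hx hu x≢u = common x≢u (hx .hit₀) (hx .hit₂) (hu _) (hu _)
      (c-distinct i 2 (s≤s z≤n) (≤-trans (m≤m+n 3 _) 5≤m)) (far i 2 ≤-refl (≤-trans (n≤1+n 4) 5≤m))

    full-clique : ∀ {u w} → (∀ k → u ~ c k) → (∀ k → w ~ c k) → u ≢ w → u ~ w
    full-clique hu hw u≢w = common u≢w (hu 0) (hu 2) (hw 0) (hw 2)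
      (c-distinct 0 2 (s≤s z≤n) (≤-trans (m≤m+n 3 _) 5≤m)) (far 0 2 ≤-refl (≤-trans (n≤1+n 4) 5≤m))

    -- `X` is silent about `c (1 + i)`, so the hole vertex belongs to its own class and needs no
    -- separate treatment.
    X-centre : ∀ i → X C i (c (1 + i))
    X-centre i = record { hit₀ = ~-sym (link i) ; hit₂ = link (1 + i)
      ; miss = λ { (suc j) (s≤s 2≤j) j< → subst (λ z → c (1 + i) ≁ c z) (+-suc j i) (far (1 + i) j 2≤j j<) } }

    X-centre-adj : ∀ {i x} → X C i x → x ≢ c (1 + i) → x ~ c (1 + i)
    X-centre-adj h = X-clique h (X-centre _)

  module _ {ℓ} (4≤ℓ : 4 + e ≤ ℓ) (C : Hole G (2 + ℓ)) {i x} (hx : X C i x) where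
    open Hole C
    private
      6≤ : 6 + e ≤ 2 + ℓ
      6≤ = s≤s (s≤s 4≤ℓ)
      5≤ : 5 ≤ 2 + ℓ
      5≤ = ≤-trans (m≤m+n 5 _) 6≤
      mid : ∀ j → 0 < j → j < ℓ → x ≁ c (j + (2 + i))
      mid j 0<j j< = hx .miss (2 + j) (s≤s (s≤s 0<j)) (s≤s (s≤s j<)) ∘ subst (λ z → x ~ c z) (shift₂ j i)
      apex : IsApex G x ℓ (λ j → c (j + (2 + i)))
      apex = OnHole.shortcut G 5≤ C x (2 + i) ℓ (≤-trans (s≤s (s≤s z≤n)) 4≤ℓ) ≤-refl (hx .hit₂)
        (subst (x ~_) (≡-sym (trans (cong c (shift₂ ℓ i)) (per i))) (hx .hit₀)) mid
        (OnHole.off-arc G 5≤ C x (2 + i) ℓ (≤-trans (m≤m+n 3 _) 4≤ℓ) mid)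

    -- x in place of c (1 + i), the indices starting from x.
    swap₀ : Hole G (2 + ℓ)
    swap₀ = apexHole G apex

    swap₀-0 : Hole.c swap₀ 0 ≡ x
    swap₀-0 = apexHole-0 G apex

    swap₀-suc : ∀ j → j ≤ ℓ → Hole.c swap₀ (suc j) ≡ c (2 + j + i)
    swap₀-suc j j≤ = trans (apexHole-suc G apex j j≤) (cong c (shift₂ j i))

  even≤′ : 4 + e ≤ 4 + e
  even≤′ = ≤-refl

  module Even (C : Hole G (6 + e)) where
    open Hole C

    private
      2+j : ∀ j i → (2 + j) + (1 + i) ≡ j + (3 + i)
      2+j = solve-∀
      3+j : ∀ j i → (3 + j) + i ≡ j + (3 + i)
      3+j = solve-∀
      2+j′ : ∀ j i → (2 + j) + i ≡ j + (2 + i)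
      2+j′ = solve-∀
      lt₃ : ∀ {j} → j ≤ 2 + e → 3 + j < 6 + e
      lt₃ j≤ = s≤s (s≤s (s≤s (s≤s j≤)))
      lt₂ : ∀ {j} → j ≤ 2 + e → 2 + j < 6 + e
      lt₂ j≤ = <-trans ≤-refl (lt₃ j≤)
      2≤2+ : ∀ {j} → 2 ≤ 2 + j
      2≤2+ = s≤s (s≤s z≤n)
      3≤3+ : ∀ {j} → 3 ≤ 3 + j
      3≤3+ = s≤s (s≤s (s≤s z≤n))

      missE : ∀ {i a} → Run C (1 + i) 2 a → ∀ j → j ≤ 2 + e → a ≁ c (j + (3 + i))
      missE {i} {a} r j j≤ = r .miss (2 + j) 2≤2+ (lt₂ j≤) ∘ subst (λ z → a ~ c z) (≡-sym (2+j j i))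
      missE′ : ∀ {i a} → Run C i 2 a → ∀ j → j ≤ 2 + e → a ≁ c (j + (3 + i))
      missE′ {i} {a} r j j≤ = r .miss (3 + j) (≤-trans (n≤1+n 2) 3≤3+) (lt₃ j≤) ∘ subst (λ z → a ~ c z) (≡-sym (3+j j i))
      missX : ∀ {i x} → X C i x → ∀ j → j ≤ 2 + e → x ≁ c (j + (3 + i))
      missX {i} {a} h j j≤ = h .miss (3 + j) 3≤3+ (lt₃ j≤) ∘ subst (λ z → a ~ c z) (≡-sym (3+j j i))

    -- Here and in the two lemmas below, both vertices miss the 2t ∸ 3 hole vertices from
    -- `c (3 + i)` on.
    E-clique : ∀ {i a b} → Run C i 2 a → Run C i 2 b → a ≢ b → a ~ b
    E-clique {i} ra rb a≢b = miss₂ even≤ C (3 + i) a≢b (missE′ ra) (missE′ rb)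

    EX-left : ∀ {i a x} → Run C (1 + i) 2 a → X C i x → a ≢ x → a ~ x
    EX-left {i} ra hx a≢x = miss₂ even≤ C (3 + i) a≢x (missE ra) (missX hx)

    EX-right : ∀ {i a x} → Run C i 2 a → X C i x → a ≢ x → a ~ x
    EX-right {i} ra hx a≢x = miss₂ even≤ C (3 + i) a≢x (missE′ ra) (missX hx)

    -- Two vertices on consecutive edges of the cycle lengthen it by one.
    EE-odd : ∀ {i a b} → Run C i 2 a → Run C (1 + i) 2 b → Hole G (7 + e)
    EE-odd {i} {a} {b} ra rb = apexHole G (record
      { 2≤ℓ = s≤s (s≤s z≤n)
      ; path = cons-induced G (OnHole.arc G 5≤ C (2 + i) (4 + e) ≤-refl) (rb .hit 1 ≤-refl)
          (λ j j< → b-miss (suc j) (s≤s z≤n) j<) b-off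
      ; first = a~b
      ; final = subst (a ~_) (≡-sym closing) (ra .hit 0 (s≤s z≤n))
      ; middle = λ { (suc j) _ (s≤s j<) → a-miss j (≤-pred j<) }
      ; off = λ { zero _ → ~⇒≢ a~b ; (suc j) (s≤s j≤) → a-off j j≤ } })
      where
      5≤ : 5 ≤ 6 + e
      5≤ = s≤s (m≤m+n 4 _)
      closing : c (4 + e + (2 + i)) ≡ c i
      closing = trans (cong c (shift₂ (4 + e) i)) (per i)
      a≢b : a ≢ b
      a≢b refl = rb .miss (5 + e) 2≤2+ ≤-refl (subst (a ~_) (≡-sym (trans (cong c (cong (5 +_) (+-suc e i))) (per i))) (ra .hit 0 (s≤s z≤n)))
      a~b : a ~ b
      a~b = miss₂ even≤ C (3 + i) a≢b (missE′ ra) (missE rb)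
      a-miss : ∀ j → j ≤ 3 + e → a ≁ c (j + (2 + i))
      a-miss j j≤ = ra .miss (2 + j) 2≤2+ (s≤s (s≤s (s≤s j≤))) ∘ subst (λ z → a ~ c z) (≡-sym (2+j′ j i))
      a-off : ∀ j → j ≤ 4 + e → a ≢ c (j + (2 + i))
      a-off j j≤ with m≤n⇒m<n∨m≡n j≤
      ... | inj₁ j< = off-window even≤ C (2 + i) (3 + e) (s≤s z≤n) a-miss j (≤-pred j<)
      ... | inj₂ refl = ~⇒≢ (subst (a ~_) (≡-sym closing) (ra .hit 0 (s≤s z≤n)))
      b-miss : ∀ j → 0 < j → j ≤ 4 + e → b ≁ c (j + (2 + i))
      b-miss (suc j) _ j≤ = rb .miss (2 + j) 2≤2+ (s≤s (s≤s j≤)) ∘ subst (λ z → b ~ c z) (≡-sym (2+j j i) ) ∘ subst (λ z → b ~ c z) (≡-sym (+-suc j (2 + i)))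
      b-off : ∀ j → j ≤ 4 + e → b ≢ c (j + (2 + i))
      b-off zero _ = ~⇒≢ (rb .hit 1 ≤-refl)
      b-off (suc j) (s≤s j≤) = off-window even≤ C (3 + i) (3 + e) (s≤s z≤n)
          (λ k k≤ → b-miss (suc k) (s≤s z≤n) (s≤s k≤) ∘ subst (λ z → b ~ c z) (+-suc k (2 + i))) j j≤ ∘ subst (λ z → b ≡ c z) (≡-sym (+-suc j (2 + i)))

    -- On the hole with `x` in place of `c (1 + i)`, an edge from `y` to `x` would make `x` and
    -- `c (4 + i)` the ends of an arc missed in between, and `y` would close it to a cycle of length
    -- 2t ∸ 1.
    XX-anti : ∀ {i x y} → X C i x → X C (2 + i) y → x ≁ y
    XX-anti {i} {x} {y} hx hy x~y = gap even≤ D 3 (3 + e) 2≤2+ ≤-refl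
        (subst (y ~_) (≡-sym (swap₀-suc even≤′ C hx 2 2≤2+)) (hy .hit₂))
        (subst (y ~_) (≡-sym (trans (cong d (eq e)) (trans (Hole.per D 0) (swap₀-0 even≤′ C hx)))) (~-sym x~y))
        mid (OnHole.off-arc G (m≤m+n 5 _) D y 3 (3 + e) 3≤3+ mid)
      where
      D = swap₀ even≤′ C hx
      d = Hole.c D
      eq : ∀ e → 3 + e + 3 ≡ 6 + e + 0
      eq = solve-∀
      idx : ∀ j i → 2 + (2 + j) + i ≡ (2 + j) + (2 + i)
      idx = solve-∀
      mid : ∀ j → 0 < j → j < 3 + e → y ≁ d (j + 3)
      mid j 0<j j< a = hy .miss (2 + j) (s≤s (s≤s 0<j)) (s≤s (s≤s (<-trans j< ≤-refl)))
        (subst (y ~_) (trans (cong d (+-comm j 3)) (trans (swap₀-suc even≤′ C hx (2 + j) (s≤s j<)) (cong c (idx j i)))) a)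

-- Even holes

module EvenCase {n : ℕ} (G : Graph n) (s : ℕ) (independence : ¬ HasIndependentSet G (4 + s))
  (noShort : ∀ k → 4 ≤ k → k ≤ 5 + (s + s) → ¬ HasInducedCycle G k) where
  open Holes G s independence noShort
  open Run
  open X

  Closed : Fin n → Fin n → Set
  Closed v f = f ≡ v ⊎ v ~ f

  closed? : ∀ v f → Dec (Closed v f)
  closed? v f = (f Finₚ.≟ v) ⊎-dec (_~?_ v f)

  size : Fin n → ℕ
  size v = count (toSet (closed? v))

  size-< : ∀ {x v} → (∀ f → Closed x f → Closed v f) → ∀ y → Closed v y → ¬ Closed x y → size x < size v
  size-< {x} {v} sub y yv y∉ = count-strict (λ f h → toSet-in (closed? v) (sub f (toSet-out (closed? x) h)))
    y (toSet-in (closed? v) yv) (Boolₚ.¬-not (y∉ ∘ toSet-out (closed? x)))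

  OnEven : Fin n → Set
  OnEven w = Σ (Hole G (6 + e)) λ D → Hole.c D 0 ≡ w

  Minimal : Fin n → Set
  Minimal v = ∀ w → OnEven w → size w < size v → ⊥

  2≤ : ∀ {j} → 2 ≤ 2 + j
  2≤ = s≤s (s≤s z≤n)
  3≤ : ∀ {j} → 3 ≤ 3 + j
  3≤ = s≤s 2≤
  5≤ : 5 ≤ 6 + e
  5≤ = s≤s (s≤s 3≤)

  module _ (C : Hole G (6 + e)) where
    open Hole C

    around-c₂ : ∀ {f} → f ~ c 1 → f ~ c 3 → f ≢ c 2 → f ~ c 2
    around-c₂ f₁ f₃ f≢ = common f≢ f₁ f₃ (~-sym (link 1)) (link 2)
      (OnHole.c-distinct G 5≤ C 1 2 (s≤s z≤n) 3≤) (far 1 2 ≤-refl (s≤s 3≤))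

  module _ (noOdd : ¬ Hole G (7 + e)) where

    -- If x and y could be chosen non-adjacent, the closed neighbourhood of x would be
    -- properly contained in that of c 2.
    module Domination (C : Hole G (6 + e)) {x y} (hy : X C 0 y) (hx : X C 1 x) (x≢y : x ≢ y) (x≁y : x ≁ y) where
      open Hole C

      private
        x≢c₂ : x ≢ c 2
        x≢c₂ refl = x≁y (~-sym (hy .hit₂))
        x~c₂ : x ~ c 2
        x~c₂ = X-centre-adj even≤ C hx x≢c₂
        D = swap₀ even≤′ C hx
        d = Hole.c D
        d-suc : ∀ j → j ≤ 4 + e → d (suc j) ≡ c (3 + j)
        d-suc j j≤ = trans (swap₀-suc even≤′ C hx j j≤) (cong c (eq j))
          where
          eq : ∀ j → 2 + j + 1 ≡ 3 + j
          eq = solve-∀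
        d-wrap : ∀ j → d (j + (6 + e)) ≡ d j
        d-wrap j = trans (cong d (+-comm j (6 + e))) (Hole.per D j)
        d₁ : d 1 ≡ c 3
        d₁ = d-suc 0 z≤n
        d₅ : d (5 + e) ≡ c 1
        d₅ = trans (d-suc (4 + e) ≤-refl) (trans (cong c (eq s)) (per 1))
          where
          eq : ∀ s → 3 + (4 + (s + s)) ≡ 6 + (s + s) + 1
          eq = solve-∀

        noSquare : ∀ {f} → x ~ f → f ~ y → f ≢ c 2 → f ≁ c 2 → ⊥
        noSquare f~x f~y f≢ f≁ = noC₄ (~-sym x~c₂) f~x f~y (hy .hit₂)
          (λ eq → f≢ (≡-sym eq)) x≢y (≁-sym f≁) x≁y

      module _ {f} (x~f : x ~ f) (f≢c₂ : f ≢ c 2) (f≁c₂ : f ≁ c 2) where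
        private
          -- `f` sees `c 0`, `c 1` and `x`. It misses the same long arc as `y`, so `f ~ y`, and
          -- `c 2`, `x`, `f`, `y` is an induced 4-cycle.
          E₀-case : Run D (4 + e) 3 f → ⊥
          E₀-case r = noSquare x~f (miss₂ even≤ C 3 (λ { refl → f≁c₂ (hy .hit₂) }) f-miss y-miss) f≢c₂ f≁c₂
            where
            idx : ∀ k e → (3 + k) + (4 + e) ≡ (1 + k) + (6 + e)
            idx = solve-∀
            f-miss : ∀ k → k ≤ 2 + e → f ≁ c (k + 3)
            f-miss k k≤ = r .miss (3 + k) 3≤ (s≤s (s≤s (s≤s (s≤s k≤)))) ∘ subst (f ~_)
              (trans (cong c (+-comm k 3)) (≡-sym (trans (cong d (idx k e)) (trans (d-wrap (1 + k)) (d-suc k (≤-trans k≤ (m≤n+m (2 + e) 2)))))))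
            y-miss : ∀ k → k ≤ 2 + e → y ≁ c (k + 3)
            y-miss k k≤ = hy .miss (3 + k) 3≤ (s≤s (s≤s (s≤s (s≤s k≤)))) ∘ subst (λ z → y ~ c z) (eq k)
              where
              eq : ∀ k → k + 3 ≡ 3 + k + 0
              eq = solve-∀

          -- `f` sees `x`, `c 3` and `c 4`, and misses `y` by `noSquare`. On the hole with `y` in
          -- place of `c 1`, the vertices `x` and `f` then have runs of two on consecutive edges.
          E₃-case : Run D (6 + e) 3 f → ⊥
          E₃-case r = noOdd (Even.EE-odd D′ run-x run-f)
            where
            f≁y : f ≁ y
            f≁y f~y = noSquare x~f f~y f≢c₂ f≁c₂
            D′ = swap₀ even≤′ C hy
            d′ = Hole.c D′
            d′-suc : ∀ j → j ≤ 4 + e → d′ (suc j) ≡ c (2 + j)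
            d′-suc j j≤ = trans (swap₀-suc even≤′ C hy j j≤) (cong c (+-identityʳ (2 + j)))
            d′-wrap : ∀ j → d′ (j + (6 + e)) ≡ d′ j
            d′-wrap j = trans (cong d′ (+-comm j (6 + e))) (Hole.per D′ j)
            run-x : Run D′ 1 2 x
            run-x = record
              { hit = λ { 0 _ → subst (x ~_) (≡-sym (d′-suc 0 z≤n)) x~c₂
                        ; 1 _ → subst (x ~_) (≡-sym (d′-suc 1 (s≤s z≤n))) (hx .hit₂)
                        ; (suc (suc _)) (s≤s (s≤s ())) }
              ; miss = x-miss }
              where
              x-miss : ∀ j → 2 ≤ j → j < 6 + e → x ≁ d′ (j + 1)
              x-miss j 2≤j j< a with m≤n⇒m<n∨m≡n (≤-pred j<)
              ... | inj₁ j<5 = hx .miss (1 + j) (s≤s 2≤j) (s≤s j<5) (subst (x ~_)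
                      (trans (cong d′ (+-comm j 1)) (trans (d′-suc j (≤-pred j<5)) (cong c (cong suc (+-comm 1 j))))) a)
              ... | inj₂ refl = x≁y (subst (x ~_) (trans (cong d′ (+-comm (5 + e) 1)) (trans (d′-wrap 0) (swap₀-0 even≤′ C hy))) a)
            f₃ : f ~ c 3
            f₃ = subst (f ~_) (trans (d-wrap 1) d₁) (r .hit 1 2≤)
            f₄ : f ~ c 4
            f₄ = subst (f ~_) (trans (d-wrap 2) (d-suc 1 (s≤s z≤n))) (r .hit 2 ≤-refl)
            run-f : Run D′ 2 2 f
            run-f = record
              { hit = λ { 0 _ → subst (f ~_) (≡-sym (d′-suc 1 (s≤s z≤n))) f₃
                        ; 1 _ → subst (f ~_) (≡-sym (d′-suc 2 2≤)) f₄
                        ; (suc (suc _)) (s≤s (s≤s ())) }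
              ; miss = f-miss }
              where
              f-miss : ∀ j → 2 ≤ j → j < 6 + e → f ≁ d′ (j + 2)
              f-miss j 2≤j j< a with m≤n⇒m<n∨m≡n (≤-pred j<)
              ... | inj₂ refl = f≁c₂ (subst (f ~_) (trans (cong d′ (eq s)) (trans (d′-wrap 1) (d′-suc 0 z≤n))) a)
                where
                eq : ∀ s → 5 + (s + s) + 2 ≡ 1 + (6 + (s + s))
                eq = solve-∀
              ... | inj₁ j<5 with m≤n⇒m<n∨m≡n (≤-pred j<5)
              ...   | inj₂ refl = f≁y (subst (f ~_) (trans (cong d′ (+-comm (4 + e) 2)) (trans (d′-wrap 0) (swap₀-0 even≤′ C hy))) a)
              ...   | inj₁ j<4 = r .miss (1 + j) (s≤s 2≤j) (s≤s (<-trans j<4 ≤-refl)) (subst (f ~_)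
                        (trans (cong d′ (+-comm j 2)) (trans (d′-suc (1 + j) j<4) (≡-sym (trans (d-wrap (1 + j)) (d-suc j (<⇒≤ j<4)))))) a)

          -- `f` sees only `c 1` and `x` on `D`, so on `C` it misses 2t ∸ 1 consecutive vertices.
          E₁-case : Run D (5 + e) 2 f → ⊥
          E₁-case r = miss₁ even≤ C 2 f-miss
            where
            idx : ∀ k e → (2 + k) + (5 + e) ≡ (1 + k) + (6 + e)
            idx = solve-∀
            f-miss : ∀ k → k ≤ 4 + e → f ≁ c (k + 2)
            f-miss zero _ = f≁c₂
            f-miss (suc k) (s≤s k≤) = r .miss (2 + k) 2≤ (s≤s (s≤s (s≤s k≤))) ∘ subst (f ~_)
              (trans (cong c (cong suc (+-comm k 2))) (≡-sym (trans (cong d (idx k e)) (trans (d-wrap (1 + k)) (d-suc k (m≤n⇒m≤1+n k≤))))))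

          E₂-case : Run D (6 + e) 2 f → ⊥
          E₂-case r = miss₁ even≤ C 4 f-miss
            where
            f-miss : ∀ k → k ≤ 4 + e → f ≁ c (k + 4)
            f-miss k k≤ a with m≤n⇒m<n∨m≡n k≤
            ... | inj₂ refl = f≁c₂ (subst (f ~_) (trans (cong c (eq s)) (per 2)) a)
              where
              eq : ∀ s → 4 + (s + s) + 4 ≡ 6 + (s + s) + 2
              eq = solve-∀
            ... | inj₁ k< = r .miss (2 + k) 2≤ (s≤s (s≤s k<)) (subst (f ~_)
                  (trans (cong c (+-comm k 4)) (≡-sym (trans (d-wrap (2 + k)) (d-suc (1 + k) k<)))) a)

        outside-⊥ : Off C f → ⊥
        outside-⊥ off with EvenHole.near D off-D (4 + e)
                             (subst (f ~_) (≡-sym (trans (cong d (+-comm 0 (6 + e))) (trans (Hole.per D 0) (swap₀-0 even≤′ C hx)))) (~-sym x~f))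
          where
          off-D : Off D f
          off-D k eq with onHole? even≤ D f
          ... | inj₂ o = o k eq
          ... | inj₁ (zero , _ , e₀) = ~⇒≢ x~f (≡-sym (trans e₀ (swap₀-0 even≤′ C hx)))
          ... | inj₁ (suc j , j< , e₀) = off (3 + j) (trans e₀ (d-suc j (≤-pred (≤-pred j<))))
        ... | EvenHole.full h = f≁c₂ (around-c₂ C (subst (f ~_) d₅ (h (5 + e))) (subst (f ~_) d₁ (h 1)) f≢c₂)
        ... | EvenHole.run₃ r = E₀-case r
        ... | EvenHole.run₃′ r = f≁c₂ (around-c₂ C (subst (f ~_) d₅ (r .hit 0 (s≤s z≤n)))
                (subst (f ~_) (trans (cong d (eq s)) (trans (d-wrap 1) d₁)) (r .hit 2 ≤-refl)) f≢c₂)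
          where
          eq : ∀ s → 2 + (5 + (s + s)) ≡ 1 + (6 + (s + s))
          eq = solve-∀
        ... | EvenHole.run₃″ r = E₃-case r
        ... | EvenHole.run₂ r = E₁-case r
        ... | EvenHole.run₂′ r = E₂-case r

        nbr-⊥ : ⊥
        nbr-⊥ with onHole? even≤ C f
        ... | inj₂ off = outside-⊥ off
        ... | inj₁ (0 , _ , refl) = hx .miss (5 + e) 3≤ ≤-refl (subst (x ~_) (≡-sym (trans (cong c (+-comm (5 + e) 1)) (trans (cong c (+-comm 0 (6 + e))) (per 0)))) x~f)
        ... | inj₁ (1 , _ , refl) = f≁c₂ (link 1)
        ... | inj₁ (2 , _ , eq) = f≢c₂ eq
        ... | inj₁ (3 , _ , refl) = f≁c₂ (~-sym (link 2))
        ... | inj₁ (suc (suc (suc (suc k))) , k< , refl) = hx .miss (3 + k) 3≤ (<-trans ≤-refl k<) (subst (λ z → x ~ c z) (+-comm 1 (3 + k)) x~f)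

      not-minimal : Minimal (c 2) → ⊥
      not-minimal min = min x (D , swap₀-0 even≤′ C hx) (size-< sub y (inj₂ (~-sym (hy .hit₂))) λ
          { (inj₁ eq) → x≢y (≡-sym eq) ; (inj₂ a) → x≁y a })
        where
        sub : ∀ f → Closed x f → Closed (c 2) f
        sub f (inj₁ refl) = inj₂ (~-sym x~c₂)
        sub f (inj₂ x~f) with f Finₚ.≟ c 2
        ... | yes eq = inj₁ eq
        ... | no ne = inj₂ (~-sym (~-stable λ f≁ → nbr-⊥ x~f ne f≁))

    XX-complete : (C : Hole G (6 + e)) → Minimal (Hole.c C 2) → ∀ {x y} → X C 0 y → X C 1 x → x ≢ y → x ~ y
    XX-complete C min {x} {y} hy hx x≢y = ~-stable λ x≁y → Domination.not-minimal C hy hx x≢y x≁y min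

-- Excluding even holes in the absence of odd ones

module EvenExclusion {n : ℕ} (G : Graph n) (s : ℕ) (independence : ¬ HasIndependentSet G (4 + s))
  (noShort : ∀ k → 4 ≤ k → k ≤ 5 + (s + s) → ¬ HasInducedCycle G k) (noGood : ∀ v → ¬ Good G v) where
  open Holes G s independence noShort
  open EvenCase G s independence noShort
  open Run
  open X

  noSimplicial : ∀ v → (∀ f g → v ~ f → v ~ g → f ≢ g → f ~ g) → ⊥
  noSimplicial v h = noGood v record
    { L = λ _ → false ; R = λ _ → false ; disjoint = λ _ _ () ; left = λ x y vx vy _ _ → h x y vx vy
    ; right = λ x y vx vy _ _ → h x y vx vy ; apart = λ _ _ _ _ () }

  -- C′ is C reflected about the position 2.
  Mirror : Hole G (6 + e) → Hole G (6 + e) → Set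
  Mirror C C′ = ∀ a b q → a + b ≡ q * (6 + e) + 4 → Hole.c C′ a ≡ Hole.c C b

  Mirror-sym : ∀ {C C′} → Mirror C C′ → Mirror C′ C
  Mirror-sym μ a b q eq = ≡-sym (μ b a q (trans (+-comm b a) eq))

  reflected : (C : Hole G (6 + e)) → Σ (Hole G (6 + e)) (Mirror C)
  -- `reflect` sends `a` to -a, and `2 + e` is -4 modulo the length `6 + e`; the composite sends `a`
  -- to 4 - a.
  reflected C = rotate G (2 + e) (reflect G C) , at
    where
    open Hole C
    open OnHole G 5≤ C
    e₁ : ∀ a e → a + (a + (2 + e)) * (5 + e) ≡ (a + (1 + e)) * (6 + e) + 4
    e₁ = solve-∀
    e₂ : ∀ a r x → a + (r + x) ≡ r + (a + x)
    e₂ = solve-∀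
    at : Mirror C (rotate G (2 + e) (reflect G C))
    at a b q eq = trans (≡-sym (c-wrap q idx)) (trans (cong c (+-cancelˡ-≡ a _ _ sum)) (c-wrap (a + (1 + e)) b))
      where
      idx : ℕ
      idx = (a + (2 + e)) * (5 + e)
      sum : a + (q * (6 + e) + idx) ≡ a + ((a + (1 + e)) * (6 + e) + b)
      sum = begin
        a + (q * (6 + e) + idx)             ≡⟨ e₂ a (q * (6 + e)) idx ⟩
        q * (6 + e) + (a + idx)             ≡⟨ cong (q * (6 + e) +_) (e₁ a e) ⟩
        q * (6 + e) + ((a + (1 + e)) * (6 + e) + 4) ≡⟨ e₂ (q * (6 + e)) ((a + (1 + e)) * (6 + e)) 4 ⟩
        (a + (1 + e)) * (6 + e) + (q * (6 + e) + 4) ≡⟨ cong ((a + (1 + e)) * (6 + e) +_) (≡-sym eq) ⟩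
        (a + (1 + e)) * (6 + e) + (a + b)   ≡⟨ e₂ ((a + (1 + e)) * (6 + e)) a b ⟩
        a + ((a + (1 + e)) * (6 + e) + b)   ∎
        where open Eq.≡-Reasoning

  module _ {C C′ : Hole G (6 + e)} (μ : Mirror C C′) where
    private
      turn : ∀ {x} a b q → a + b ≡ q * (6 + e) + 4 → x ~ Hole.c C b → x ~ Hole.c C′ a
      turn {x} a b q eq = subst (x ~_) (≡-sym (μ a b q eq))

      -- The offsets strictly between `k` and `6 + e`, which form the missed arc, are reversed by
      -- sending `j` to `6 + e + k ∸ j`.
      turn-miss : ∀ {x} k i i′ → k + (i + i′) ≡ 4 →
        (∀ j → k < j → j < 6 + e → x ≁ Hole.c C (j + i)) → ∀ j → k < j → j < 6 + e → x ≁ Hole.c C′ (j + i′)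
      turn-miss {x} k i i′ ik h j k<j j< a = h j′ k<j′ j′< (subst (x ~_) (μ (j + i′) (j′ + i) 1 sum) a)
        where
        j′ : ℕ
        j′ = 6 + e + k ∸ j
        k<j′ : k < j′
        k<j′ = m+n≤o⇒m≤o∸n (suc k) (subst (_≤ 6 + e + k) (trans (+-comm (suc j) k) (+-suc k j)) (+-monoˡ-≤ k j<))
        j′< : j′ < 6 + e
        j′< = s≤s (≤-trans (∸-monoʳ-≤ (6 + e + k) k<j) (≤-reflexive (m+n∸n≡m (5 + e) k)))
        e₁ : ∀ j i′ j′ i → (j + i′) + (j′ + i) ≡ (j′ + j) + (i + i′)
        e₁ = solve-∀
        sum : (j + i′) + (j′ + i) ≡ 1 * (6 + e) + 4
        sum = trans (e₁ j i′ j′ i) (trans (cong (_+ (i + i′)) (m∸n+n≡m (≤-trans (<⇒≤ j<) (m≤m+n _ k))))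
          (trans (+-assoc (6 + e) k (i + i′)) (Eq.cong₂ _+_ (≡-sym (+-identityʳ (6 + e))) ik)))

    X-reflected : ∀ {x} i i′ → i + i′ ≡ 2 → X C i x → X C′ i′ x
    X-reflected i i′ ii h = record
      { hit₀ = turn i′ (2 + i) 0 (trans (e₁ i i′) (cong (2 +_) ii)) (h .hit₂)
      ; hit₂ = turn (2 + i′) i 0 (trans (e₂ i i′) (cong (2 +_) ii)) (h .hit₀)
      ; miss = turn-miss 2 i i′ (cong (2 +_) ii) (h .miss) }
      where
      e₁ : ∀ i i′ → i′ + (2 + i) ≡ 2 + (i + i′)
      e₁ = solve-∀
      e₂ : ∀ i i′ → (2 + i′) + i ≡ 2 + (i + i′)
      e₂ = solve-∀

    Run₂-reflected : ∀ {x} i i′ → i + i′ ≡ 3 → Run C i 2 x → Run C′ i′ 2 x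
    Run₂-reflected i i′ ii h = record
      { hit = λ { 0 _ → turn i′ (1 + i) 0 (trans (e₁ i i′) (cong (1 +_) ii)) (h .hit 1 ≤-refl)
                ; 1 _ → turn (1 + i′) i 0 (trans (e₂ i i′) (cong (1 +_) ii)) (h .hit 0 (s≤s z≤n))
                ; (suc (suc _)) (s≤s (s≤s ())) }
      ; miss = turn-miss 1 i i′ (cong (1 +_) ii) (h .miss) }
      where
      e₁ : ∀ i i′ → i′ + (1 + i) ≡ 1 + (i + i′)
      e₁ = solve-∀
      e₂ : ∀ i i′ → (1 + i′) + i ≡ 1 + (i + i′)
      e₂ = solve-∀

  module _ (noOdd : ¬ Hole G (7 + e)) where

    -- If they were adjacent, then on the hole with `y` in place of `c 1` the vertex `a` would be a
    -- substitute of `c 2`, and `c 1` one of `y`. `XX-complete` would make `a` adjacent to `c 1`.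
    XE-anti : (C : Hole G (6 + e)) → Minimal (Hole.c C 2) → ∀ {a y} → Run C 2 2 a → X C 0 y → a ≁ y
    XE-anti C min {a} {y} ra hy a~y = ra .miss (5 + e) 2≤ ≤-refl (subst (a ~_) (≡-sym c₇)
        (XX-complete noOdd D (subst Minimal (≡-sym d₂) min) c₁∈X a∈X a≢c₁))
      where
      open Hole C
      c₇ : c (5 + e + 2) ≡ c 1
      c₇ = trans (cong c (eq s)) (per 1)
        where
        eq : ∀ s → 5 + (s + s) + 2 ≡ 6 + (s + s) + 1
        eq = solve-∀
      a≢c₁ : a ≢ c 1
      a≢c₁ refl = far 1 2 ≤-refl (s≤s 3≤) (ra .hit 1 ≤-refl)
      D₀ = swap₀ even≤′ C hy
      -- `D₀` starts at `y`. The rotation moves `y` to position 1 and keeps `c 2` at position 2,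
      -- where minimality is assumed.
      D = rotate G (5 + e) D₀
      d = Hole.c D
      -- D agrees with C except that y takes the place of c 1.
      d-at : ∀ j → j ≤ 4 + e → d (2 + j) ≡ c (2 + j)
      d-at j j≤ = trans (cong (Hole.c D₀) (eq j s)) (trans (Hole.per D₀ (suc j)) (trans (swap₀-suc even≤′ C hy j j≤) (cong c (+-identityʳ (2 + j)))))
        where
        eq : ∀ j s → 2 + j + (5 + (s + s)) ≡ 6 + (s + s) + suc j
        eq = solve-∀
      d₁ : d 1 ≡ y
      d₁ = trans (cong (Hole.c D₀) (+-comm 0 (6 + e))) (trans (Hole.per D₀ 0) (swap₀-0 even≤′ C hy))
      d₂ : d 2 ≡ c 2
      d₂ = d-at 0 z≤n
      d₀ : d 0 ≡ c 0
      d₀ = trans (swap₀-suc even≤′ C hy (4 + e) ≤-refl) (per 0)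
      c₁∈X : X D 0 (c 1)
      c₁∈X = record
        { hit₀ = subst (c 1 ~_) (≡-sym d₀) (~-sym (link 0)) ; hit₂ = subst (c 1 ~_) (≡-sym d₂) (link 1)
        ; miss = λ { (suc zero) (s≤s ()) _ ; (suc (suc j)) 3≤j (s≤s (s≤s j<)) → X-centre even≤ C 0 .miss (2 + j) 3≤j (s≤s (s≤s j<)) ∘
            subst (c 1 ~_) (trans (cong d (+-identityʳ (2 + j))) (trans (d-at j (<⇒≤ j<)) (cong c (≡-sym (+-identityʳ (2 + j)))))) } }
      a∈X : X D 1 a
      a∈X = record
        { hit₀ = subst (a ~_) (≡-sym d₁) a~y ; hit₂ = subst (a ~_) (≡-sym (d-at 1 (s≤s z≤n))) (ra .hit 1 ≤-refl)
        ; miss = λ { (suc j) (s≤s 2≤j) j< h → ra-miss j 2≤j j< (subst (λ z → a ~ d z) (+-comm (suc j) 1) h) } }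
        where
        ra-miss : ∀ j → 2 ≤ j → suc j < 6 + e → a ≁ d (2 + j)
        ra-miss j 2≤j j< h = ra .miss j 2≤j (<-trans ≤-refl j<) (subst (a ~_)
            (trans (d-at j (≤-pred (≤-pred j<))) (cong c (+-comm 2 j))) h)

    module AtMinimum (C : Hole G (6 + e)) (min : Minimal (Hole.c C 2)) (noE₁ : ∀ f → ¬ Run C 1 2 f) where
      open Hole C

      data Class (f : Fin n) : Set where
        x₀ : X C 0 f → Class f
        x₁ : X C 1 f → Class f
        x₂ : X C 2 f → Class f
        ee : Run C 2 2 f → Class f
        uu : (∀ k → f ~ c k) → Class f

      classify : ∀ {f} → c 2 ~ f → Class f
      classify {f} h with onHole? even≤ C f
      ... | inj₁ (k , k< , refl) with hole-nbr even≤ C k k< h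
      ...   | inj₁ refl = x₀ (X-centre even≤ C 0)
      ...   | inj₂ refl = x₂ (X-centre even≤ C 2)
      classify {f} h | inj₂ off with EvenHole.near C off 0 (~-sym h)
      ... | EvenHole.full u = uu u
      ... | EvenHole.run₃ r = x₀ (Run⇒X C r)
      ... | EvenHole.run₃′ r = x₁ (Run⇒X C r)
      ... | EvenHole.run₃″ r = x₂ (Run⇒X C r)
      ... | EvenHole.run₂ r = ⊥-elim (noE₁ f r)
      ... | EvenHole.run₂′ r = ee r

      X₀₁ : ∀ {x y} → X C 0 x → X C 1 y → x ≢ y → x ~ y
      X₀₁ hx hy x≢y = ~-sym (XX-complete noOdd C min hx hy (x≢y ∘ ≡-sym))

      X₁₂ : ∀ {x y} → X C 1 x → X C 2 y → x ≢ y → x ~ y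
      X₁₂ hx hy x≢y with reflected C
      ... | C′ , μ = XX-complete noOdd C′ (subst Minimal (≡-sym (μ 2 2 0 refl)) min)
            (X-reflected μ 2 0 refl hy) (X-reflected μ 1 1 refl hx) x≢y

      data InRight (f : Fin n) : Set where
        x₁ : X C 1 f → InRight f
        x₂ : X C 2 f → InRight f
        ee : Run C 2 2 f → InRight f
        uu : (∀ k → f ~ c k) → InRight f

      -- Adjacency of a run-of-two vertex to a vertex complete to the cycle is a hypothesis about
      -- the pair `f`, `g` only, because the proof of `EU-complete` uses this lemma with just the
      -- instances that minimality provides.
      right-adj : ∀ {f g} → (∀ a u → Run C 2 2 a → (∀ k → u ~ c k) → a ≡ f ⊎ a ≡ g → u ≡ f ⊎ u ≡ g → a ~ u) →
        InRight f → InRight g → f ≢ g → f ~ g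
      right-adj eu (x₁ p) (x₁ q) ne = X-clique even≤ C p q ne
      right-adj eu (x₁ p) (x₂ q) ne = X₁₂ p q ne
      right-adj eu (x₁ p) (ee q) ne = ~-sym (Even.EX-left C q p (ne ∘ ≡-sym))
      right-adj eu (x₁ p) (uu q) ne = X-full even≤ C p q ne
      right-adj eu (x₂ p) (x₁ q) ne = ~-sym (X₁₂ q p (ne ∘ ≡-sym))
      right-adj eu (x₂ p) (x₂ q) ne = X-clique even≤ C p q ne
      right-adj eu (x₂ p) (ee q) ne = ~-sym (Even.EX-right C q p (ne ∘ ≡-sym))
      right-adj eu (x₂ p) (uu q) ne = X-full even≤ C p q ne
      right-adj eu (ee p) (x₁ q) ne = Even.EX-left C p q ne
      right-adj eu (ee p) (x₂ q) ne = Even.EX-right C p q ne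
      right-adj eu (ee p) (ee q) ne = Even.E-clique C p q ne
      right-adj eu (ee p) (uu q) ne = eu _ _ p q (inj₁ refl) (inj₂ refl)
      right-adj eu (uu p) (x₁ q) ne = ~-sym (X-full even≤ C q p (ne ∘ ≡-sym))
      right-adj eu (uu p) (x₂ q) ne = ~-sym (X-full even≤ C q p (ne ∘ ≡-sym))
      right-adj eu (uu p) (ee q) ne = ~-sym (eu _ _ q p (inj₂ refl) (inj₁ refl))
      right-adj eu (uu p) (uu q) ne = full-clique even≤ C p q ne

      E-on : ∀ {a} → Run C 2 2 a → ∀ k → k < 6 + e → a ~ c k → k ≡ 2 ⊎ k ≡ 3
      E-on ra 0 _ h = ⊥-elim (ra .miss (4 + e) 2≤ (n≤1+n _) (subst (_ ~_) (≡-sym (trans (cong c (trans (+-comm (4 + e) 2) (+-comm 0 (6 + e)))) (per 0))) h))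
      E-on ra 1 _ h = ⊥-elim (ra .miss (5 + e) 2≤ ≤-refl (subst (_ ~_) (≡-sym (trans (cong c (trans (+-comm (5 + e) 2) (+-comm 1 (6 + e)))) (per 1))) h))
      E-on ra 2 _ h = inj₁ refl
      E-on ra 3 _ h = inj₂ refl
      E-on {a} ra (suc (suc (suc (suc k)))) k< h = ⊥-elim (ra .miss (2 + k) 2≤ (<-trans (n<1+n _) (<-trans (n<1+n _) k<)) (subst (λ z → a ~ c z) (+-comm 2 (2 + k)) h))

      module _ {a u} (ra : Run C 2 2 a) (hu : ∀ k → u ~ c k) (a≁u : a ≁ u) where
        private
          a₂ : a ~ c 2
          a₂ = ra .hit 0 (s≤s z≤n)
          a₃ : a ~ c 3
          a₃ = ra .hit 1 ≤-refl
          a≢u : a ≢ u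
          a≢u refl = ra .miss 2 ≤-refl 3≤ (hu 4)

        -- The missed `u` confines the neighbours `f` of `a`. If `f` sees neither `c 2` nor `c 3`,
        -- then `f ≁ u` by a 4-cycle, and any neighbour of `f` on the cycle would give an induced
        -- pentagon through `u` and `a`; so `f` would miss the whole cycle.
        E-nbr : ∀ {f} → a ~ f → InRight f
        E-nbr {f} a~f with onHole? even≤ C f
        ... | inj₁ (k , k< , refl) with E-on ra k k< a~f
        ...   | inj₁ refl = x₁ (X-centre even≤ C 1)
        ...   | inj₂ refl = x₂ (X-centre even≤ C 2)
        E-nbr {f} a~f | inj₂ off with _~?_ f (c 2)
        ... | yes f₂ with classify (~-sym f₂)
        ...   | x₀ h = ⊥-elim (XE-anti C min ra h a~f)
        ...   | x₁ h = x₁ h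
        ...   | x₂ h = x₂ h
        ...   | ee h = ee h
        ...   | uu h = uu h
        E-nbr {f} a~f | inj₂ off | no f≁₂ with _~?_ f (c 3)
        ... | yes f₃ with EvenHole.near C off 1 f₃
        ...   | EvenHole.full h = ⊥-elim (f≁₂ (h 2))
        ...   | EvenHole.run₃ r = ⊥-elim (f≁₂ (r .hit 1 2≤))
        ...   | EvenHole.run₃′ r = ⊥-elim (f≁₂ (r .hit 0 (s≤s z≤n)))
        ...   | EvenHole.run₂ r = ⊥-elim (f≁₂ (r .hit 0 (s≤s z≤n)))
        ...   | EvenHole.run₂′ r = ⊥-elim (noOdd (Even.EE-odd C ra r))
        ...   | EvenHole.run₃″ r = ⊥-elim (a≁u (common a≢u a~f a₂ (~-sym f~u) (hu 2) (off 2) f≁₂))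
          where
          f~u : f ~ u
          f~u = X-full even≤ C (Run⇒X C r) hu λ { refl → a≁u a~f }
        E-nbr {f} a~f | inj₂ off | no f≁₂ | no f≁₃ = ⊥-elim (miss₁ even≤ C 0 λ j j≤ → away (j + 0) (subst (_< 6 + e) (≡-sym (+-identityʳ j)) (s≤s (m≤n⇒m≤1+n j≤))))
          where
          f≁u : f ≁ u
          f≁u f~u = noC₄ (hu 2) (~-sym a₂) a~f f~u (a≢u ∘ ≡-sym) (λ eq → off 2 (≡-sym eq)) (≁-sym a≁u) (≁-sym f≁₂)
          away : ∀ k → k < 6 + e → f ≁ c k
          away k k< f~k = pentagon
            where
            a≁k : a ≁ c k
            a≁k h with E-on ra k k< h
            ... | inj₁ refl = f≁₂ f~k
            ... | inj₂ refl = f≁₃ f~k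
            pentagon : ⊥
            pentagon with _~?_ (c 2) (c k)
            ... | no c₂≁k = noC₅ (hu 2) (~-sym a₂) a~f f~k (~-sym (hu k)) (≁-sym a≁u) (≁-sym f≁u) (≁-sym f≁₂) c₂≁k a≁k
            ... | yes h with hole-nbr even≤ C k k< h
            ...   | inj₁ refl = noC₅ (hu 3) (~-sym a₃) a~f f~k (~-sym (hu k)) (≁-sym a≁u) (≁-sym f≁u) (≁-sym f≁₃)
                      (≁-sym (far 1 2 ≤-refl (s≤s 3≤))) a≁k
            ...   | inj₂ refl = f≁₃ f~k

      -- Among the vertices a violating this, one with the fewest neighbours is simplicial.
      EU-complete : ∀ {a u} → Run C 2 2 a → (∀ k → u ~ c k) → a ~ u
      EU-complete {a} {u} ra hu = ~-stable λ a≁u → descend size smallest a (ra , u , hu , a≁u)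
        where
        Bad : Fin n → Set
        Bad a = Run C 2 2 a × ∃ λ u → (∀ k → u ~ c k) × a ≁ u
        smallest : ∀ a → Bad a → (∀ b → Bad b → size b < size a → ⊥) → ⊥
        smallest a (ra , u , hu , a≁u) least = noSimplicial a λ f g a~f a~g f≢g →
            right-adj (λ b w rb hw b∈ w∈ → ~-stable λ b≁w →
                least b (rb , w , hw , b≁w) (size-< (sub rb hw b≁w (pick w∈ a~f a~g)) w (inj₂ (pick w∈ a~f a~g))
                  λ { (inj₁ refl) → rb .miss 2 ≤-refl 3≤ (hw 4) ; (inj₂ h) → b≁w h }))
              (E-nbr ra hu a≁u a~f) (E-nbr ra hu a≁u a~g) f≢g
          where
          pick : ∀ {f g w} → w ≡ f ⊎ w ≡ g → a ~ f → a ~ g → a ~ w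
          pick (inj₁ refl) h _ = h
          pick (inj₂ refl) _ h = h
          sub : ∀ {b w} → Run C 2 2 b → (∀ k → w ~ c k) → b ≁ w → a ~ w → ∀ f → Closed b f → Closed a f
          sub {b} rb hw b≁w a~w f h with f Finₚ.≟ a
          ... | yes eq = inj₁ eq
          sub {b} rb hw b≁w a~w f (inj₁ refl) | no ne = inj₂ (Even.E-clique C ra rb (ne ∘ ≡-sym))
          sub {b} {w} rb hw b≁w a~w f (inj₂ b~f) | no ne with E-nbr rb hw b≁w b~f
          ... | x₁ p = inj₂ (Even.EX-left C ra p (ne ∘ ≡-sym))
          ... | x₂ p = inj₂ (Even.EX-right C ra p (ne ∘ ≡-sym))
          ... | ee p = inj₂ (Even.E-clique C ra p (ne ∘ ≡-sym))
          ... | uu p = inj₂ (~-stable λ a≁f →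
                  noC₄ a~w (full-clique even≤ C hw p λ { refl → b≁w b~f }) (~-sym b~f) (Even.E-clique C rb ra b≢a)
                    (ne ∘ ≡-sym) (λ { refl → rb .miss 2 ≤-refl 3≤ (hw 4) }) a≁f (≁-sym b≁w))
            where
            b≢a : b ≢ a
            b≢a refl = b≁w a~w

      eu : ∀ {f g : Fin n} a u → Run C 2 2 a → (∀ k → u ~ c k) → a ≡ f ⊎ a ≡ g → u ≡ f ⊎ u ≡ g → a ~ u
      eu a u ra hu _ _ = EU-complete ra hu

      isL isR : ∀ {f} → Class f → Bool
      isL (x₀ _) = true
      isL _ = false
      isR (x₂ _) = true
      isR (ee _) = true
      isR _ = false

      -- L consists of the copies of `c 1`; R of the copies of `c 3` and the vertices seeing just
      -- `c 2` and `c 3`. The copies of `c 2` and the vertices complete to the cycle form M.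
      goodVertex : Good G (c 2)
      goodVertex = record { L = L ; R = R ; disjoint = disjoint ; left = left ; right = right ; apart = apart }
        where
        L R : Fin n → Bool
        L f with _~?_ (c 2) f
        ... | yes h = isL (classify h)
        ... | no _ = false
        R f with _~?_ (c 2) f
        ... | yes h = isR (classify h)
        ... | no _ = false
        data Sides (f : Fin n) : Bool → Bool → Set where
          x₀ : X C 0 f → Sides f true false
          x₁ : X C 1 f → Sides f false false
          x₂ : X C 2 f → Sides f false true
          ee : Run C 2 2 f → Sides f false true
          uu : (∀ k → f ~ c k) → Sides f false false
        sides : ∀ f → c 2 ~ f → Sides f (L f) (R f)
        sides f h with _~?_ (c 2) f
        ... | no ¬h = ⊥-elim (¬h h)
        ... | yes h′ with classify h′
        ...   | x₀ p = x₀ p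
        ...   | x₁ p = x₁ p
        ...   | x₂ p = x₂ p
        ...   | ee p = ee p
        ...   | uu p = uu p
        data InLeft (f : Fin n) : Set where
          x₀ : X C 0 f → InLeft f
          x₁ : X C 1 f → InLeft f
          uu : (∀ k → f ~ c k) → InLeft f
        inLeft : ∀ {f l} → Sides f l false → InLeft f
        inLeft (x₀ p) = x₀ p
        inLeft (x₁ p) = x₁ p
        inLeft (uu p) = uu p
        inRight : ∀ {f r} → Sides f false r → InRight f
        inRight (x₁ p) = x₁ p
        inRight (x₂ p) = x₂ p
        inRight (ee p) = ee p
        inRight (uu p) = uu p
        left-adj : ∀ {f g} → InLeft f → InLeft g → f ≢ g → f ~ g
        left-adj (x₀ p) (x₀ q) ne = X-clique even≤ C p q ne
        left-adj (x₀ p) (x₁ q) ne = X₀₁ p q ne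
        left-adj (x₀ p) (uu q) ne = X-full even≤ C p q ne
        left-adj (x₁ p) (x₀ q) ne = ~-sym (X₀₁ q p (ne ∘ ≡-sym))
        left-adj (x₁ p) (x₁ q) ne = X-clique even≤ C p q ne
        left-adj (x₁ p) (uu q) ne = X-full even≤ C p q ne
        left-adj (uu p) (x₀ q) ne = ~-sym (X-full even≤ C q p (ne ∘ ≡-sym))
        left-adj (uu p) (x₁ q) ne = ~-sym (X-full even≤ C q p (ne ∘ ≡-sym))
        left-adj (uu p) (uu q) ne = full-clique even≤ C p q ne
        disjoint : ∀ f → c 2 ~ f → L f ≡ true → R f ≡ true → ⊥
        disjoint f h l r with Eq.subst₂ (Sides f) l r (sides f h)
        ... | ()
        left : ∀ f g → c 2 ~ f → c 2 ~ g → R f ≡ false → R g ≡ false → f ≢ g → f ~ g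
        left f g hf hg rf rg = left-adj (inLeft (subst (Sides f (L f)) rf (sides f hf))) (inLeft (subst (Sides g (L g)) rg (sides g hg)))
        right : ∀ f g → c 2 ~ f → c 2 ~ g → L f ≡ false → L g ≡ false → f ≢ g → f ~ g
        right f g hf hg lf lg = right-adj eu (inRight (subst (λ b → Sides f b (R f)) lf (sides f hf)))
          (inRight (subst (λ b → Sides g b (R g)) lg (sides g hg)))
        apart : ∀ f g → c 2 ~ f → c 2 ~ g → L f ≡ true → R g ≡ true → f ≁ g
        apart f g hf hg lf rg = separate (subst (λ b → Sides f b (R f)) lf (sides f hf)) (subst (Sides g (L g)) rg (sides g hg))
          where
          separate : ∀ {f g l r} → Sides f true r → Sides g l true → f ≁ g
          separate (x₀ p) (x₂ q) = Even.XX-anti C p q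
          separate (x₀ p) (ee q) = XE-anti C min q p ∘ ~-sym

    noEven : ¬ Hole G (6 + e)
    noEven C = descend size least (Hole.c C 0) (C , refl)
      where
      least : ∀ v → OnEven v → Minimal v → ⊥
      -- Vertices with runs of two on both edges at `c 2` would give an odd hole. Hence one of the
      -- two directions of the cycle satisfies `noE₁`.
      least v (D , refl) min = noGood (c₂ 2) (goodVertex C₂ min₂ λ f rf → noGood (Hole.c C₃ 2)
          (goodVertex C₃ min₃ λ g rg → noOdd (Even.EE-odd C₂ rf (Run₂-reflected {C₃} {C₂} (Mirror-sym {C₂} {C₃} μ) 1 2 refl rg))))
        where
        open AtMinimum
        C₂ = rotate G (4 + e) D
        c₂ = Hole.c C₂
        min₂ : Minimal (c₂ 2)
        min₂ = subst Minimal (≡-sym (trans (cong (Hole.c D) (+-comm 0 (6 + e))) (Hole.per D 0))) min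
        C₃ = proj₁ (reflected C₂)
        μ = proj₂ (reflected C₂)
        min₃ : Minimal (Hole.c C₃ 2)
        min₃ = subst Minimal (≡-sym (μ 2 2 0 refl)) min₂

-- Odd holes

module OddCase {n : ℕ} (G : Graph n) (s : ℕ) (independence : ¬ HasIndependentSet G (4 + s))
  (noShort : ∀ k → 4 ≤ k → k ≤ 5 + (s + s) → ¬ HasInducedCycle G k) where
  open Holes G s independence noShort public
  open Run
  open X

  private
    2≤ : ∀ {j} → 2 ≤ 2 + j
    2≤ = s≤s (s≤s z≤n)
    3≤ : ∀ {j} → 3 ≤ 3 + j
    3≤ = s≤s 2≤
    4≤ : ∀ {j} → 4 ≤ 4 + j
    4≤ = s≤s 3≤
    5≤ : 5 ≤ 7 + e
    5≤ = s≤s 4≤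
    odd≤′ : 4 + e ≤ 5 + e
    odd≤′ = n≤1+n _

  Run-rotate : ∀ {m} (C : Hole G m) k {i l x} → Run (rotate G k C) i l x → Run C (i + k) l x
  Run-rotate C k {i} {l} {x} r = record
    { hit = λ j j< → subst (λ z → x ~ Hole.c C z) (+-assoc j i k) (r .hit j j<)
    ; miss = λ j l≤ j< → r .miss j l≤ j< ∘ subst (λ z → x ~ Hole.c C z) (≡-sym (+-assoc j i k)) }

  Run-unrotate : ∀ {m} (C : Hole G m) k {i l x} → Run C (i + k) l x → Run (rotate G k C) i l x
  Run-unrotate C k {i} {l} {x} r = record
    { hit = λ j j< → subst (λ z → x ~ Hole.c C z) (≡-sym (+-assoc j i k)) (r .hit j j<)
    ; miss = λ j l≤ j< → r .miss j l≤ j< ∘ subst (λ z → x ~ Hole.c C z) (+-assoc j i k) }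

  X-rotate : ∀ {m} (C : Hole G m) k {i x} → X (rotate G k C) i x → X C (i + k) x
  X-rotate C k {i} {x} h = record { hit₀ = h .hit₀ ; hit₂ = h .hit₂
    ; miss = λ j l≤ j< → h .miss j l≤ j< ∘ subst (λ z → x ~ Hole.c C z) (≡-sym (+-assoc j i k)) }

  Off-rotate : ∀ {m′} → 5 ≤ suc m′ → (C : Hole G (suc m′)) → ∀ k {x} → Off (rotate G k C) x → Off C x
  Off-rotate {m′} 5≤m C k off i eq = off (k * m′ + i) (trans eq (trans (≡-sym (OnHole.c-wrap G 5≤m C k i)) (cong (Hole.c C) (idx k m′ i))))
    where
    idx : ∀ k m i → k * suc m + i ≡ k * m + i + k
    idx = solve-∀

  X-off : ∀ {m′} → 6 + e ≤ suc m′ → (C : Hole G (suc m′)) → ∀ k {x} → X C k x → x ≢ Hole.c C (1 + k) → Off C x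
  X-off {m′} 6≤m C k {x} h ne with onHole? 6≤m (rotate G k C) x
  ... | inj₂ off = Off-rotate (≤-trans (s≤s 4≤) 6≤m) C k off
  ... | inj₁ (0 , _ , refl) = ⊥-elim (~-irrefl (h .hit₀))
  ... | inj₁ (1 , _ , eq) = ⊥-elim (ne eq)
  ... | inj₁ (2 , _ , refl) = ⊥-elim (~-irrefl (h .hit₂))
  ... | inj₁ (suc (suc (suc r)) , r< , refl) with m≤n⇒m<n∨m≡n r<
  ...   | inj₁ r<′ = ⊥-elim (Hole.far C k (3 + r) 2≤ r<′ (~-sym (h .hit₀)))
  ...   | inj₂ refl = ⊥-elim (Hole.far C (2 + k) (1 + r) (≤-trans (s≤s (s≤s z≤n)) (≤-pred (≤-pred (≤-pred 6≤m)))) (≤-trans (n≤1+n _) (≤-reflexive refl))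
            (subst (λ z → Hole.c C (2 + k) ~ Hole.c C z) (≡-sym (shift₂ (1 + r) k)) (~-sym (h .hit₂))))

  module Odd (C : Hole G (7 + e)) where
    open Hole C

    five : ∀ {x} → Off C x → ∀ i → (∀ j → j < 5 → x ~ c (j + i)) → ∀ k → x ~ c k
    five {x} off i h k = backwards G (5 + e) Q down back i h k 0 (s≤s z≤n)
      where
      Q : ℕ → Set
      Q i = ∀ j → j < 5 → x ~ c (j + i)
      swap₃ : ∀ j i e → j + (7 + e + i) ≡ 7 + e + (j + i)
      swap₃ = solve-∀
      down : ∀ i → Q (7 + e + i) → Q i
      down i q j j< = subst (x ~_) (trans (cong c (swap₃ j i e)) (per _)) (q j j<)
      back : ∀ i → Q i → Q (6 + e + i)
      back i q = λ { zero _ → prev ; (suc j) (s≤s j<) → subst (x ~_) (≡-sym (trans (cong c (shift j)) (per _))) (q j (m<n⇒m<1+n j<)) }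
        where
        shift : ∀ j → suc j + (6 + e + i) ≡ 7 + e + (j + i)
        shift j = trans (≡-sym (+-suc j (6 + e + i))) (swap₃ j i e)
        up : ∀ j → j < 5 → x ~ c (j + (7 + e + i))
        up j j< = subst (x ~_) (≡-sym (trans (cong c (swap₃ j i e)) (per _))) (q j j<)
        prev : x ~ c (6 + e + i)
        prev = ~-stable λ x≁ → case OddHole.start C off (6 + e + i) x≁ (up 0 (s≤s z≤n)) of λ
          { (inj₁ r) → r .miss 4 3≤ (s≤s 4≤) (up 4 ≤-refl)
          ; (inj₂ r) → r .miss 4 ≤-refl (s≤s 4≤) (up 4 ≤-refl) }

    data Near (p : ℕ) (x : Fin n) : Set where
      full : (∀ k → x ~ c k) → Near p x
      run₃ : ∀ i → 1 ≤ i → i ≤ 3 → Run C (i + p) 3 x → Near p x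
      run₄ : ∀ i → i ≤ 3 → Run C (i + p) 4 x → Near p x

    abstract
      near : ∀ {x} → Off C x → ∀ p → x ~ c (3 + p) → Near p x
      near {x} off p h₃ with _~?_ x (c (2 + p))
      ... | no x≁ = [ run₃ 3 (s≤s z≤n) ≤-refl , run₄ 3 ≤-refl ]′ (OddHole.start C off (2 + p) x≁ h₃)
      ... | yes h₂ with _~?_ x (c (1 + p))
      ...   | no x≁ = [ run₃ 2 (s≤s z≤n) 2≤ , run₄ 2 2≤ ]′ (OddHole.start C off (1 + p) x≁ h₂)
      ...   | yes h₁ with _~?_ x (c p)
      ...     | no x≁ = [ run₃ 1 (s≤s z≤n) (s≤s z≤n) , run₄ 1 (s≤s z≤n) ]′ (OddHole.start C off p x≁ h₁)
      ...     | yes h₀ with _~?_ x (c (6 + e + p))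
      ...       | yes h₆ = full (five off (6 + e + p) λ
                    { 0 _ → h₆ ; 1 _ → up 0 h₀ ; 2 _ → up 1 h₁ ; 3 _ → up 2 h₂ ; 4 _ → up 3 h₃
                    ; (suc (suc (suc (suc (suc _))))) (s≤s (s≤s (s≤s (s≤s (s≤s ()))))) })
        where
        up : ∀ j → x ~ c (j + p) → x ~ c (suc j + (6 + e + p))
        up j h = subst (x ~_) (≡-sym (trans (cong c (eq j p e)) (per (j + p)))) h
          where
          eq : ∀ j p e → suc j + (6 + e + p) ≡ 7 + e + (j + p)
          eq = solve-∀
      ...       | no x≁ with OddHole.start C off (6 + e + p) x≁ (subst (x ~_) (≡-sym (per p)) h₀)
      ...         | inj₁ r = ⊥-elim (Run-down C r .miss 3 ≤-refl 4≤ h₃)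
      ...         | inj₂ r = run₄ 0 z≤n (Run-down C r)

    -- Runs on an odd hole have at least three vertices, so a vertex with a neighbour on it sees two
    -- hole vertices at distance two. These are also seen by `u`, and `common` applies.
    full-universal : ∀ {u} → (∀ k → u ~ c k) → ∀ x → x ≢ u → u ~ x
    full-universal {u} hu x x≢u with onHole? odd≤ C x
    ... | inj₁ (k , _ , refl) = hu k
    ... | inj₂ off = ~-sym (~-stable λ x≁u → miss₁ odd≤ C 0 λ j _ x~j → noPair x≁u 0
            (all x≁u (j + 0) x~j 0) (all x≁u (j + 0) x~j 2))
      where
      noPair : x ≁ u → ∀ i → x ~ c i → x ~ c (2 + i) → ⊥
      noPair x≁u i h₀ h₂ = x≁u (common x≢u h₀ h₂ (hu i) (hu (2 + i))
        (OnHole.c-distinct G 5≤ C i 2 (s≤s z≤n) 3≤) (far i 2 ≤-refl 4≤))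
      back : x ≁ u → ∀ i → x ~ c (suc i) → x ~ c i
      back x≁u i h = ~-stable λ x≁ → case OddHole.start C off i x≁ h of λ
        { (inj₁ r) → noPair x≁u (suc i) h (r .hit 2 ≤-refl) ; (inj₂ r) → noPair x≁u (suc i) h (r .hit 2 3≤) }
      all : x ≁ u → ∀ i → x ~ c i → ∀ k → x ~ c k
      all x≁u = backwards G (5 + e) (λ i → x ~ c i) (λ i → subst (x ~_) (per i))
        λ i h → back x≁u (6 + e + i) (subst (x ~_) (≡-sym (per i)) h)

    -- Otherwise, on the hole with `x` in place of `c (1 + i)`, `y` would see only `c (2 + i)` and
    -- `c (3 + i)` at most, missing 2t ∸ 1 consecutive vertices.
    XX-complete-odd : ∀ {i x y} → X C i x → X C (1 + i) y → x ≢ y → x ~ y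
    XX-complete-odd {i} {x} {y} hx hy x≢y = ~-stable λ x≁y → miss₁ odd≤ D 3 (none x≁y)
      where
      D = swap₀ odd≤′ C hx
      d = Hole.c D
      idx : ∀ j i → 2 + (2 + j) + i ≡ (3 + j) + (1 + i)
      idx = solve-∀
      none : x ≁ y → ∀ j → j ≤ 4 + e → y ≁ d (j + 3)
      none x≁y j j≤ a with m≤n⇒m<n∨m≡n j≤
      ... | inj₁ j< = hy .miss (3 + j) 3≤ (s≤s (s≤s (s≤s j<))) (subst (y ~_)
              (trans (cong d (+-comm j 3)) (trans (swap₀-suc odd≤′ C hx (2 + j) (s≤s j<)) (cong c (idx j i)))) a)
      ... | inj₂ refl = x≁y (~-sym (subst (y ~_) (trans (cong d (eq e)) (trans (Hole.per D 0) (swap₀-0 odd≤′ C hx))) a))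
        where
        eq : ∀ e → 4 + e + 3 ≡ 7 + e + 0
        eq = solve-∀

    hole-nbr₃ : ∀ k → k < 7 + e → c 3 ~ c k → k ≡ 2 ⊎ k ≡ 4
    hole-nbr₃ 0 _ a = ⊥-elim (far 0 3 2≤ (s≤s 4≤) (~-sym a))
    hole-nbr₃ 1 _ a = ⊥-elim (far 1 2 2≤ 4≤ (~-sym a))
    hole-nbr₃ 2 _ a = inj₁ refl
    hole-nbr₃ 3 _ a = ⊥-elim (~-irrefl a)
    hole-nbr₃ 4 _ a = inj₂ refl
    hole-nbr₃ (suc (suc (suc (suc (suc k))))) k< a = ⊥-elim (far 3 (2 + k) 2≤ (≤-trans (m≤n+m _ 2) k<)
      (subst (λ z → c 3 ~ c z) (+-comm 3 (2 + k)) a))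

    -- Under these hypotheses the neighbours of `c 3` are copies of `c 2`, `c 3` and `c 4`. The runs
    -- of four containing `c 3` are those starting at `c 0`, ..., `c 3`.
    module Clean (noFull : ∀ u → ¬ (∀ k → u ~ c k)) (noB : ∀ f i → i ≤ 3 → Off C f → ¬ Run C i 4 f)
      (anti : ∀ x y → X C 1 x → X C 3 y → x ≁ y) where

      data Class (f : Fin n) : Set where
        x₁ : X C 1 f → Class f
        x₂ : X C 2 f → Class f
        x₃ : X C 3 f → Class f

      classify : ∀ {f} → c 3 ~ f → Class f
      classify {f} h with onHole? odd≤ C f
      ... | inj₁ (k , k< , refl) with hole-nbr₃ k k< h
      ...   | inj₁ refl = x₁ (X-centre odd≤ C 1)
      ...   | inj₂ refl = x₃ (X-centre odd≤ C 3)
      classify {f} h | inj₂ off with near off 0 (~-sym h)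
      ... | full u = ⊥-elim (noFull f u)
      ... | run₄ i i≤ r = ⊥-elim (noB f i i≤ off (subst (λ z → Run C z 4 f) (+-identityʳ i) r))
      ... | run₃ 1 _ _ r = x₁ (Run⇒X C r)
      ... | run₃ 2 _ _ r = x₂ (Run⇒X C r)
      ... | run₃ 3 _ _ r = x₃ (Run⇒X C r)
      ... | run₃ (suc (suc (suc (suc _)))) _ (s≤s (s≤s (s≤s ()))) _

      isL isR : ∀ {f} → Class f → Bool
      isL (x₁ _) = true
      isL _ = false
      isR (x₃ _) = true
      isR _ = false

      goodVertex : Good G (c 3)
      goodVertex = record { L = L ; R = R ; disjoint = disjoint ; left = left ; right = right ; apart = apart }
        where
        L R : Fin n → Bool
        L f with _~?_ (c 3) f
        ... | yes h = isL (classify h)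
        ... | no _ = false
        R f with _~?_ (c 3) f
        ... | yes h = isR (classify h)
        ... | no _ = false
        data Sides (f : Fin n) : Bool → Bool → Set where
          x₁ : X C 1 f → Sides f true false
          x₂ : X C 2 f → Sides f false false
          x₃ : X C 3 f → Sides f false true
        sides : ∀ f → c 3 ~ f → Sides f (L f) (R f)
        sides f h with _~?_ (c 3) f
        ... | no ¬h = ⊥-elim (¬h h)
        ... | yes h′ with classify h′
        ...   | x₁ p = x₁ p
        ...   | x₂ p = x₂ p
        ...   | x₃ p = x₃ p
        disjoint : ∀ f → c 3 ~ f → L f ≡ true → R f ≡ true → ⊥
        disjoint f h l r with L f | R f | sides f h
        disjoint f h refl () | _ | _ | x₁ _
        left : ∀ f g → c 3 ~ f → c 3 ~ g → R f ≡ false → R g ≡ false → f ≢ g → f ~ g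
        left f g hf hg rf rg ne with L f | R f | sides f hf | L g | R g | sides g hg
        left f g hf hg () rg ne | _ | _ | x₃ _ | _ | _ | _
        left f g hf hg rf () ne | _ | _ | _ | _ | _ | x₃ _
        ... | _ | _ | x₁ p | _ | _ | x₁ q = X-clique odd≤ C p q ne
        ... | _ | _ | x₁ p | _ | _ | x₂ q = XX-complete-odd p q ne
        ... | _ | _ | x₂ p | _ | _ | x₁ q = ~-sym (XX-complete-odd q p (ne ∘ ≡-sym))
        ... | _ | _ | x₂ p | _ | _ | x₂ q = X-clique odd≤ C p q ne
        right : ∀ f g → c 3 ~ f → c 3 ~ g → L f ≡ false → L g ≡ false → f ≢ g → f ~ g
        right f g hf hg rf rg ne with L f | R f | sides f hf | L g | R g | sides g hg
        right f g hf hg () rg ne | _ | _ | x₁ _ | _ | _ | _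
        right f g hf hg rf () ne | _ | _ | _ | _ | _ | x₁ _
        ... | _ | _ | x₃ p | _ | _ | x₃ q = X-clique odd≤ C p q ne
        ... | _ | _ | x₂ p | _ | _ | x₃ q = XX-complete-odd p q ne
        ... | _ | _ | x₃ p | _ | _ | x₂ q = ~-sym (XX-complete-odd q p (ne ∘ ≡-sym))
        ... | _ | _ | x₂ p | _ | _ | x₂ q = X-clique odd≤ C p q ne
        apart : ∀ f g → c 3 ~ f → c 3 ~ g → L f ≡ true → R g ≡ true → f ≁ g
        apart f g hf hg lf rg a with L f | R f | sides f hf | L g | R g | sides g hg
        apart f g hf hg refl refl a | _ | _ | x₁ p | _ | _ | x₃ q = anti f g p q a

    -- With `x` in place of `c 2`, the run of `y` grows to `x`, `c 3`, `c 4`, `c 5`. So both defects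
    -- at a vertex of an odd hole come down to a run of four, possibly on another odd hole.
    edge⇒run₄ : ∀ {x y} → X C 1 x → X C 3 y → x ~ y → Σ (Hole G (7 + e)) λ D → Run D 0 4 y
    edge⇒run₄ {x} {y} hx hy x~y = D , record
        { hit = λ { 0 _ → subst (y ~_) (≡-sym (swap₀-0 odd≤′ C hx)) (~-sym x~y)
                  ; 1 _ → subst (y ~_) (≡-sym (d-suc 0 z≤n)) (hy .hit₀)
                  ; 2 _ → subst (y ~_) (≡-sym (d-suc 1 (s≤s z≤n))) (X-centre-adj odd≤ C hy λ { refl → hx .miss 3 ≤-refl 4≤ x~y })
                  ; 3 _ → subst (y ~_) (≡-sym (d-suc 2 2≤)) (hy .hit₂)
                  ; (suc (suc (suc (suc _)))) (s≤s (s≤s (s≤s (s≤s ())))) }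
        ; miss = y-miss }
      where
      D = swap₀ odd≤′ C hx
      d-suc : ∀ j → j ≤ 5 + e → Hole.c D (suc j) ≡ c (3 + j)
      d-suc j j≤ = trans (swap₀-suc odd≤′ C hx j j≤) (cong c (eq j))
        where
        eq : ∀ j → 2 + j + 1 ≡ 3 + j
        eq = solve-∀
      y-miss : ∀ j → 4 ≤ j → j < 7 + e → y ≁ Hole.c D (j + 0)
      y-miss (suc j) (s≤s 3≤j) j< a = hy .miss j 3≤j (<-trans (n<1+n _) j<) (subst (y ~_)
        (trans (cong (Hole.c D) (+-identityʳ (suc j))) (trans (d-suc j (≤-pred (≤-pred j<))) (cong c (+-comm 3 j)))) a)

    module Shortcut {b} (rb : Run C 0 4 b) where
      private
        mid : ∀ j → 0 < j → j < 4 + e → b ≁ c (j + 3)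
        mid j 0<j j< = rb .miss (3 + j) (s≤s (s≤s (s≤s 0<j))) (s≤s (s≤s (s≤s j<))) ∘ subst (λ z → b ~ c z) (eq j)
          where
          eq : ∀ j → j + 3 ≡ 3 + j + 0
          eq = solve-∀
        apex : IsApex G b (4 + e) (λ j → c (j + 3))
        apex = OnHole.shortcut G 5≤ C b 3 (4 + e) 2≤ (n≤1+n _) (rb .hit 3 ≤-refl)
          (subst (b ~_) (≡-sym (trans (cong c (eq e)) (per 0))) (rb .hit 0 (s≤s z≤n)))
          mid (OnHole.off-arc G 5≤ C b 3 (4 + e) 3≤ mid)
          where
          eq : ∀ e → 4 + e + 3 ≡ 7 + e + 0
          eq = solve-∀

      -- The cycle b, c 3, …, c m.
      D : Hole G (6 + e)
      D = apexHole G apex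

      d-0 : Hole.c D 0 ≡ b
      d-0 = apexHole-0 G apex

      d-suc : ∀ j → j ≤ 4 + e → Hole.c D (suc j) ≡ c (3 + j)
      d-suc j j≤ = trans (apexHole-suc G apex j j≤) (cong c (+-comm j 3))

      off-D : ∀ {f} → f ≢ b → Off C f → Off D f
      off-D {f} f≢b off k eq with onHole? even≤ D f
      ... | inj₂ o = o k eq
      ... | inj₁ (zero , _ , e₀) = f≢b (trans e₀ d-0)
      ... | inj₁ (suc j , j< , e₀) = off (3 + j) (trans e₀ (d-suc j (≤-pred (≤-pred j<))))

      b-miss : ∀ j → 4 ≤ j → j < 7 + e → b ≁ c j
      b-miss j 4≤j j< = rb .miss j 4≤j j< ∘ subst (λ z → b ~ c z) (≡-sym (+-identityʳ j))

      onD : ∀ {f} k j → k + j ≤ 4 + e → f ~ c (j + (3 + k)) → f ~ Hole.c D (j + suc k)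
      onD {f} k j le h = subst (f ~_) (≡-sym (trans (cong (Hole.c D) (+-suc j k)) (trans (d-suc (j + k) (subst (_≤ 4 + e) (+-comm k j) le)) (cong c (eq j k))))) h
        where
        eq : ∀ j k → 3 + (j + k) ≡ j + (3 + k)
        eq = solve-∀

      -- The four neighbours are also consecutive on the even hole `D`, so `f` would be complete to
      -- `D`; but `D` contains one of the hole vertices next to the run.
      far-run₄ : ∀ {f} k → k ≤ 1 + e → Off C f → ¬ Run C (3 + k) 4 f
      far-run₄ {f} k k≤ off r = contra k k≤ r full-D
        where
        full-D : ∀ i → f ~ Hole.c D i
        full-D = EvenHole.four D (off-D f≢b off) (suc k) λ j j< →
            onD k j (≤-trans (+-mono-≤ k≤ (≤-pred j<)) (≤-reflexive (cong suc (+-comm e 3)))) (r .hit j j<)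
          where
          f≢b : f ≢ b
          f≢b refl = b-miss (4 + k) 4≤ (s≤s (s≤s (s≤s (s≤s (s≤s (≤-trans k≤ (n≤1+n _))))))) (r .hit 1 2≤)
        contra : ∀ k → k ≤ 1 + e → Run C (3 + k) 4 f → (∀ i → f ~ Hole.c D i) → ⊥
        contra zero _ r h = r .miss 4 ≤-refl (s≤s 4≤) (subst (f ~_) (d-suc 4 4≤) (h 5))
        contra (suc k) (s≤s k≤) r h = r .miss (6 + e) 4≤ ≤-refl
            (subst (f ~_) (trans (d-suc k (≤-trans k≤ (m≤n+m e 4))) (≡-sym (trans (cong c (eq k e)) (per (3 + k))))) (h (suc k)))
          where
          eq : ∀ k e → 6 + e + (3 + suc k) ≡ 7 + e + (3 + k)
          eq = solve-∀

      X-D : ∀ {x} k → k ≤ 2 + e → X C (3 + k) x → (∃ λ i → x ≁ Hole.c D i) → X D (suc k) x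
      X-D {x} k k≤ hx (i , x≁) with x Finₚ.≟ c (4 + k)
      ... | yes refl = subst (X D (suc k)) (d-suc (suc k) (≤-trans (s≤s k≤) (n≤1+n _))) (X-centre even≤ D (suc k))
      ... | no ne = Run⇒X D (EvenHole.three D (off-D x≢b (X-off odd≤ C (3 + k) hx ne)) (suc k) i x≁ λ
              { 0 _ → onD k 0 (≤-trans (≤-reflexive (+-identityʳ k)) (≤-trans k≤ (m≤n+m (2 + e) 2))) (hx .hit₀)
              ; 1 _ → onD k 1 (≤-trans (≤-reflexive (+-comm k 1)) (≤-trans (s≤s k≤) (n≤1+n _))) (X-centre-adj odd≤ C hx ne)
              ; 2 _ → onD k 2 (≤-trans (≤-reflexive (+-comm k 2)) (s≤s (s≤s k≤))) (hx .hit₂)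
              ; (suc (suc (suc _))) (s≤s (s≤s (s≤s ()))) })
        where
        x≢b : x ≢ b
        x≢b refl = b-miss (4 + k) 4≤ (s≤s (s≤s (s≤s (s≤s (s≤s k≤))))) (X-centre-adj odd≤ C hx ne)

      -- Copies of vertices well inside the arc shared with `D` are copies on `D` too, and there
      -- `XX-anti` holds.
      far-anti : ∀ {x y} k → k ≤ e → X C (3 + k) x → X C (5 + k) y → x ≁ y
      far-anti {x} {y} k k≤ hx hy = Even.XX-anti D (X-D k (≤-trans k≤ (m≤n+m e 2)) hx (4 + k , x≁)) (X-D (2 + k) (s≤s (s≤s k≤)) hy (2 + k , y≁))
        where
        x≁ : x ≁ Hole.c D (4 + k)
        x≁ = hx .miss 3 ≤-refl 4≤ ∘ subst (x ~_) (d-suc (3 + k) (s≤s (s≤s (s≤s (m≤n⇒m≤1+n k≤)))))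
        y≁ : y ≁ Hole.c D (2 + k)
        y≁ a = hy .miss (6 + e) 3≤ ≤-refl (subst (y ~_) (trans (d-suc (1 + k) (s≤s (≤-trans k≤ (m≤n+m e 3)))) (≡-sym (trans (cong c (eq k e)) (per (4 + k))))) a)
          where
          eq : ∀ k e → 6 + e + (5 + k) ≡ 7 + e + (4 + k)
          eq = solve-∀

-- The square of the 11-cycle.
record Ring {n : ℕ} (G : Graph n) : Set where
  field
    z     : ℕ → Fin n
    z-per : ∀ i → z (11 + i) ≡ z i
    near₁ : ∀ i → Adj G (z i) (z (1 + i))
    near₂ : ∀ i → Adj G (z i) (z (2 + i))
    far   : ∀ i d → 3 ≤ d → d ≤ 8 → ¬ Adj G (z i) (z (d + i))

-- Excluding odd holes

module OddAssembly {n : ℕ} (G : Graph n) (noGood : ∀ v → ¬ Good G v)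
  (noUniversal : ∀ u → ¬ (∀ x → x ≢ u → Adj G u x)) (s : ℕ)
  (independence : ¬ HasIndependentSet G (4 + s))
  (noShort : ∀ k → 4 ≤ k → k ≤ 5 + (s + s) → ¬ HasInducedCycle G k) where
  open OddCase G s independence noShort public
  open Run
  open X

  noFull : (C : Hole G (7 + e)) → ∀ u → ¬ (∀ k → u ~ Hole.c C k)
  noFull C u hu = noUniversal u (Odd.full-universal C hu)

  dirty : (C : Hole G (7 + e)) → (∀ f i → i ≤ 3 → Off C f → ¬ Run C i 4 f) →
    (∀ x y → X C 1 x → X C 3 y → x ≁ y) → ⊥
  dirty C noB anti = noGood (Hole.c C 3) (Odd.Clean.goodVertex C (noFull C) noB anti)

  Off-back : (C : Hole G (7 + e)) → ∀ k {f} → Off (rotate G k C) f → Off C f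
  Off-back C = Off-rotate (m≤m+n 5 _) C

  Run₄-off : (C : Hole G (7 + e)) → ∀ {b} → Run C 0 4 b → Off C b
  Run₄-off C {b} r with onHole? odd≤ C b
  ... | inj₂ off = off
  ... | inj₁ (0 , _ , refl) = ⊥-elim (~-irrefl (r .hit 0 (s≤s z≤n)))
  ... | inj₁ (1 , _ , refl) = ⊥-elim (~-irrefl (r .hit 1 (s≤s (s≤s z≤n))))
  ... | inj₁ (2 , _ , refl) = ⊥-elim (~-irrefl (r .hit 2 (m≤m+n 3 _)))
  ... | inj₁ (3 , _ , refl) = ⊥-elim (~-irrefl (r .hit 3 ≤-refl))
  ... | inj₁ (4 , _ , refl) = ⊥-elim (r .miss 5 (n≤1+n 4) (m≤m+n 6 _) (Hole.link C 4))
  ... | inj₁ (suc (suc (suc (suc (suc k)))) , k< , refl) = ⊥-elim (r .miss (4 + k) (m≤m+n 4 _) (<-trans (n<1+n _) k<)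
          (subst (λ i → Hole.c C (5 + k) ~ Hole.c C i) (≡-sym (+-identityʳ (4 + k))) (~-sym (Hole.link C (4 + k)))))

  noOdd-if : (∀ (C : Hole G (7 + e)) b → Run C 0 4 b → ⊥) → ¬ Hole G (7 + e)
  noOdd-if noB C = dirty C (λ f i _ _ r → noB (rotate G i C) f (Run-unrotate C i {0} r))
    λ x y hx hy x~y → case Odd.edge⇒run₄ C hx hy x~y of λ (D , r) → noB D y r

-- For t ≥ 4 the vertex opposite a run of length four is good.
noOdd-large : ∀ {n} (G : Graph n) → (∀ v → ¬ Good G v) → (∀ u → ¬ (∀ x → x ≢ u → Adj G u x)) → ∀ s →
  ¬ HasIndependentSet G (5 + s) → (∀ k → 4 ≤ k → k ≤ 5 + (suc s + suc s) → ¬ HasInducedCycle G k) →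
  ¬ Hole G (7 + (suc s + suc s))
noOdd-large {n} G noGood noUniversal s independence noShort = noOdd-if opposite
  where
  open OddAssembly G noGood noUniversal (suc s) independence noShort
  2≤e : 2 ≤ e
  2≤e = s≤s (subst (1 ≤_) (≡-sym (+-suc s s)) (s≤s z≤n))
  opposite : ∀ (C : Hole G (7 + e)) b → Run C 0 4 b → ⊥
  opposite C b rb = dirty (rotate G 3 C)
      -- The runs of four containing `c 6` start at `c 3`, ..., `c 6`. `far-run₄` covers them all
      -- because 3 ≤ 1 + e; for t = 3, where e = 0, it would only cover the first two.
      (λ f i i≤ off r → far-run₄ i (≤-trans i≤ (s≤s 2≤e)) (Off-back C 3 off)
        (subst (λ k → Run C k 4 f) (+-comm i 3) (Run-rotate C 3 r)))
      λ x y hx hy → far-anti 1 (≤-trans (n≤1+n 1) 2≤e) (X-rotate C 3 hx) (X-rotate C 3 hy)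
    where open Odd.Shortcut C rb

module OddSmall {n : ℕ} (G : Graph n) (noGood : ∀ v → ¬ Good G v)
  (noUniversal : ∀ u → ¬ (∀ x → x ≢ u → Adj G u x)) (noRing : ¬ Ring G)
  (independence : ¬ HasIndependentSet G 4)
  (noShort : ∀ k → 4 ≤ k → k ≤ 5 → ¬ HasInducedCycle G k) where
  open OddAssembly G noGood noUniversal 0 independence noShort
  open Run
  open X

  private
    1≤ : ∀ {j} → 1 ≤ 1 + j
    1≤ = s≤s z≤n
    2≤ : ∀ {j} → 2 ≤ 2 + j
    2≤ = s≤s 1≤
    3≤ : ∀ {j} → 3 ≤ 3 + j
    3≤ = s≤s 2≤
    4≤ : ∀ {j} → 4 ≤ 4 + j
    4≤ = s≤s 3≤
    5≤ : ∀ {j} → 5 ≤ 5 + j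
    5≤ = s≤s 4≤
    6≤ : ∀ {j} → 6 ≤ 6 + j
    6≤ = s≤s 5≤

  -- The cyclic order is c₆ y c₀ c₁ b₁ c₂ c₃ b₃ c₄ c₅ x.
  module Build (C : Hole G 7) {b₁ b₃ x y} (r₁ : Run C 0 4 b₁) (r₃ : Run C 2 4 b₃) (off₃ : Off C b₃)
    (hx : X C 4 x) (hy : X C 6 y) (x~y : x ~ y) where
    open Hole C
    module S₁ = Odd.Shortcut C r₁
    C₂ = rotate G 2 C
    module S₃ = Odd.Shortcut C₂ (Run-unrotate C 2 {0} r₃)

    x≢c₅ : x ≢ c 5
    x≢c₅ refl = hy .miss 6 3≤ ≤-refl (~-sym (subst (_~ y) (≡-sym (per 5)) x~y))
    x₅ : x ~ c 5
    x₅ = X-centre-adj odd≤ C hx x≢c₅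
    x≁ : ∀ k → 3 ≤ k → k < 7 → x ≁ c (k + 4)
    x≁ = hx .miss
    y≢c₇ : y ≢ c 7
    y≢c₇ refl = x≁ 3 ≤-refl 4≤ x~y
    y₀ : y ~ c 0
    y₀ = subst (y ~_) (per 0) (X-centre-adj odd≤ C hy y≢c₇)
    y₁ : y ~ c 1
    y₁ = subst (y ~_) (per 1) (hy .hit₂)
    y≁ : ∀ k → 2 ≤ k → k < 6 → y ≁ c k
    y≁ k 2≤k k< = hy .miss (1 + k) (s≤s 2≤k) (s≤s k<) ∘ subst (y ~_) (≡-sym (trans (cong c (eq k)) (per k)))
      where
      eq : ∀ k → 1 + k + 6 ≡ 7 + k
      eq = solve-∀
    x≁′ : ∀ k → k < 4 → x ≁ c k
    x≁′ k k< = hx .miss (3 + k) 3≤ (s≤s (s≤s (s≤s k<))) ∘ subst (x ~_) (≡-sym (trans (cong c (eq k)) (per k)))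
      where
      eq : ∀ k → 3 + k + 4 ≡ 7 + k
      eq = solve-∀
    b₁~ : ∀ k → k < 4 → b₁ ~ c k
    b₁~ k k< = subst (λ i → b₁ ~ c i) (+-identityʳ k) (r₁ .hit k k<)
    b₁≁ : ∀ k → 4 ≤ k → k < 7 → b₁ ≁ c k
    b₁≁ = S₁.b-miss
    b₃~ : ∀ k → k < 4 → b₃ ~ c (2 + k)
    b₃~ k k< = subst (λ i → b₃ ~ c i) (+-comm k 2) (r₃ .hit k k<)
    b₃≁₆ : b₃ ≁ c 6
    b₃≁₆ = r₃ .miss 4 ≤-refl 5≤
    b₃≁₀ : b₃ ≁ c 0
    b₃≁₀ = r₃ .miss 5 4≤ 6≤ ∘ subst (b₃ ~_) (≡-sym (per 0))
    b₃≁₁ : b₃ ≁ c 1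
    b₃≁₁ = r₃ .miss 6 4≤ ≤-refl ∘ subst (b₃ ~_) (≡-sym (per 1))

    -- On the even hole `b₁`, `c 3`, ..., `c 7` the vertex `b₃` sees `c 3`, `c 4`, `c 5` and misses
    -- `c 6`, so its run ends there and excludes `b₁`.
    b₁≁b₃ : b₁ ≁ b₃
    b₁≁b₃ a = EvenHole.three S₁.D (S₁.off-D (λ { refl → b₁≁ 4 ≤-refl 5≤ (b₃~ 2 3≤) }) off₃) 1 4
        (b₃≁₆ ∘ subst (b₃ ~_) (S₁.d-suc 3 3≤)) on .miss 5 3≤ ≤-refl
        (subst (b₃ ~_) (≡-sym (trans (Hole.per S₁.D 0) S₁.d-0)) (~-sym a))
      where
      on : ∀ j → j < 3 → b₃ ~ Hole.c S₁.D (j + 1)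
      on j j< = S₁.onD 0 j (≤-trans (<⇒≤ j<) 3≤) (subst (λ i → b₃ ~ c i) (eq j) (b₃~ (1 + j) (s≤s j<)))
        where
        eq : ∀ j → 2 + (1 + j) ≡ j + 3
        eq = solve-∀

    x∈D₁ : X S₁.D 2 x
    x∈D₁ = S₁.X-D 1 1≤ hx (5 , (x≁ 3 ≤-refl 4≤ ∘ subst (x ~_) (S₁.d-suc 4 ≤-refl)))
    x≁b₁ : x ≁ b₁
    x≁b₁ = x∈D₁ .miss 4 3≤ 5≤ ∘ subst (x ~_) (≡-sym (trans (Hole.per S₁.D 0) S₁.d-0))
    -- Otherwise `y` would see `c 6`, `c 7`, `b₁` on that even hole, and `x` and `y` would be copies
    -- of vertices at distance two, which `XX-anti` keeps apart.
    y≁b₁ : y ≁ b₁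
    y≁b₁ a = Even.XX-anti S₁.D x∈D₁ (Run⇒X S₁.D (EvenHole.three S₁.D (S₁.off-D y≢b₁ (X-off odd≤ C 6 hy y≢c₇)) 4 1
        (y≁ 3 2≤ 4≤ ∘ subst (y ~_) (S₁.d-suc 0 z≤n)) on)) x~y
      where
      y≢b₁ : y ≢ b₁
      y≢b₁ refl = b₁≁ 6 4≤ ≤-refl (hy .hit₀)
      on : ∀ j → j < 3 → y ~ Hole.c S₁.D (j + 4)
      on 0 _ = subst (y ~_) (≡-sym (S₁.d-suc 3 3≤)) (hy .hit₀)
      on 1 _ = subst (y ~_) (≡-sym (S₁.d-suc 4 ≤-refl)) (X-centre-adj odd≤ C hy y≢c₇)
      on 2 _ = subst (y ~_) (≡-sym (trans (Hole.per S₁.D 0) S₁.d-0)) a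
      on (suc (suc (suc _))) (s≤s (s≤s (s≤s ())))

    hy₂ : X C₂ 4 y
    hy₂ = record { hit₀ = hy .hit₀ ; hit₂ = hy .hit₂
      ; miss = λ j l≤ j< → hy .miss j l≤ j< ∘ subst (λ i → y ~ c i) (+-assoc j 4 2) }
    y∈D₃ : X S₃.D 2 y
    y∈D₃ = S₃.X-D 1 1≤ hy₂ (5 , (hy .miss 3 ≤-refl 4≤ ∘ subst (y ~_) (S₃.d-suc 4 ≤-refl)))
    y≁b₃ : y ≁ b₃
    y≁b₃ = y∈D₃ .miss 4 3≤ 5≤ ∘ subst (y ~_) (≡-sym (trans (Hole.per S₃.D 0) S₃.d-0))
    x≁b₃ : x ≁ b₃
    x≁b₃ a = Even.XX-anti S₃.D (Run⇒X S₃.D (EvenHole.three S₃.D (S₃.off-D x≢b₃ off-x) 0 3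
        (x≁ 3 ≤-refl 4≤ ∘ subst (x ~_) (S₃.d-suc 2 2≤)) on)) y∈D₃ x~y
      where
      x≢b₃ : x ≢ b₃
      x≢b₃ refl = b₃≁₆ (hx .hit₂)
      off-x : Off C₂ x
      off-x i = X-off odd≤ C 4 hx x≢c₅ (i + 2)
      on : ∀ j → j < 3 → x ~ Hole.c S₃.D (j + 0)
      on 0 _ = subst (x ~_) (≡-sym S₃.d-0) a
      on 1 _ = subst (x ~_) (≡-sym (S₃.d-suc 0 z≤n)) x₅
      on 2 _ = subst (x ~_) (≡-sym (S₃.d-suc 1 1≤)) (hx .hit₂)
      on (suc (suc (suc _))) (s≤s (s≤s (s≤s ())))

    z : ℕ → Fin n
    z 0 = c 6
    z 1 = y
    z 2 = c 0
    z 3 = c 1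
    z 4 = b₁
    z 5 = c 2
    z 6 = c 3
    z 7 = b₃
    z 8 = c 4
    z 9 = c 5
    z 10 = x
    z (suc (suc (suc (suc (suc (suc (suc (suc (suc (suc (suc i))))))))))) = z i

    c-far : ∀ i d → 2 ≤ d → d ≤ 5 → c i ≁ c (d + i)
    c-far i d 2≤d d≤ = far i d 2≤d (s≤s (s≤s d≤))

    z₁ : ∀ i → z i ~ z (1 + i)
    z₁ 0 = ~-sym (hy .hit₀)
    z₁ 1 = y₀
    z₁ 2 = link 0
    z₁ 3 = ~-sym (b₁~ 1 2≤)
    z₁ 4 = b₁~ 2 3≤
    z₁ 5 = link 2
    z₁ 6 = ~-sym (b₃~ 1 2≤)
    z₁ 7 = b₃~ 2 3≤
    z₁ 8 = link 4
    z₁ 9 = ~-sym x₅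
    z₁ 10 = hx .hit₂
    z₁ (suc (suc (suc (suc (suc (suc (suc (suc (suc (suc (suc i))))))))))) = z₁ i

    z₂ : ∀ i → z i ~ z (2 + i)
    z₂ 0 = subst (c 6 ~_) (per 0) (link 6)
    z₂ 1 = y₁
    z₂ 2 = ~-sym (b₁~ 0 1≤)
    z₂ 3 = link 1
    z₂ 4 = b₁~ 3 ≤-refl
    z₂ 5 = ~-sym (b₃~ 0 1≤)
    z₂ 6 = link 3
    z₂ 7 = b₃~ 3 ≤-refl
    z₂ 8 = ~-sym (hx .hit₀)
    z₂ 9 = link 5
    z₂ 10 = x~y
    z₂ (suc (suc (suc (suc (suc (suc (suc (suc (suc (suc (suc i))))))))))) = z₂ i

    z₃ : ∀ i → z i ≁ z (3 + i)
    z₃ 0 = ≁-sym (c-far 1 5 2≤ 5≤)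
    z₃ 1 = y≁b₁
    z₃ 2 = c-far 0 2 2≤ 2≤
    z₃ 3 = c-far 1 2 2≤ 2≤
    z₃ 4 = b₁≁b₃
    z₃ 5 = c-far 2 2 2≤ 2≤
    z₃ 6 = c-far 3 2 2≤ 2≤
    z₃ 7 = ≁-sym x≁b₃
    z₃ 8 = c-far 4 2 2≤ 2≤
    z₃ 9 = ≁-sym (y≁ 5 2≤ ≤-refl)
    z₃ 10 = x≁′ 0 1≤
    z₃ (suc (suc (suc (suc (suc (suc (suc (suc (suc (suc (suc i))))))))))) = z₃ i

    z₄ : ∀ i → z i ≁ z (4 + i)
    z₄ 0 = ≁-sym (b₁≁ 6 4≤ ≤-refl)
    z₄ 1 = y≁ 2 2≤ 3≤
    z₄ 2 = c-far 0 3 2≤ 3≤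
    z₄ 3 = ≁-sym b₃≁₁
    z₄ 4 = b₁≁ 4 4≤ 5≤
    z₄ 5 = c-far 2 3 2≤ 3≤
    z₄ 6 = ≁-sym (x≁′ 3 ≤-refl)
    z₄ 7 = b₃≁₆
    z₄ 8 = ≁-sym (y≁ 4 2≤ 5≤)
    z₄ 9 = ≁-sym (c-far 0 5 2≤ 5≤)
    z₄ 10 = x≁′ 1 2≤
    z₄ (suc (suc (suc (suc (suc (suc (suc (suc (suc (suc (suc i))))))))))) = z₄ i

    z₅ : ∀ i → z i ≁ z (5 + i)
    z₅ 0 = ≁-sym (c-far 2 4 2≤ 4≤)
    z₅ 1 = y≁ 3 2≤ 4≤
    z₅ 2 = ≁-sym b₃≁₀
    z₅ 3 = c-far 1 3 2≤ 3≤
    z₅ 4 = b₁≁ 5 4≤ 6≤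
    z₅ 5 = ≁-sym (x≁′ 2 3≤)
    z₅ 6 = c-far 3 3 2≤ 3≤
    z₅ 7 = ≁-sym y≁b₃
    z₅ 8 = ≁-sym (c-far 0 4 2≤ 4≤)
    z₅ 9 = ≁-sym (c-far 1 4 2≤ 4≤)
    z₅ 10 = x≁b₁
    z₅ (suc (suc (suc (suc (suc (suc (suc (suc (suc (suc (suc i))))))))))) = z₅ i

    ring : Ring G
    ring = record { z = z ; z-per = λ _ → refl ; near₁ = z₁ ; near₂ = z₂ ; far = far′ }
      where
      far′ : ∀ i d → 3 ≤ d → d ≤ 8 → z i ≁ z (d + i)
      far′ i 3 _ _ = z₃ i
      far′ i 4 _ _ = z₄ i
      far′ i 5 _ _ = z₅ i
      -- Distances 6, 7 and 8 are 5, 4 and 3 the other way round.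
      far′ i 6 _ _ = ≁-sym (z₅ (6 + i))
      far′ i 7 _ _ = ≁-sym (z₄ (7 + i))
      far′ i 8 _ _ = ≁-sym (z₃ (8 + i))
      far′ i 1 (s≤s ()) _
      far′ i 2 (s≤s (s≤s ())) _
      far′ i (suc (suc (suc (suc (suc (suc (suc (suc (suc d))))))))) _ (s≤s (s≤s (s≤s (s≤s (s≤s (s≤s (s≤s (s≤s ()))))))))

  -- At `c 6`, runs of four starting at `c 3` or `c 4` are excluded by the first shortcut and those
  -- at `c 5` or `c 6` by the second. The remaining defect is an edge between copies of `c 5` and
  -- `c 7`, which completes the ring.
  twoRuns : ∀ (C : Hole G 7) {b₁ b₃} → Run C 0 4 b₁ → Run C 2 4 b₃ → Off C b₃ → ⊥
  twoRuns C {b₁} {b₃} r₁ r₃ off₃ = dirty (rotate G 3 C) noB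
      λ x y hx hy x~y → noRing (Build.ring C r₁ r₃ off₃ (X-rotate C 3 hx) (X-rotate C 3 hy) x~y)
    where
    module S₁ = Odd.Shortcut C r₁
    C₂ = rotate G 2 C
    module S₃ = Odd.Shortcut C₂ (Run-unrotate C 2 {0} r₃)
    noB : ∀ f i → i ≤ 3 → Off (rotate G 3 C) f → ¬ Run (rotate G 3 C) i 4 f
    noB f 0 _ off r = S₁.far-run₄ 0 z≤n (Off-back C 3 off) (Run-rotate C 3 r)
    noB f 1 _ off r = S₁.far-run₄ 1 ≤-refl (Off-back C 3 off) (Run-rotate C 3 r)
    noB f 2 _ off r = S₃.far-run₄ 0 z≤n (λ i → Off-back C 3 off (i + 2)) (Run-unrotate C 2 {3} (Run-rotate C 3 r))
    noB f 3 _ off r = S₃.far-run₄ 1 ≤-refl (λ i → Off-back C 3 off (i + 2)) (Run-unrotate C 2 {4} (Run-rotate C 3 r))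
    noB f (suc (suc (suc (suc _)))) (s≤s (s≤s (s≤s ())))

  -- At `c 5` the shortcut leaves only runs of four starting at `c 2` or `c 5`. Either is at
  -- distance two from the given run, which is the situation of `twoRuns`.
  oneRun : ∀ (C : Hole G 7) b → Run C 0 4 b → ⊥
  oneRun C b rb = dirty (rotate G 2 C) noB λ x y hx hy → S.far-anti 0 z≤n (X-rotate C 2 hx) (X-rotate C 2 hy)
    where
    module S = Odd.Shortcut C rb
    noB : ∀ f i → i ≤ 3 → Off (rotate G 2 C) f → ¬ Run (rotate G 2 C) i 4 f
    noB f 0 _ off r = twoRuns C rb (Run-rotate C 2 r) (Off-back C 2 off)
    noB f 1 _ off r = S.far-run₄ 0 z≤n (Off-back C 2 off) (Run-rotate C 2 r)
    noB f 2 _ off r = S.far-run₄ 1 ≤-refl (Off-back C 2 off) (Run-rotate C 2 r)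
    noB f 3 _ off r = twoRuns (rotate G 5 C) (Run-unrotate C 5 {0} (Run-rotate C 2 r)) (Run-unrotate C 5 {2} (Run-up rb)) λ i → Run₄-off C rb (i + 5)
      where
      Run-up : ∀ {x} → Run C 0 4 x → Run C 7 4 x
      Run-up {x} r = record
        { hit = λ j j< → subst (x ~_) (≡-sym (up j)) (r .hit j j<)
        ; miss = λ j l j< → r .miss j l j< ∘ subst (x ~_) (up j) }
        where
        eq : ∀ j → j + 7 ≡ 7 + (j + 0)
        eq = solve-∀
        up : ∀ j → Hole.c C (j + 7) ≡ Hole.c C (j + 0)
        up j = trans (cong (Hole.c C) (eq j)) (Hole.per C (j + 0))
    noB f (suc (suc (suc (suc _)))) (s≤s (s≤s (s≤s ())))

  noOdd-small : ¬ Hole G 7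
  noOdd-small = noOdd-if oneRun

-- Inflations of the square of the 11-cycle

module RingCase {n : ℕ} (G : Graph n) (independence : ¬ HasIndependentSet G 4)
  (noShort : ∀ k → 4 ≤ k → k ≤ 5 → ¬ HasInducedCycle G k) where
  open Holes G 0 independence noShort public

  noIndependent₄ : ∀ {f a b d} → f ≢ a → f ≢ b → f ≢ d → a ≢ b → a ≢ d → b ≢ d →
    f ≁ a → f ≁ b → f ≁ d → a ≁ b → a ≁ d → b ≁ d → ⊥
  noIndependent₄ {f} {a} {b} {d} fa fb fd ab ad bd fa′ fb′ fd′ ab′ ad′ bd′ =
    independence (independentFamily G 4 g λ
      { 0 1 _ _ → fa , fa′ ; 0 2 _ _ → fb , fb′ ; 0 3 _ _ → fd , fd′ ; 1 2 _ _ → ab , ab′ ; 1 3 _ _ → ad , ad′ ; 2 3 _ _ → bd , bd′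
      ; 1 1 (s≤s ()) _ ; 2 1 (s≤s ()) _ ; 2 2 (s≤s (s≤s ())) _ ; (suc (suc (suc _))) 1 (s≤s ()) _
      ; (suc (suc (suc _))) 2 (s≤s (s≤s ())) _ ; (suc (suc (suc _))) 3 (s≤s (s≤s (s≤s ()))) _
      ; _ (suc (suc (suc (suc _)))) _ (s≤s (s≤s (s≤s (s≤s ())))) })
    where
    g : ℕ → Fin n
    g 0 = f
    g 1 = a
    g 2 = b
    g _ = d

  module Twins (R : Ring G) where
    open Ring R

    private
      f₃ : ∀ i → z i ≁ z (3 + i)
      f₃ i = far i 3 ≤-refl (m≤m+n 3 _)
      f₄ : ∀ i → z i ≁ z (4 + i)
      f₄ i = far i 4 (m≤m+n 3 _) (m≤m+n 4 _)
      f₅ : ∀ i → z i ≁ z (5 + i)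
      f₅ i = far i 5 (m≤m+n 3 _) (m≤m+n 5 _)
      f₆ : ∀ i → z i ≁ z (6 + i)
      f₆ i = far i 6 (m≤m+n 3 _) (m≤m+n 6 _)
      f₇ : ∀ i → z i ≁ z (7 + i)
      f₇ i = far i 7 (m≤m+n 3 _) (m≤m+n 7 _)
      d₃ : ∀ i → z i ≢ z (3 + i)
      d₃ i eq = f₄ i (subst (_~ z (4 + i)) (≡-sym eq) (near₁ (3 + i)))
      d₄ : ∀ i → z i ≢ z (4 + i)
      d₄ i eq = f₅ i (subst (_~ z (5 + i)) (≡-sym eq) (near₁ (4 + i)))
      d₆ : ∀ i → z i ≢ z (6 + i)
      d₆ i eq = f₇ i (subst (_~ z (7 + i)) (≡-sym eq) (near₁ (6 + i)))
      d₇ : ∀ i → z i ≢ z (7 + i)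
      d₇ i eq = f₆ i (subst (_~ z (6 + i)) (≡-sym eq) (~-sym (near₁ (6 + i))))

    OffRing : Fin n → Set
    OffRing f = ∀ k → f ≢ z k

    -- f has the neighbours of z (2 + i) on the ring, with no condition at z (2 + i) itself.
    Twin : ℕ → Fin n → Set
    Twin i f = (f ~ z i × f ~ z (1 + i) × f ~ z (3 + i) × f ~ z (4 + i)) ×
      (f ≁ z (5 + i) × f ≁ z (6 + i) × f ≁ z (7 + i) × f ≁ z (8 + i) × f ≁ z (9 + i) × f ≁ z (10 + i))

    abstract
      twin? : ∀ i f → Dec (Twin i f)
      twin? i f = ((_~?_ f (z i)) ×-dec (_~?_ f (z (1 + i))) ×-dec (_~?_ f (z (3 + i))) ×-dec (_~?_ f (z (4 + i)))) ×-dec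
        (¬? (_~?_ f (z (5 + i))) ×-dec ¬? (_~?_ f (z (6 + i))) ×-dec ¬? (_~?_ f (z (7 + i))) ×-dec
         ¬? (_~?_ f (z (8 + i))) ×-dec ¬? (_~?_ f (z (9 + i))) ×-dec ¬? (_~?_ f (z (10 + i))))

    private
      z-shift : ∀ i k → z (k + (11 + i)) ≡ z (k + i)
      z-shift i k = trans (cong z (eq k i)) (z-per (k + i))
        where
        eq : ∀ k i → k + (11 + i) ≡ 11 + (k + i)
        eq = solve-∀

      twin-along : ∀ {f} i j → (∀ k → z (k + i) ≡ z (k + j)) → Twin i f → Twin j f
      twin-along {f} i j eq ((a₀ , a₁ , a₃ , a₄) , (b₅ , b₆ , b₇ , b₈ , b₉ , b₁₀)) =
        (u 0 a₀ , u 1 a₁ , u 3 a₃ , u 4 a₄) , (w 5 b₅ , w 6 b₆ , w 7 b₇ , w 8 b₈ , w 9 b₉ , w 10 b₁₀)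
        where
        u : ∀ k → f ~ z (k + i) → f ~ z (k + j)
        u k = subst (f ~_) (eq k)
        w : ∀ k → f ≁ z (k + i) → f ≁ z (k + j)
        w k h = h ∘ subst (f ~_) (≡-sym (eq k))

    twin-up : ∀ {i f} → Twin i f → Twin (11 + i) f
    twin-up {i} = twin-along i (11 + i) (≡-sym ∘ z-shift i)

    twin-down : ∀ {i f} → Twin (11 + i) f → Twin i f
    twin-down {i} = twin-along (11 + i) i (z-shift i)

    self-twin : ∀ i → Twin i (z (2 + i))
    self-twin i = (~-sym (near₂ i) , ~-sym (near₁ (1 + i)) , near₁ (2 + i) , near₂ (2 + i)) ,
      (f₃ (2 + i) , f₄ (2 + i) , f₅ (2 + i) , f₆ (2 + i) , f₇ (2 + i) ,
       far (2 + i) 8 (m≤m+n 3 _) ≤-refl)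

    -- `z i` and `z (1 + i)` recur as `z (11 + i)` and `z (12 + i)`. Induced 4- and 5-cycles through
    -- these rule out neighbours, and independent sets of size four force the others; `n₁₀` combines
    -- both, which fixes the order of the steps.
    start : ∀ {f} → OffRing f → ∀ i → f ≁ z i → f ~ z (1 + i) → Twin (1 + i) f
    start {f} off i n₀ h₁ = (h₁ , h₂ , h₄ , h₅) , (n₆ , n₇ , n₈ , n₉ , n₁₀ , n₁₁)
      where
      n₁₁ : f ≁ z (11 + i)
      n₁₁ = n₀ ∘ subst (f ~_) (z-per i)
      h₁₂ : f ~ z (12 + i)
      h₁₂ = subst (f ~_) (≡-sym (z-per (1 + i))) h₁
      n₉ : f ≁ z (9 + i)
      n₉ h = noC₄ h (near₂ (9 + i)) (near₁ (11 + i)) (~-sym h₁₂) (off _) (d₃ (9 + i)) n₁₁ (f₃ (9 + i))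
      n₈ : f ≁ z (8 + i)
      n₈ h = noC₅ h (near₁ (8 + i)) (near₂ (9 + i)) (near₁ (11 + i)) (~-sym h₁₂) n₉ n₁₁ (f₃ (8 + i)) (f₄ (8 + i)) (f₃ (9 + i))
      n₇ : f ≁ z (7 + i)
      n₇ h = noC₅ h (near₂ (7 + i)) (near₂ (9 + i)) (near₁ (11 + i)) (~-sym h₁₂) n₉ n₁₁ (f₄ (7 + i)) (f₅ (7 + i)) (f₃ (9 + i))
      n₁₀ : f ≁ z (10 + i)
      n₁₀ h = noIndependent₄ (off _) (off _) (off _) (d₄ (7 + i)) (d₇ (7 + i)) (d₃ (11 + i))
          n₇ n₁₁ n₁₄ (f₄ (7 + i)) (f₇ (7 + i)) (f₃ (11 + i))
        where
        n₁₃ : f ≁ z (13 + i)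
        n₁₃ h₁₃ = noC₄ h (near₁ (10 + i)) (near₂ (11 + i)) (~-sym h₁₃) (off _) (d₃ (10 + i)) n₁₁ (f₃ (10 + i))
        n₁₄ : f ≁ z (14 + i)
        n₁₄ h₁₄ = noC₅ h (near₁ (10 + i)) (near₂ (11 + i)) (near₁ (13 + i)) (~-sym h₁₄) n₁₁ n₁₃ (f₃ (10 + i)) (f₄ (10 + i)) (f₃ (11 + i))
      h₂ : f ~ z (2 + i)
      h₂ = ~-stable λ n₂ → noIndependent₄ (off _) (off _) (off _) (d₃ (7 + i)) (d₆ (7 + i)) (d₃ (10 + i))
          n₇ n₁₀ (n₂ ∘ subst (f ~_) (z-per (2 + i))) (f₃ (7 + i)) (f₆ (7 + i)) (f₃ (10 + i))
      h₄ : f ~ z (4 + i)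
      h₄ = ~-stable λ n₄ → noIndependent₄ (off _) (off _) (off _) (d₃ (4 + i)) (d₆ (4 + i)) (d₃ (7 + i))
          n₄ n₇ n₁₀ (f₃ (4 + i)) (f₆ (4 + i)) (f₃ (7 + i))
      n₆ : f ≁ z (6 + i)
      n₆ h = noC₅ h (near₂ (6 + i)) (near₂ (8 + i)) (near₂ (10 + i)) (~-sym h₁₂) n₈ n₁₀ (f₄ (6 + i)) (f₆ (6 + i)) (f₄ (8 + i))
      h₅ : f ~ z (5 + i)
      h₅ = ~-stable λ n₅ → noIndependent₄ (off _) (off _) (off _) (d₃ (5 + i)) (d₆ (5 + i)) (d₃ (8 + i))
          n₅ n₈ n₁₁ (f₃ (5 + i)) (f₆ (5 + i)) (f₃ (8 + i))

    z-wrap : ∀ q r → z (q * 11 + r) ≡ z r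
    z-wrap zero r = refl
    z-wrap (suc q) r = trans (cong z (+-assoc 11 (q * 11) r)) (trans (z-per _) (z-wrap q r))

    z-mod : ∀ i → z (i % 11) ≡ z i
    z-mod i = ≡-sym (trans (cong z (trans (m≡m%n+[m/n]*n i 11) (+-comm (i % 11) _))) (z-wrap (i / 11) (i % 11)))

    z-mod′ : ∀ i → z (1 + i % 11) ≡ z (1 + i)
    z-mod′ i = ≡-sym (trans (cong (z ∘ suc) (trans (m≡m%n+[m/n]*n i 11) (+-comm (i % 11) _)))
      (trans (cong z (≡-sym (+-suc (i / 11 * 11) (i % 11)))) (z-wrap (i / 11) (1 + i % 11))))

    abstract
      classify : ∀ f → (∃ λ i → i < 11 × Twin i f) ⊎ (∀ k → f ~ z k)
      classify f with Finₚ.any? {n = 11} (λ k → f Finₚ.≟ z (2 + toℕ k))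
      ... | yes (k , eq) = inj₁ (toℕ k , Finₚ.toℕ<n k , subst (Twin (toℕ k)) (≡-sym eq) (self-twin (toℕ k)))
      ... | no none with Finₚ.any? {n = 11} (λ k → ¬? (_~?_ f (z (toℕ k))) ×-dec (_~?_ f (z (1 + toℕ k))))
      ...   | yes (k , n₀ , h₁) = inj₁ (found (toℕ k) (Finₚ.toℕ<n k) (start off (toℕ k) n₀ h₁))
        where
        off : OffRing f
        off k eq = none (fromℕ< (m%n<n (9 + k) 11) , trans eq (trans (≡-sym (z-per k))
          (≡-sym (trans (cong (λ j → z (2 + j)) (Finₚ.toℕ-fromℕ< (m%n<n (9 + k) 11))) two))))
          where
          two : z (2 + (9 + k) % 11) ≡ z (2 + (9 + k))
          two = ≡-sym (trans (cong (λ j → z (2 + j)) (trans (m≡m%n+[m/n]*n (9 + k) 11) (+-comm ((9 + k) % 11) _)))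
            (trans (cong z (≡-sym (trans (+-suc q (1 + r)) (cong suc (+-suc q r))))) (z-wrap ((9 + k) / 11) (2 + r))))
            where
            r q : ℕ
            r = (9 + k) % 11
            q = (9 + k) / 11 * 11
        found : ∀ i → i < 11 → Twin (1 + i) f → ∃ λ i → i < 11 × Twin i f
        found i i< t with i ≟ 10
        ... | yes refl = 0 , s≤s z≤n , twin-down t
        ... | no ne = 1 + i , s≤s (≤∧≢⇒< (≤-pred i<) ne) , t
      ...   | no none′ = inj₂ (backwards G 9 (λ i → f ~ z i) (λ i → subst (f ~_) (z-per i))
                (λ i h → back (10 + i) (subst (f ~_) (≡-sym (z-per i)) h)) (proj₁ some) (proj₂ some))
        where
        back : ∀ i → f ~ z (1 + i) → f ~ z i
        back i h = ~-stable λ n₀ → none′ (fromℕ< (m%n<n i 11) ,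
          (λ a → n₀ (subst (f ~_) (trans (cong z (Finₚ.toℕ-fromℕ< (m%n<n i 11))) (z-mod i)) a)) ,
          subst (f ~_) (≡-sym (trans (cong (z ∘ suc) (Finₚ.toℕ-fromℕ< (m%n<n i 11))) (z-mod′ i))) h)
        some : ∃ λ i → f ~ z i
        -- `z 3`, `z 6` and `z 9` are independent, so `f` sees one of them.
        some with _~?_ f (z 3) | _~?_ f (z 6) | _~?_ f (z 9)
        ... | yes h | _ | _ = 3 , h
        ... | _ | yes h | _ = 6 , h
        ... | _ | _ | yes h = 9 , h
        ... | no a | no b | no d = ⊥-elim (noIndependent₄ (λ eq → none (Fin.suc Fin.zero , eq))
                (λ eq → none (Fin.suc (Fin.suc (Fin.suc (Fin.suc Fin.zero))) , eq)) (λ eq → none (Fin.suc (Fin.suc (Fin.suc (Fin.suc (Fin.suc (Fin.suc (Fin.suc Fin.zero)))))) , eq))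
                (d₃ 3) (d₆ 3) (d₃ 6) a b d (f₃ 3) (f₆ 3) (f₃ 6))

    -- This and the next five lemmas show that distinct twins are adjacent exactly when their
    -- classes are at cyclic distance at most two: the classes are the parts of an inflation.
    twin-adj₀ : ∀ {i f g} → Twin i f → Twin i g → f ≢ g → f ~ g
    twin-adj₀ {i} ((a₀ , _ , _ , a₄) , _) ((b₀ , _ , _ , b₄) , _) ne = common ne a₀ a₄ b₀ b₄ (d₄ i) (f₄ i)

    twin-adj₁ : ∀ {i f g} → Twin i f → Twin (1 + i) g → f ≢ g → f ~ g
    twin-adj₁ {i} ((_ , a₁ , _ , a₄) , _) ((b₀ , _ , b₃ , _) , _) ne = common ne a₁ a₄ b₀ b₃ (d₃ (1 + i)) (f₃ (1 + i))

    twin-adj₂ : ∀ {i f g} → Twin i f → Twin (2 + i) g → f ≢ g → f ~ g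
    twin-adj₂ {i} {f} {g} (_ , (_ , _ , n₇ , n₈ , n₉ , n₁₀)) (_ , (m₇ , m₈ , m₉ , m₁₀ , _)) ne =
      ~-stable λ f≁g → noIndependent₄ ne
        (λ { refl → n₈ (near₁ (7 + i)) }) (λ { refl → n₉ (~-sym (near₁ (9 + i))) })
        (λ { refl → m₈ (near₁ (7 + i)) }) (λ { refl → m₉ (~-sym (near₁ (9 + i))) }) (d₃ (7 + i))
        f≁g n₇ n₁₀ m₇ m₁₀ (f₃ (7 + i))

    twin-far₃ : ∀ {i f g} → Twin i f → Twin (3 + i) g → f ≁ g
    twin-far₃ {i} {f} ((a₀ , _) , (_ , _ , n₇ , _ , n₉ , _)) ((_ , _ , _ , b₇) , (_ , m₉ , _ , m₁₁ , _)) f~g =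
      noC₅ f~g b₇ (near₂ (7 + i)) (near₂ (9 + i)) (~-sym (subst (f ~_) (≡-sym (z-per i)) a₀)) n₇ n₉ m₉ m₁₁ (f₄ (7 + i))

    twin-far₄ : ∀ {i f g} → Twin i f → Twin (4 + i) g → f ≁ g
    twin-far₄ {i} {f} ((a₀ , _) , (_ , _ , _ , n₈ , _ , n₁₀)) ((_ , _ , _ , b₈) , (_ , m₁₀ , m₁₁ , _)) f~g =
      noC₅ f~g b₈ (near₂ (8 + i)) (near₁ (10 + i)) (~-sym (subst (f ~_) (≡-sym (z-per i)) a₀)) n₈ n₁₀ m₁₀ m₁₁ (f₃ (8 + i))

    twin-far₅ : ∀ {i f g} → Twin i f → Twin (5 + i) g → f ≁ g
    twin-far₅ {i} {f} {g} ((a₀ , _) , (_ , _ , _ , n₈ , n₉ , _)) ((_ , _ , _ , b₉) , (m₁₀ , m₁₁ , _)) f~g =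
      noC₄ f~g b₉ (near₂ (9 + i)) (~-sym (subst (f ~_) (≡-sym (z-per i)) a₀))
        (λ { refl → n₈ (~-sym (near₁ (8 + i))) }) (λ { refl → m₁₀ (~-sym (near₁ (10 + i))) }) n₉ m₁₁

    full-universal : ∀ {u} → (∀ k → u ~ z k) → ∀ x → x ≢ u → u ~ x
    full-universal {u} hu x ne with classify x
    ... | inj₂ hx = ~-sym (common ne (hx 0) (hx 3) (hu 0) (hu 3) (d₃ 0) (f₃ 0))
    ... | inj₁ (i , _ , (a₀ , _ , _ , a₄) , _) = ~-sym (common ne a₀ a₄ (hu i) (hu (4 + i)) (d₄ i) (f₄ i))

    twin-unique : ∀ {i f} d → 1 ≤ d → d ≤ 10 → Twin i f → Twin (d + i) f → ⊥
    twin-unique 1 _ _ (_ , (b₅ , _)) ((_ , _ , _ , a₄) , _) = b₅ a₄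
    twin-unique 2 _ _ (_ , (b₅ , _)) ((_ , _ , a₃ , _) , _) = b₅ a₃
    twin-unique 3 _ _ (_ , (_ , b₆ , _)) ((_ , _ , a₃ , _) , _) = b₆ a₃
    twin-unique 4 _ _ (_ , (b₅ , _)) ((_ , a₁ , _) , _) = b₅ a₁
    twin-unique 5 _ _ (_ , (b₅ , _)) ((a₀ , _) , _) = b₅ a₀
    twin-unique 6 _ _ (_ , (_ , b₆ , _)) ((a₀ , _) , _) = b₆ a₀
    twin-unique 7 _ _ (_ , (_ , _ , b₇ , _)) ((a₀ , _) , _) = b₇ a₀
    twin-unique 8 _ _ (_ , (_ , _ , _ , b₈ , _)) ((a₀ , _) , _) = b₈ a₀
    twin-unique 9 _ _ (_ , (_ , _ , _ , _ , b₉ , _)) ((a₀ , _) , _) = b₉ a₀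
    twin-unique 10 _ _ (_ , (_ , _ , _ , _ , _ , b₁₀)) ((a₀ , _) , _) = b₁₀ a₀
    twin-unique (suc (suc (suc (suc (suc (suc (suc (suc (suc (suc (suc _))))))))))) _ (s≤s (s≤s (s≤s (s≤s (s≤s (s≤s (s≤s (s≤s (s≤s (s≤s ())))))))))) _ _

-- Counting and ranking in sets of vertices

count-∪ : ∀ {n} {f g h : Fin n → Bool} → (∀ x → f x ≡ true → g x ≡ true ⊎ h x ≡ true) → count f ≤ count g + count h
count-∪ {zero} _ = z≤n
count-∪ {suc n} {f} {g} {h} sub = ≤-trans (+-mono-≤ (bits (sub Fin.zero)) (count-∪ (sub ∘ Fin.suc)))
    (≤-reflexive (shuffle (bit (g Fin.zero)) (bit (h Fin.zero)) (count (g ∘ Fin.suc)) (count (h ∘ Fin.suc))))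
  where
  bits : ∀ {a b c} → (a ≡ true → b ≡ true ⊎ c ≡ true) → bit a ≤ bit b + bit c
  bits {false} _ = z≤n
  bits {true} {b} s with s refl
  ... | inj₁ refl = s≤s z≤n
  ... | inj₂ refl = m≤n+m 1 (bit b)
  shuffle : ∀ a b c d → (a + b) + (c + d) ≡ (a + c) + (b + d)
  shuffle = solve-∀

rank : ∀ {n} → (Fin n → Bool) → Fin n → ℕ
rank S Fin.zero = 0
rank S (Fin.suc x) = bit (S Fin.zero) + rank (S ∘ Fin.suc) x

rank< : ∀ {n} (S : Fin n → Bool) x → S x ≡ true → rank S x < count S
rank< S Fin.zero sx rewrite sx = s≤s z≤n
rank< S (Fin.suc x) sx = +-monoʳ-< (bit (S Fin.zero)) (rank< (S ∘ Fin.suc) x sx)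

select : ∀ {n} (S : Fin n → Bool) r → r < count S → ∃ λ x → S x ≡ true × rank S x ≡ r
select {suc n} S r r< with S Fin.zero in eq
select {suc n} S zero r< | true = Fin.zero , eq , refl
select {suc n} S (suc r) (s≤s r<) | true with select (S ∘ Fin.suc) r r<
... | x , sx , e = Fin.suc x , sx , trans (cong (λ b → bit b + rank (S ∘ Fin.suc) x) eq) (cong suc e)
select {suc n} S r r< | false with select (S ∘ Fin.suc) r r<
... | x , sx , e = Fin.suc x , sx , trans (cong (λ b → bit b + rank (S ∘ Fin.suc) x) eq) e

count-values : ∀ {n} (g : Fin n → ℕ) N (S : Fin n → Bool) → (∀ i → i < N → ∃ λ x → S x ≡ true × g x ≡ i) → N ≤ count S
count-values g zero S _ = z≤n
count-values {n} g (suc N) S h with h N ≤-refl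
... | x , sx , gx = ≤-trans (s≤s (count-values g N S′ h′)) (count-strict S′⊆S x sx x∉)
  where
  S′? : ∀ w → Dec (S w ≡ true × w ≢ x)
  S′? w = (S w Bool.≟ true) ×-dec ¬? (w Finₚ.≟ x)
  S′ : Fin n → Bool
  S′ = toSet S′?
  S′⊆S : ∀ w → S′ w ≡ true → S w ≡ true
  S′⊆S w m = proj₁ (toSet-out S′? m)
  x∉ : S′ x ≡ false
  x∉ = Boolₚ.¬-not λ m → proj₂ (toSet-out S′? m) refl
  h′ : ∀ i → i < N → ∃ λ w → S′ w ≡ true × g w ≡ i
  h′ i i< with h i (m<n⇒m<1+n i<)
  ... | w , sw , gw = w , toSet-in S′? (sw , λ { refl → <-irrefl (trans (≡-sym gw) gx) i< }) , gw

argmax : (g : ℕ → ℕ) → ∀ N → ∃ λ q → ∀ k → k < suc N → g k ≤ g q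
argmax g zero = 0 , λ { zero _ → ≤-refl ; (suc _) (s≤s ()) }
argmax g (suc N) with argmax g N
... | q , mx with ≤-total (g q) (g (suc N))
...   | inj₁ le = suc N , λ k k< → case m≤n⇒m<n∨m≡n (≤-pred k<) of λ
          { (inj₁ lt) → ≤-trans (mx k lt) le ; (inj₂ refl) → ≤-refl }
...   | inj₂ ge = q , λ k k< → case m≤n⇒m<n∨m≡n (≤-pred k<) of λ
          { (inj₁ lt) → mx k lt ; (inj₂ refl) → ge }

Colourable-mono : ∀ {n} (G : Graph n) {k k′} → k ≤ k′ → Colourable G k → Colourable G k′
Colourable-mono G le (c , proper) = (λ v → Fin.inject≤ (c v) le) , λ u v a e → proper u v a (Finₚ.inject≤-injective le le _ _ e)

-- A complete minor in an inflated ring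

module NoRing {n : ℕ} (G : Graph n) (independence : ¬ HasIndependentSet G 4)
  (noShort : ∀ k → 4 ≤ k → k ≤ 5 → ¬ HasInducedCycle G k)
  (noUniversal : ∀ u → ¬ (∀ x → x ≢ u → Adj G u x))
  (unbounded : ¬ HadwigerBound G) where
  open RingCase G independence noShort

  -- If the κ of `bw` were smaller, one more colour would still make G colourable with the κ of
  -- `bv`, whose minor then gives a bound. So κ is the same for all vertices.
  κ≤ : ∀ {v w} (bv : BoundWithout G v) (bw : BoundWithout G w) → BoundWithout.κ bv ≤ BoundWithout.κ bw
  κ≤ bv bw = ≮⇒≥ λ lt → unbounded (BoundWithout.κ bv , Colourable-mono G lt (colour-suc G unbounded bw) , BoundWithout.minor bv)

  rotateRing : ℕ → Ring G → Ring G
  rotateRing q R = record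
    { z = λ i → z (i + q) ; z-per = λ i → z-per (i + q) ; near₁ = λ i → near₁ (i + q) ; near₂ = λ i → near₂ (i + q)
    ; far = λ i d l u → subst (λ j → z (i + q) ≁ z j) (≡-sym (+-assoc d i q)) (far (i + q) d l u) }
    where open Ring R

  module _ (R : Ring G) where
    open Ring R
    open Twins R

    abstract
      classOf : ∀ k f → ∃ λ d → d < 11 × Twin (d + k) f
      classOf k f with Twins.classify (rotateRing k R) f
      ... | inj₁ h = h
      ... | inj₂ full = ⊥-elim (noUniversal f (Twins.full-universal (rotateRing k R) full))

    y : ℕ → ℕ
    y k = count (toSet (twin? k))

    Tri : ℕ → Fin n → Set
    Tri k f = Twin k f ⊎ Twin (1 + k) f ⊎ Twin (2 + k) f

    abstract
      tri? : ∀ k f → Dec (Tri k f)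
      tri? k f = twin? k f ⊎-dec twin? (1 + k) f ⊎-dec twin? (2 + k) f

    tri : ℕ → ℕ
    tri k = count (toSet (tri? k))

    y-per : ∀ k → y (11 + k) ≤ y k
    y-per k = count-mono {f = toSet (twin? (11 + k))} {g = toSet (twin? k)} λ f h → toSet-in (twin? k) {f} (twin-down (toSet-out (twin? (11 + k)) {f} h))

    tri-per : ∀ k → tri (11 + k) ≡ tri k
    tri-per k = ≤-antisym
      (count-mono {f = toSet (tri? (11 + k))} {g = toSet (tri? k)} λ f h → toSet-in (tri? k) {f} (Data.Sum.map twin-down (Data.Sum.map twin-down twin-down) (toSet-out (tri? (11 + k)) {f} h)))
      (count-mono {f = toSet (tri? k)} {g = toSet (tri? (11 + k))} λ f h → toSet-in (tri? (11 + k)) {f} (Data.Sum.map twin-up (Data.Sum.map twin-up twin-up) (toSet-out (tri? k) {f} h)))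

    tri-mod : ∀ k → tri k ≡ tri (k % 11)
    tri-mod k = trans (cong tri (trans (m≡m%n+[m/n]*n k 11) (+-comm (k % 11) _))) (wrap (k / 11) (k % 11))
      where
      wrap : ∀ q r → tri (q * 11 + r) ≡ tri r
      wrap zero r = refl
      wrap (suc q) r = trans (cong tri (+-assoc 11 (q * 11) r)) (trans (tri-per _) (wrap q r))

    -- `z (4 + k)` belongs to part `2 + k`, so its closed neighbourhood consists of the parts `k`,
    -- ..., `4 + k`.
    Nbhd : ℕ → Fin n → Set
    Nbhd k f = f ≡ z (4 + k) ⊎ z (4 + k) ~ f

    abstract
      nbhd? : ∀ k f → Dec (Nbhd k f)
      nbhd? k f = (f Finₚ.≟ z (4 + k)) ⊎-dec (_~?_ (z (4 + k)) f)

    nbhd-class : ∀ k f → Nbhd k f → Twin k f ⊎ Twin (1 + k) f ⊎ Tri (2 + k) f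
    nbhd-class k f (inj₁ refl) = inj₂ (inj₂ (inj₁ (self-twin (2 + k))))
    nbhd-class k f (inj₂ a) with classOf k f
    ... | 0 , _ , t = inj₁ t
    ... | 1 , _ , t = inj₂ (inj₁ t)
    ... | 2 , _ , t = inj₂ (inj₂ (inj₁ t))
    ... | 3 , _ , t = inj₂ (inj₂ (inj₂ (inj₁ t)))
    ... | 4 , _ , t = inj₂ (inj₂ (inj₂ (inj₂ t)))
    ... | 5 , _ , t = ⊥-elim (twin-far₃ (self-twin (2 + k)) t a)
    ... | 6 , _ , t = ⊥-elim (twin-far₄ (self-twin (2 + k)) t a)
    ... | 7 , _ , t = ⊥-elim (twin-far₅ (self-twin (2 + k)) t a)
    ... | 8 , _ , t = ⊥-elim (twin-far₅ t (twin-up (self-twin (2 + k))) (~-sym a))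
    ... | 9 , _ , t = ⊥-elim (twin-far₄ t (twin-up (self-twin (2 + k))) (~-sym a))
    ... | 10 , _ , t = ⊥-elim (twin-far₃ t (twin-up (self-twin (2 + k))) (~-sym a))
    ... | suc (suc (suc (suc (suc (suc (suc (suc (suc (suc (suc _)))))))))) , s≤s (s≤s (s≤s (s≤s (s≤s (s≤s (s≤s (s≤s (s≤s (s≤s (s≤s ())))))))))) , _

    -- Every colour of G - v is seen at `v`, and `v` itself counts as a further colour κ.
    κ<nbhd : ∀ k → (bw : BoundWithout G (z (4 + k))) → suc (BoundWithout.κ bw) ≤ count (toSet (nbhd? k))
    κ<nbhd k bw = count-values g (suc κ) (toSet (nbhd? k)) values
      where
      open BoundWithout bw
      v = z (4 + k)
      g : Fin n → ℕ
      g x with x Finₚ.≟ v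
      ... | yes _ = κ
      ... | no _ = c x
      g-v : g v ≡ κ
      g-v with v Finₚ.≟ v
      ... | yes _ = refl
      ... | no ne = ⊥-elim (ne refl)
      g-c : ∀ x → x ≢ v → g x ≡ c x
      g-c x ne with x Finₚ.≟ v
      ... | yes eq = ⊥-elim (ne eq)
      ... | no _ = refl
      values : ∀ i → i < suc κ → ∃ λ x → toSet (nbhd? k) x ≡ true × g x ≡ i
      values i i< with m≤n⇒m<n∨m≡n (≤-pred i<)
      ... | inj₂ refl = v , toSet-in (nbhd? k) {v} (inj₁ refl) , g-v
      ... | inj₁ lt with colour-seen G unbounded bw i lt
      ...   | x , a , eq = x , toSet-in (nbhd? k) {x} (inj₂ a) , trans (g-c x (λ e → ~⇒≢ a (≡-sym e))) eq

    five₁ : ∀ k → count (toSet (nbhd? k)) ≤ y k + (y (1 + k) + tri (2 + k))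
    five₁ k = ≤-trans (count-∪ {f = toSet (nbhd? k)} {g = toSet (twin? k)} {h = toSet rest?} λ f h → Data.Sum.map (toSet-in (twin? k) {f}) (toSet-in rest? {f}) (nbhd-class k f (toSet-out (nbhd? k) {f} h)))
        (+-monoʳ-≤ (y k) (count-∪ {f = toSet rest?} {g = toSet (twin? (1 + k))} {h = toSet (tri? (2 + k))}
          λ f h → Data.Sum.map (toSet-in (twin? (1 + k)) {f}) (toSet-in (tri? (2 + k)) {f}) (toSet-out rest? {f} h)))
      where
      rest? : ∀ f → Dec (Twin (1 + k) f ⊎ Tri (2 + k) f)
      rest? f = twin? (1 + k) f ⊎-dec tri? (2 + k) f

    five₂ : ∀ k → count (toSet (nbhd? k)) ≤ y k + (tri (1 + k) + y (4 + k))
    five₂ k = ≤-trans (count-∪ {f = toSet (nbhd? k)} {g = toSet (twin? k)} {h = toSet rest?} λ f h → Data.Sum.map (toSet-in (twin? k) {f}) (toSet-in rest? {f}) (regroup (nbhd-class k f (toSet-out (nbhd? k) {f} h))))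
        (+-monoʳ-≤ (y k) (count-∪ {f = toSet rest?} {g = toSet (tri? (1 + k))} {h = toSet (twin? (4 + k))}
          λ f h → Data.Sum.map (toSet-in (tri? (1 + k)) {f}) (toSet-in (twin? (4 + k)) {f}) (toSet-out rest? {f} h)))
      where
      rest? : ∀ f → Dec (Tri (1 + k) f ⊎ Twin (4 + k) f)
      rest? f = tri? (1 + k) f ⊎-dec twin? (4 + k) f
      regroup : ∀ {f} → Twin k f ⊎ Twin (1 + k) f ⊎ Tri (2 + k) f → Twin k f ⊎ Tri (1 + k) f ⊎ Twin (4 + k) f
      regroup (inj₁ t) = inj₁ t
      regroup (inj₂ (inj₁ t)) = inj₂ (inj₁ (inj₁ t))
      regroup (inj₂ (inj₂ (inj₁ t))) = inj₂ (inj₁ (inj₂ (inj₁ t)))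
      regroup (inj₂ (inj₂ (inj₂ (inj₁ t)))) = inj₂ (inj₁ (inj₂ (inj₂ t)))
      regroup (inj₂ (inj₂ (inj₂ (inj₂ t)))) = inj₂ (inj₂ t)

  -- Positions 0, 1, 2 carry a largest clique Q.  Every label λ < d outside Q occurs in two consecutive
  -- positions among 3, …, 10 and in 3 or 10: labels are handed out from below at odd positions and
  -- from above at even ones.
  module Model (R : Ring G) {v₀} (bw : BoundWithout G v₀) (largest : ∀ k → tri R k ≤ tri R 0)
    (seen : ∀ k → suc (BoundWithout.κ bw) ≤ count (toSet (nbhd? R k))) where
    open Ring R
    open Twins R
    open BoundWithout bw using (κ)

    ω d : ℕ
    ω = tri R 0
    d = suc κ ∸ ω

    -- Five consecutive parts have at least `suc κ` vertices and three of them at most `ω`, so the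
    -- other two have at least `d`. Here the last three are taken off, in `cross` the middle three.
    pair : ∀ k → d ≤ y R k + y R (1 + k)
    pair k = m≤n+o⇒m∸n≤o (suc κ) ω (≤-trans (seen k) (≤-trans (five₁ R k)
      (≤-trans (+-monoʳ-≤ (y R k) (+-monoʳ-≤ (y R (1 + k)) (largest (2 + k)))) (≤-reflexive (eq (y R k) (y R (1 + k)) ω)))))
      where
      eq : ∀ a b c → a + (b + c) ≡ c + (a + b)
      eq = solve-∀

    cross : d ≤ y R 3 + y R 10
    cross = m≤n+o⇒m∸n≤o (suc κ) ω (≤-trans (seen 10) (≤-trans (five₂ R 10)
      (≤-trans (+-monoʳ-≤ (y R 10) (+-mono-≤ (largest 11) (y-per R 3))) (≤-reflexive (eq (y R 10) ω (y R 3))))))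
      where
      eq : ∀ a b c → a + (b + c) ≡ b + (c + a)
      eq = solve-∀

    class : Fin n → ℕ
    class f = proj₁ (classOf R 0 f)
    class-twin : ∀ f → Twin (class f) f
    class-twin f = subst (λ k → Twin k f) (+-identityʳ _) (proj₂ (proj₂ (classOf R 0 f)))
    class< : ∀ f → class f < 11
    class< f = proj₁ (proj₂ (classOf R 0 f))

    twin-injective : ∀ {i j f} → i < 11 → j < 11 → Twin i f → Twin j f → i ≡ j
    twin-injective {i} {j} {f} i< j< ti tj with <-cmp i j
    ... | tri≈ _ eq _ = eq
    ... | tri< lt _ _ = ⊥-elim (twin-unique (j ∸ i) (m<n⇒0<n∸m lt) (≤-trans (m∸n≤m j i) (≤-pred j<)) ti (subst (λ k → Twin k f) (≡-sym (m∸n+n≡m (<⇒≤ lt))) tj))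
    ... | tri> _ _ gt = ⊥-elim (twin-unique (i ∸ j) (m<n⇒0<n∸m gt) (≤-trans (m∸n≤m i j) (≤-pred i<)) tj (subst (λ k → Twin k f) (≡-sym (m∸n+n≡m (<⇒≤ gt))) ti))

    class-≡ : ∀ {k f} → k < 11 → Twin k f → class f ≡ k
    class-≡ {f = f} k< t = twin-injective (class< f) k< (class-twin f) t

    odd : ℕ → Bool
    odd zero = false
    odd (suc k) = Bool.not (odd k)

    -- Two parts of opposite parity fill the levels below `d` from opposite ends, so sizes adding up
    -- to `d` leave no gap. Neighbouring positions have opposite parity, and so have 3 and 10.
    level : ℕ → ℕ → ℕ
    level k r = if odd k then r else d ∸ suc r

    -- A surplus vertex of a part gets `ω + d`, which is at least `suc κ` and so in no branch set.
    label : ℕ → ℕ → ℕ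
    label k r with r <? d
    ... | yes _ = ω + level k r
    ... | no _ = ω + d

    abstract
      ψ : Fin n → ℕ
      ψ f with tri? R 0 f
      ... | yes _ = rank (toSet (tri? R 0)) f
      ... | no _ = label (class f) (rank (toSet (twin? (class f))) f)

    Label : ℕ → ℕ → Fin n → Set
    Label l k f = Twin k f × ψ f ≡ ω + l

    abstract
      ψ-clique : ∀ i → i < ω → ∃ λ f → Tri R 0 f × ψ f ≡ i
      ψ-clique i i< with select (toSet (tri? R 0)) i i<
      ... | f , m , r = f , t , value
        where
        t : Tri R 0 f
        t = toSet-out (tri? R 0) {f} m
        value : ψ f ≡ i
        value with tri? R 0 f
        ... | yes _ = r
        ... | no h = ⊥-elim (h t)

      ψ<ω : ∀ f → ψ f < ω → Tri R 0 f
      ψ<ω f lt with tri? R 0 f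
      ... | yes h = h
      ... | no _ = ⊥-elim (≤⇒≯ (low (class f) (rank (toSet (twin? (class f))) f)) lt)
        where
        low : ∀ k r → ω ≤ label k r
        low k r with r <? d
        ... | yes _ = m≤m+n ω _
        ... | no _ = m≤m+n ω d

      outer : ∀ f l → ψ f ≡ ω + l → ∃ λ k → 3 ≤ k × k ≤ 10 × Twin k f
      outer f l eq with tri? R 0 f
      ... | yes h = ⊥-elim (<-irrefl eq (<-≤-trans (rank< (toSet (tri? R 0)) f (toSet-in (tri? R 0) {f} h)) (m≤m+n ω l)))
      ... | no h = go (class f) (class< f) (class-twin f)
        where
        go : ∀ k → k < 11 → Twin k f → ∃ λ k → 3 ≤ k × k ≤ 10 × Twin k f
        go 0 _ t = ⊥-elim (h (inj₁ t))
        go 1 _ t = ⊥-elim (h (inj₂ (inj₁ t)))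
        go 2 _ t = ⊥-elim (h (inj₂ (inj₂ t)))
        go (suc (suc (suc k))) k< t = 3 + k , s≤s (s≤s (s≤s z≤n)) , ≤-pred k< , t

      realise : ∀ k r → 3 ≤ k → k ≤ 10 → r < d → r < y R k → ∃ λ f → Label (level k r) k f
      realise k r 3≤ k≤ r<d r<y with select (toSet (twin? k)) r r<y
      ... | f , m , rk = f , t , value
        where
        t : Twin k f
        t = toSet-out (twin? k) {f} m
        k<11 : ∀ {j} → j ≤ 2 → j < 11
        k<11 j≤ = s≤s (≤-trans j≤ (s≤s (s≤s z≤n)))
        small : ∀ {j} → j ≤ 2 → ¬ Twin j f
        small {j} j≤ t′ = ≤⇒≯ 3≤ (s≤s (≤-trans (≤-reflexive (twin-injective (s≤s k≤) (k<11 j≤) t t′)) j≤))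
        not-tri : ¬ Tri R 0 f
        not-tri (inj₁ t′) = small z≤n t′
        not-tri (inj₂ (inj₁ t′)) = small (s≤s z≤n) t′
        not-tri (inj₂ (inj₂ t′)) = small ≤-refl t′
        label-yes : label k r ≡ ω + level k r
        label-yes with r <? d
        ... | yes _ = refl
        ... | no h = ⊥-elim (h r<d)
        value : ψ f ≡ ω + level k r
        value with tri? R 0 f
        ... | yes h = ⊥-elim (not-tri h)
        ... | no _ rewrite class-≡ (s≤s k≤) t | rk = label-yes

    module Branch {l} (l<d : l < d) where

      Has : ℕ → Set
      Has k = ∃ λ f → Label l k f

      abstract
        -- If `l` is not below the size of part `i`, then part `j` has at least `d ∸ l` vertices,
        -- and its vertex of rank `d ∸ suc l` has level `l`.
        has-one : ∀ i j → 3 ≤ i → i ≤ 10 → 3 ≤ j → j ≤ 10 → odd i ≡ true → odd j ≡ false → d ≤ y R i + y R j → Has i ⊎ Has j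
        has-one i j 3≤i i≤ 3≤j j≤ oi oj le with l <? y R i
        ... | yes l<y = inj₁ (subst (λ l → ∃ λ f → Label l i f) (cong (λ b → if b then l else d ∸ suc l) oi) (realise i l 3≤i i≤ l<d l<y))
        ... | no l≮ = inj₂ (subst (λ l → ∃ λ f → Label l j f)
                (trans (cong (λ b → if b then d ∸ suc l else d ∸ suc (d ∸ suc l)) oj) back)
                (realise j (d ∸ suc l) 3≤j j≤ (≤-trans (≤-reflexive step₁) (m∸n≤m d l)) r<y))
          where
          step₁ : suc (d ∸ suc l) ≡ d ∸ l
          step₁ = ≡-sym (+-∸-assoc 1 l<d)
          back : d ∸ suc (d ∸ suc l) ≡ l
          back = trans (cong (d ∸_) step₁) (m∸[m∸n]≡n (<⇒≤ l<d))
          r<y : d ∸ suc l < y R j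
          r<y = ≤-trans (≤-reflexive step₁) (≤-trans (∸-monoˡ-≤ l le) (≤-trans (∸-monoˡ-≤ l (+-monoˡ-≤ (y R j) (≮⇒≥ l≮))) (≤-reflexive (m+n∸m≡n l (y R j)))))

        has-next : ∀ k → 3 ≤ k → k ≤ 9 → Has k ⊎ Has (1 + k)
        has-next k 3≤ k≤ with odd k in eq
        ... | true = has-one k (1 + k) 3≤ (m≤n⇒m≤1+n k≤) (m≤n⇒m≤1+n 3≤) (s≤s k≤) eq (cong Bool.not eq) (pair k)
        ... | false = swapped (has-one (1 + k) k (m≤n⇒m≤1+n 3≤) (s≤s k≤) 3≤ (m≤n⇒m≤1+n k≤) (cong Bool.not eq) eq
                (≤-trans (pair k) (≤-reflexive (+-comm (y R k) (y R (1 + k))))))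
          where
          swapped : Has (1 + k) ⊎ Has k → Has k ⊎ Has (1 + k)
          swapped (inj₁ h) = inj₂ h
          swapped (inj₂ h) = inj₁ h

        has-cross : Has 3 ⊎ Has 10
        has-cross = has-one 3 10 ≤-refl (m≤m+n 3 _) (m≤m+n 3 _) ≤-refl refl refl cross

      In : Fin n → Set
      In w = ψ w ≡ ω + l

      hop : ∀ {f g} → In f → In g → (f ≢ g → f ~ g) → WalkIn G In f g
      hop {f} {g} hf hg adj′ with f Finₚ.≟ g
      ... | yes refl = here hf
      ... | no ne = step hf (adj′ ne) (here hg)

      unhop : ∀ {f g} → In f → In g → (f ≢ g → f ~ g) → WalkIn G In g f
      unhop hf hg adj′ = walk-reverse G (hop hf hg adj′)

      3≤3 : 3 ≤ 3
      3≤3 = ≤-refl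
      3≤9 : 3 ≤ 9
      3≤9 = s≤s (s≤s (s≤s z≤n))

      first : Has 3 ⊎ Has 4 → ∃ λ f → (Twin 3 f ⊎ Twin 4 f) × In f
      first (inj₁ (f , t , hf)) = f , inj₁ t , hf
      first (inj₂ (f , t , hf)) = f , inj₂ t , hf

      root : Fin n
      root = proj₁ (first (has-next 3 3≤3 3≤9))

      root-class : (Twin 3 root ⊎ Twin 4 root) × In root
      root-class = proj₂ (first (has-next 3 3≤3 3≤9))

      -- One of any two consecutive outer positions carries the label, so successive occurrences are
      -- at most two positions apart and hence adjacent.
      spread : ∀ j → 3 + j ≤ 9 → ∀ f → Twin (3 + j) f ⊎ Twin (4 + j) f → In f → WalkIn G In root f
      spread zero _ f tf hf with root-class
      spread zero _ f (inj₁ t) hf | inj₁ r , hr = hop hr hf (twin-adj₀ r t)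
      spread zero _ f (inj₂ t) hf | inj₁ r , hr = hop hr hf (twin-adj₁ r t)
      spread zero _ f (inj₁ t) hf | inj₂ r , hr = unhop hf hr (twin-adj₁ t r)
      spread zero _ f (inj₂ t) hf | inj₂ r , hr = hop hr hf (twin-adj₀ r t)
      spread (suc j) le f (inj₁ t) hf = spread j (<⇒≤ le) f (inj₂ t) hf
      spread (suc j) le f (inj₂ t) hf with has-next (3 + j) (m≤m+n 3 _) (<⇒≤ le)
      ... | inj₁ (g , tg , hg) = walk-append G (spread j (<⇒≤ le) g (inj₁ tg) hg) (hop hg hf (twin-adj₂ tg t))
      ... | inj₂ (g , tg , hg) = walk-append G (spread j (<⇒≤ le) g (inj₂ tg) hg) (hop hg hf (twin-adj₁ tg t))

      connected : ∀ f → In f → WalkIn G In root f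
      connected f hf with outer f l hf
      ... | suc (suc (suc j)) , _ , k≤ , t with m≤n⇒m<n∨m≡n k≤
      ...   | inj₁ lt = spread j (≤-pred lt) f (inj₁ t) hf
      ...   | inj₂ refl = spread 6 ≤-refl f (inj₂ t) hf
      connected f hf | zero , () , _
      connected f hf | suc zero , s≤s () , _
      connected f hf | suc (suc zero) , s≤s (s≤s ()) , _

      -- Part 0 sees parts 9 and 10, and part 2 sees parts 3 and 4, both consecutive pairs. The
      -- outer parts seen by part 1 are 3 and 10, which is where `cross` is needed.
      touches : ∀ f → Tri R 0 f → ∃ λ g → In g × (f ≢ g → f ~ g)
      touches f (inj₁ t) with has-next 9 3≤9 ≤-refl
      ... | inj₁ (g , tg , hg) = g , hg , λ ne → ~-sym (twin-adj₂ tg (twin-up t) (ne ∘ ≡-sym))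
      ... | inj₂ (g , tg , hg) = g , hg , λ ne → ~-sym (twin-adj₁ tg (twin-up t) (ne ∘ ≡-sym))
      touches f (inj₂ (inj₁ t)) with has-cross
      ... | inj₁ (g , tg , hg) = g , hg , twin-adj₂ t tg
      ... | inj₂ (g , tg , hg) = g , hg , λ ne → ~-sym (twin-adj₂ tg (twin-up t) (ne ∘ ≡-sym))
      touches f (inj₂ (inj₂ t)) with has-next 3 3≤3 3≤9
      ... | inj₁ (g , tg , hg) = g , hg , twin-adj₁ t tg
      ... | inj₂ (g , tg , hg) = g , hg , twin-adj₂ t tg

    split : ∀ i → i < suc κ → i < ω ⊎ ∃ λ l → l < d × i ≡ ω + l
    split i i< with i <? ω
    ... | yes lt = inj₁ lt
    ... | no ge = inj₂ (i ∸ ω , ∸-monoˡ-< i< (≮⇒≥ ge) , ≡-sym (m+[n∸m]≡n (≮⇒≥ ge)))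

    tri-adj : ∀ {f g} → Tri R 0 f → Tri R 0 g → f ≢ g → f ~ g
    tri-adj (inj₁ s) (inj₁ t) ne = twin-adj₀ s t ne
    tri-adj (inj₁ s) (inj₂ (inj₁ t)) ne = twin-adj₁ s t ne
    tri-adj (inj₁ s) (inj₂ (inj₂ t)) ne = twin-adj₂ s t ne
    tri-adj (inj₂ (inj₁ s)) (inj₁ t) ne = ~-sym (twin-adj₁ t s (ne ∘ ≡-sym))
    tri-adj (inj₂ (inj₁ s)) (inj₂ (inj₁ t)) ne = twin-adj₀ s t ne
    tri-adj (inj₂ (inj₁ s)) (inj₂ (inj₂ t)) ne = twin-adj₁ s t ne
    tri-adj (inj₂ (inj₂ s)) (inj₁ t) ne = ~-sym (twin-adj₂ t s (ne ∘ ≡-sym))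
    tri-adj (inj₂ (inj₂ s)) (inj₂ (inj₁ t)) ne = ~-sym (twin-adj₁ t s (ne ∘ ≡-sym))
    tri-adj (inj₂ (inj₂ s)) (inj₂ (inj₂ t)) ne = twin-adj₀ s t ne

    centre : ℕ → Fin n
    centre i with i <? suc κ
    ... | no _ = z 0
    ... | yes i< with split i i<
    ...   | inj₁ lt = proj₁ (ψ-clique i lt)
    ...   | inj₂ (l , l< , _) = Branch.root l<

    ψ-centre : ∀ i → i < suc κ → ψ (centre i) ≡ i
    ψ-centre i i< with i <? suc κ
    ... | no h = ⊥-elim (h i<)
    ... | yes i<′ with split i i<′
    ...   | inj₁ lt = proj₂ (proj₂ (ψ-clique i lt))
    ...   | inj₂ (l , l< , eq) = trans (proj₂ (Branch.root-class l<)) (≡-sym eq)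

    centre-walk : ∀ i x → i < suc κ → ψ x ≡ i → WalkIn G (λ w → ψ w ≡ i) (centre i) x
    centre-walk i x i< eq with i <? suc κ
    ... | no h = ⊥-elim (h i<)
    ... | yes i<′ with split i i<′
    ...   | inj₂ (l , l< , refl) = Branch.connected l< x eq
    ...   | inj₁ lt with ψ-clique i lt
    ...     | f , tf , ef with f Finₚ.≟ x
    ...       | yes refl = here ef
    ...       | no ne = step ef (tri-adj tf (ψ<ω x (subst (_< ω) (≡-sym eq) lt)) ne) (here eq)

    joins : ∀ i j → i < j → j < suc κ → ∃ λ u → ∃ λ w → ψ u ≡ i × ψ w ≡ j × u ~ w
    joins i j i<j j< with split i (<-trans i<j j<) | split j j<
    ... | inj₁ li | inj₁ lj with ψ-clique i li | ψ-clique j lj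
    ...   | f , tf , ef | g , tg , eg = f , g , ef , eg , tri-adj tf tg λ { refl → <-irrefl (trans (≡-sym ef) eg) i<j }
    joins i j i<j j< | inj₁ li | inj₂ (l , l< , refl) with ψ-clique i li
    ...   | f , tf , ef with Branch.touches l< f tf
    ...     | g , eg , adj′ = f , g , ef , eg , adj′ λ { refl → <-irrefl (trans (≡-sym ef) eg) i<j }
    joins i j i<j j< | inj₂ (l , l< , refl) | inj₁ lj = ⊥-elim (≤⇒≯ (m≤m+n ω l) (<-trans i<j lj))
    joins i j i<j j< | inj₂ (l , l< , refl) | inj₂ (l′ , l′< , refl)
      -- Both labels occur at position 5 or 6, and these two parts together are a clique.
      with Branch.has-next l< 5 (m≤m+n 3 _) (m≤m+n 5 _) | Branch.has-next l′< 5 (m≤m+n 3 _) (m≤m+n 5 _)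
    ...   | inj₁ (f , tf , ef) | inj₁ (g , tg , eg) = f , g , ef , eg , twin-adj₀ tf tg λ { refl → <-irrefl (trans (≡-sym ef) eg) i<j }
    ...   | inj₁ (f , tf , ef) | inj₂ (g , tg , eg) = f , g , ef , eg , twin-adj₁ tf tg λ { refl → <-irrefl (trans (≡-sym ef) eg) i<j }
    ...   | inj₂ (f , tf , ef) | inj₁ (g , tg , eg) = f , g , ef , eg , ~-sym (twin-adj₁ tg tf λ { refl → <-irrefl (trans (≡-sym ef) eg) i<j })
    ...   | inj₂ (f , tf , ef) | inj₂ (g , tg , eg) = f , g , ef , eg , twin-adj₀ tf tg λ { refl → <-irrefl (trans (≡-sym ef) eg) i<j }

    impossible : ⊥
    impossible = no-next-minor G unbounded bw (complete-minor G (suc κ) ψ centre ψ-centre centre-walk joins)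

  noRing : (∀ v → ¬ ¬ BoundWithout G v) → ¬ Ring G
  noRing ih R = ih (Ring.z R 0) λ bw → Model.impossible R′ bw largest λ k →
      -- The induction hypothesis at each `z (4 + k)` is doubly negated, but the inequality needed
      -- from it is decidable. `κ≤` transfers it to the fixed κ.
      decidable-stable (suc (BoundWithout.κ bw) ≤? count (toSet (nbhd? R′ k))) λ ≰ →
        ih (Ring.z R′ (4 + k)) λ bw′ → ≰ (≤-trans (s≤s (κ≤ bw bw′)) (κ<nbhd R′ k bw′))
    where
    q = proj₁ (argmax (tri R) 10)
    R′ = rotateRing q R
    largest : ∀ k → tri R′ k ≤ tri R′ 0
    largest k = ≤-trans
      (count-mono {f = toSet (tri? R′ k)} {g = toSet (tri? R (k + q))} λ f h → toSet-in (tri? R (k + q)) {f} (toSet-out (tri? R′ k) {f} h))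
      (≤-trans (≤-reflexive (tri-mod R (k + q)))
        (≤-trans (proj₂ (argmax (tri R) 10) ((k + q) % 11) (m%n<n (k + q) 11))
          (count-mono {f = toSet (tri? R q)} {g = toSet (tri? R′ 0)} λ f h → toSet-in (tri? R′ 0) {f} (toSet-out (tri? R q) {f} h))))

-- Induction on the number of vertices

delete : ∀ {n} → Fin (suc n) → Graph (suc n) → Graph n
delete v G = record
  { adj = λ x y → adj G (punchIn v x) (punchIn v y)
  ; sym = λ x y → Graph.sym G _ _
  ; irrefl = λ x → irrefl G _ }

delete-independent : ∀ {n} (G : Graph (suc n)) v {k} → HasIndependentSet (delete v G) k → HasIndependentSet G k
delete-independent G v (f , inj , ind) = (λ i → punchIn v (f i)) , (λ e → inj (Finₚ.punchIn-injective v _ _ e)) , ind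

delete-cycle : ∀ {n} (G : Graph (suc n)) v {k} → HasInducedCycle (delete v G) k → HasInducedCycle G k
delete-cycle G v (f , inj , cyc) = (λ i → punchIn v (f i)) , (λ e → inj (Finₚ.punchIn-injective v _ _ e)) , cyc

boundWithout : ∀ {n} (G : Graph (suc n)) v → HadwigerBound (delete v G) → BoundWithout G v
boundWithout {n} G v (κ , (col , proper) , model) = record
  { κ = κ ; c = c ; c<κ = c<κ ; proper = c-proper ; minor = minor ; avoids = avoids }
  where
  module M = MinorModel model
  c : Fin (suc n) → ℕ
  c x with v Finₚ.≟ x
  ... | yes _ = 0
  ... | no v≢x = toℕ (col (punchOut v≢x))
  c<κ : ∀ x → x ≢ v → c x < κ
  c<κ x x≢v with v Finₚ.≟ x
  ... | yes eq = ⊥-elim (x≢v (≡-sym eq))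
  ... | no v≢x = Finₚ.toℕ<n (col (punchOut v≢x))
  c-proper : ∀ x y → x ≢ v → y ≢ v → Adj G x y → c x ≢ c y
  c-proper x y x≢v y≢v a with v Finₚ.≟ x | v Finₚ.≟ y
  ... | yes eq | _ = ⊥-elim (x≢v (≡-sym eq))
  ... | no _ | yes eq = ⊥-elim (y≢v (≡-sym eq))
  ... | no p | no q = λ e → proper (punchOut p) (punchOut q)
          (Eq.subst₂ (Adj G) (≡-sym (Finₚ.punchIn-punchOut p)) (≡-sym (Finₚ.punchIn-punchOut q)) a) (Finₚ.toℕ-injective e)
  φ : Fin (suc n) → Maybe (Fin κ)
  φ x with v Finₚ.≟ x
  ... | yes _ = nothing
  ... | no v≢x = M.φ (punchOut v≢x)
  φ-in : ∀ w → φ (punchIn v w) ≡ M.φ w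
  φ-in w with v Finₚ.≟ punchIn v w
  ... | yes eq = ⊥-elim (Finₚ.punchInᵢ≢i v w (≡-sym eq))
  ... | no v≢ = cong M.φ (trans (Finₚ.punchOut-cong v refl) (Finₚ.punchOut-punchIn v))
  φ-out : ∀ x {i} → φ x ≡ just i → ∃ λ w → x ≡ punchIn v w × M.φ w ≡ just i
  φ-out x eq with v Finₚ.≟ x
  ... | no v≢x = punchOut v≢x , ≡-sym (Finₚ.punchIn-punchOut v≢x) , eq
  lift : ∀ {i x y} → WalkIn (delete v G) (λ w → M.φ w ≡ just i) x y → WalkIn G (λ w → φ w ≡ just i) (punchIn v x) (punchIn v y)
  lift (here p) = here (trans (φ-in _) p)
  lift (step p a w) = step (trans (φ-in _) p) a (lift w)
  minor : K κ ≼ G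
  minor = record
    { φ = φ
    ; nonempty = λ i → let (w , p) = M.nonempty i in punchIn v w , trans (φ-in w) p
    ; connected = λ i x y p q → case φ-out x p , φ-out y q of λ
        { ((w , refl , p′) , (w′ , refl , q′)) → lift (M.connected i w w′ p′ q′) }
    ; edges = λ i j h → let (x , y , p , q , a) = M.edges i j h in
        punchIn v x , punchIn v y , trans (φ-in x) p , trans (φ-in y) q , a }
  avoids : φ v ≡ nothing
  avoids with v Finₚ.≟ v
  ... | yes _ = refl
  ... | no ne = ⊥-elim (ne refl)

noOddHole : ∀ {n} (G : Graph n) → ¬ HadwigerBound G → (∀ v → ¬ ¬ BoundWithout G v) →
  (∀ v → ¬ Good G v) → (∀ u → ¬ (∀ x → x ≢ u → Adj G u x)) → ∀ s →
  ¬ HasIndependentSet G (4 + s) → (∀ k → 4 ≤ k → k ≤ 5 + (s + s) → ¬ HasInducedCycle G k) → ¬ Hole G (7 + (s + s))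
noOddHole G unbounded ih noGood noUniversal zero independence noShort =
  OddSmall.noOdd-small G noGood noUniversal (NoRing.noRing G independence noShort noUniversal unbounded ih) independence noShort
noOddHole G unbounded ih noGood noUniversal (suc s) independence noShort =
  noOdd-large G noGood noUniversal s independence noShort

hadwigerBound : ∀ n (G : Graph n) s → ¬ HasIndependentSet G (4 + s) →
  (∀ k → 4 ≤ k → k ≤ 5 + (s + s) → ¬ HasInducedCycle G k) → ¬ ¬ HadwigerBound G
hadwigerBound zero G s _ _ unbounded = unbounded (0 , ((λ ()) , λ ()) , record
  { φ = λ () ; nonempty = λ () ; connected = λ () ; edges = λ () })
hadwigerBound (suc n) G s independence noShort unbounded =
    chordal-simplicial G noHole (suc n) (λ _ → true) (count-≤ {suc n} λ _ → true) Fin.zero refl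
      λ v _ simp → EvenExclusion.noSimplicial G s independence noShort noGood v λ f g → simp f g refl refl
  where
  ih : ∀ v → ¬ ¬ BoundWithout G v
  ih v no-bw = hadwigerBound n (delete v G) s (independence ∘ delete-independent G v)
    (λ k l u → noShort k l u ∘ delete-cycle G v) (no-bw ∘ boundWithout G v)
  double : ∀ s → (3 + s) + (3 + s) ≡ 6 + (s + s)
  double = solve-∀
  noGood : ∀ v → ¬ Good G v
  noGood v g = ih v λ bw → no-good G unbounded (3 + s) independence
    (λ k l u → noShort k l (≤-pred (subst (k <_) (double s) u))) bw g
  noUniversal : ∀ u → ¬ (∀ x → x ≢ u → Adj G u x)
  noUniversal u univ = ih u λ bw → no-universal G unbounded u bw univ
  open Holes G s independence noShort
  noOdd : ¬ Hole G (7 + e)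
  noOdd = noOddHole G unbounded ih noGood noUniversal s independence noShort
  noHole : ∀ {v ℓ p} → IsApex G v ℓ p → ⊥
  noHole {v} {ℓ} {p} ap with ℓ ≤? 3 + e
  ... | yes short = noApex ap short
  ... | no long with m≤n⇒m<n∨m≡n (≰⇒> long)
  ...   | inj₂ refl = EvenExclusion.noEven G s independence noShort noGood noOdd (apexHole G ap)
  ...   | inj₁ longer with m≤n⇒m<n∨m≡n longer
  ...     | inj₂ refl = noOdd (apexHole G ap)
  -- A hole of length at least 2t + 2 contains t + 1 alternate vertices.
  ...     | inj₁ longest = independence (independentFamily G (4 + s) _
              (OnHole.alternate G (s≤s (s≤s (≤-trans (m≤m+n 3 _) longest))) (apexHole G ap) 0 (4 + s)
                (≤-trans (≤-reflexive (quad s)) (s≤s (s≤s longest)))))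
    where
    quad : ∀ s → (4 + s) + (4 + s) ≡ 8 + (s + s)
    quad = solve-∀

theorem2p3 : ∀ {n} (G : Graph n) (a c h : ℕ) →
    IsIndependenceNumber G a → 3 ≤ a →
    (∀ k → 4 ≤ k → k ≤ 2 * a ∸ 1 → ¬ HasInducedCycle G k) →
    IsChromaticNumber G c → IsHadwigerNumber G h →
    c ≤ h
theorem2p3 {n} G (suc (suc (suc s))) c h (_ , α≤) (s≤s (s≤s (s≤s z≤n))) noShort (_ , χ-least) (_ , h-greatest) =
  decidable-stable (c ≤? h) λ c≰h → hadwigerBound n G s (λ ind → <-irrefl refl (α≤ _ ind))
    (λ k 4≤k k≤ → noShort k 4≤k (≤-trans k≤ (≤-reflexive (length s))))
    λ (k , colouring , minor) → c≰h (≤-trans (χ-least k colouring) (h-greatest k minor))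
  where
  length : ∀ s → 5 + (s + s) ≡ 2 + s + (3 + s + 0)
  length = solve-∀
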